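{- If $G$ is a $30$-connected graph, then $G$ is $4$-linked. Consequently, $g(4)\le 30$.
   Context: Graphs are finite and simple. A graph is $m$-connected if it has more than $m$ vertices and deleting any set of fewer than $m$ vertices leaves a connected graph. For an integer $k\ge 2$, a graph $G$ is $k$-linked if it has at least $2k$ vertices and for every $2k$ distinct vertices $u_1,v_1,u_2,v_2,\ldots,u_k,v_k$ of $G$ there are $k$ pairwise vertex-disjoint paths $P_1,\ldots,P_k$ in $G$ such that $P_i$ connects $u_i$ and $v_i$ for each $i$. For $k\ge 2$, $g(k)$ denotes the least integer such that every $g(k)$-connected graph is $k$-linked. -}

module Defs where

open import Data.Fin.Base using (Fin)
open import Data.Fin.Subset using (Subset; ∣_∣; _∉_)
open import Data.List.Base using (List; head; last)
open import Data.List.Relation.Binary.Disjoint.Propositional using (Disjoint)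
open import Data.List.Relation.Unary.Linked using (Linked)
open import Data.List.Relation.Unary.Unique.Propositional using (Unique)
open import Data.Maybe.Base using (just)
open import Data.Nat.Base using (ℕ; _*_; _≤_; _<_)
open import Data.Product.Base using (_×_; Σ-syntax)
open import Data.Refinement using (Refinement-syntax; value)
open import Data.Sum.Base using ([_,_]′)
open import Function.Definitions using (Injective)
open import Level using (0ℓ)
open import Relation.Binary.Core using (Rel)
open import Relation.Binary.Definitions using (Decidable; Irreflexive; Symmetric)
open import Relation.Binary.PropositionalEquality using (_≡_; _≢_; refl)

record SimpleGraph (V : Set) : Set₁ where
  field
    Adj    : Rel V 0ℓ
    adj?   : Decidable Adj
    sym    : Symmetric Adj
    irrefl : Irreflexive _≡_ Adj

FiniteGraph : ℕ → Set₁
FiniteGraph n = SimpleGraph (Fin n)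

-- The trivial path, whose list of vertices is a singleton, is allowed.
record Path {V : Set} (G : SimpleGraph V) (u v : V) : Set where
  open SimpleGraph G
  field
    vertices : List V
    linked   : Linked Adj vertices
    distinct : Unique vertices
    starts   : head vertices ≡ just u
    ends     : last vertices ≡ just v

-- The graph without vertices would count as connected, but a graph with more
-- than m vertices never becomes empty by deleting fewer than m of them.
Connected : {V : Set} → SimpleGraph V → Set
Connected {V} G = (u v : V) → Path G u v

-- The proof of v ∉ S carried by a vertex of G ─ S is irrelevant, so vertices
-- of G ─ S are equal as soon as the underlying vertices of G are.
infixl 6 _─_
_─_ : ∀ {n} → FiniteGraph n → (S : Subset n) →
      SimpleGraph [ v ∈ Fin n ∣ v ∉ S ]
G ─ S = record
  { Adj    = λ u v → Adj (value u) (value v)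
  ; adj?   = λ u v → adj? (value u) (value v)
  ; sym    = sym
  ; irrefl = λ { refl → irrefl refl }
  }
  where open SimpleGraph G

infix 4 _-connected_ _-linked_

_-connected_ : ∀ {n} → ℕ → FiniteGraph n → Set
_-connected_ {n} m G =
  m < n × (∀ (S : Subset n) → ∣ S ∣ < m → Connected (G ─ S))

-- Injectivity of [ u , v ]′ says that the 2k terminals are distinct.
_-linked_ : ∀ {n} → ℕ → FiniteGraph n → Set
_-linked_ {n} k G =
  2 * k ≤ n ×
  (∀ (u v : Fin k → Fin n) → Injective _≡_ _≡_ [ u , v ]′ →
   Σ[ P ∈ (∀ i → Path G (u i) (v i)) ]
     (∀ i j → i ≢ j → Disjoint (Path.vertices (P i)) (Path.vertices (P j))))

ConnectivityForcesLinked : ℕ → ℕ → Set₁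
ConnectivityForcesLinked m k =
  ∀ {n} (G : FiniteGraph n) → m -connected G → k -linked G

-- IsG k m expresses g(k) = m. As a least element of an undecided set of
-- naturals, g(k) is not available constructively as a function of k.
IsG : ℕ → ℕ → Set₁
IsG k m =
  ConnectivityForcesLinked m k ×
  (∀ m′ → ConnectivityForcesLinked m′ k → m ≤ m′)

{-# OPTIONS --safe #-}
-- A set X of at most 8 vertices is massed if more than 15 |V ∖ X| edges meet V ∖ X,
-- while a set C that is cut off from X by fewer than |X| vertices meets at most 15 |C|
-- edges. In a 30-connected graph every such X is massed, and massed sets can be linked
-- in any prescribed way, by induction on the size of the graph. For let X be a minimal
-- counterexample. A separation of order less than |X| whose far side C can be routed is
-- removed by putting a clique on the separating set; a far side with more than 15 |C|
-- edges is smaller and massed, hence routable. So an edge outside X can be deleted unless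
-- edges are scarce, in which case some v ∉ X has at most 29 neighbours, and an edge can
-- be contracted unless it lies in 15 triangles. By Menger's theorem and the same
-- removal it suffices to route terminals within a K₈, or within the neighbourhood W of v.
--
-- Let W have at most 29 vertices, each with 15 neighbours in W. Two of four pairs in W
-- are joined by short disjoint paths, as otherwise a large clique appears by counting
-- neighbours. A third pair is joined in the rest F of W, the fourth through v. If F falls
-- apart instead, its smaller part is so dense that it is a clique up to a matching, and
-- together with v and an edge of each path it contains a K₈.

module Submission where

open import Data.Nat.Base using (ℕ; _≤_)
open import Data.Product.Base using (_×_; ∃-syntax)
open import Relation.Nullary.Negation.Core using (¬_)
open import Defs

open import Data.Bool.Base using (Bool; true; false; _∧_; _∨_; not; if_then_else_)
import Data.Bool.Properties as Bool
open import Data.Empty using (⊥; ⊥-elim; ⊥-elim-irr)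
open import Data.Fin.Base using (Fin; zero; suc; toℕ)
import Data.Fin.Properties as Fin
open import Data.Fin.Subset using (∣_∣)
open import Data.Fin.Subset.Properties using (anySubset?)
open import Data.Irrelevant using (Irrelevant; [_])
open import Data.List.Base using (List; []; _∷_; _++_; head; last; length)
open import Data.List.Membership.Propositional using () renaming (_∈_ to _∈ₗ_)
import Data.List.Properties as List
open import Data.List.Relation.Unary.All using (All; []; _∷_)
open import Data.List.Relation.Unary.AllPairs using ([]; _∷_)
open import Data.List.Relation.Unary.Any using (here; there)
open import Data.List.Relation.Unary.Linked using (Linked; []; [-]; _∷_)
open import Data.List.Relation.Unary.Unique.Propositional using (Unique)
open import Data.Maybe.Base using (just)
open import Data.Nat.Base using (zero; suc; _+_; _*_; _∸_; _<_; z≤n; s≤s; _≤ᵇ_)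
import Data.Nat.Properties as ℕ
open import Data.Nat.Properties using
  ( *-assoc; *-distribʳ-+; *-distribˡ-+; *-identityʳ; *-identityˡ; *-monoʳ-≤; *-monoˡ-≤;
    *-suc; *-zeroʳ; +-assoc; +-cancelʳ-≤; +-cancelˡ-≡; +-cancelˡ-≤; +-comm; +-identityʳ;
    +-mono-≤; +-monoʳ-≤; +-monoˡ-<; +-monoˡ-≤; +-suc; 0≢1+n; <-asym; <-cmp; <-irrefl;
    <-≤-connex; <-≤-trans; <⇒≤; <⇒≱; m+[n∸m]≡n; m+n∸m≡n; m∸n+n≡m; m≤m+n; m≤n+m; m≤n⇒m≤1+n;
    n≤1+n; n≮0; suc-injective; ≤-<-trans; ≤-antisym; ≤-pred; ≤-refl; ≤-reflexive; ≤-total;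
    ≤-trans; ≤ᵇ⇒≤; ≮⇒≥; ≰⇒> )
open import Data.Product.Base using (Σ-syntax; ∃; _,_; proj₁; proj₂)
open import Data.Refinement using (Refinement; value; proof; _,_)
open import Data.Sum.Base using (_⊎_; inj₁; inj₂; [_,_]′)
open import Data.Vec.Base using (Vec; []; _∷_; lookup; map; replicate; tabulate; zipWith)
import Data.Vec.Properties as Vec
open import Function.Definitions using (Injective)
open import Relation.Binary.Definitions using (tri<; tri≈; tri>)
open import Relation.Binary.PropositionalEquality
  using (_≡_; _≢_; refl; sym; trans; cong; cong₂; subst)
open import Relation.Nullary.Decidable using (_×-dec_)
open import Relation.Nullary.Decidable.Core using (Dec; yes; no; does)
import Algebra.Properties.CommutativeMonoid.Sum ℕ.+-0-commutativeMonoid as ℕSum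

-- Connectivity does not survive the deletion or contraction of an edge, whereas the conditions on
-- massed sets fail only through a separation of small order, which can itself be exploited. The
-- threshold 15 per vertex is half of the degree 30 that connectivity guarantees; edges are counted
-- as ordered pairs, so it appears as 30. Contracting v into u lowers the threshold by 15 and loses
-- the edges from v to u and to common neighbours. If u is a terminal, the edges from v to the other
-- terminals are lost too, since edges inside X are not counted. Therefore the 15 neighbours within
-- W are genuine only up to pairs of terminals, and the terminals to be linked in W must include
-- those of X that lie there. Of the 29 vertices of W, 8 are terminals and 21 are free. Every path
-- costs free vertices as well as degrees, and the constants of the linking balance the two losses:
-- a path of which a free vertex sees four vertices can be shortened, so each path costs a free
-- vertex at most three neighbours.

≤-respˡ : ∀ {k m n} → m ≡ n → m ≤ k → n ≤ k
≤-respˡ refl h = h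

≤-respʳ : ∀ {k m n} → m ≡ n → k ≤ m → k ≤ n
≤-respʳ refl h = h

-- Propositional reasoning by truth tables

𝟙 : Bool → ℕ
𝟙 true  = 1
𝟙 false = 0

infixr 2 _⇒_
infix  3 _≼_

-- Inequalities stand beside Boolean conclusions because cardinalities are compared pointwise, by
-- sums of values of `𝟙`.
data Goal : Set where
  _⇒_ : Bool → Goal → Goal
  !_  : Bool → Goal
  _≼_ : ℕ → ℕ → Goal

holds? : Goal → Bool
holds? (b ⇒ g) = not b ∨ holds? g
holds? (! b)   = b
holds? (m ≼ n) = m ≤ᵇ n

⟦_⟧ : Goal → Set
⟦ b ⇒ g ⟧ = b ≡ true → ⟦ g ⟧
⟦ ! b ⟧   = b ≡ true
⟦ m ≼ n ⟧ = m ≤ n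

≤ᵇ-true : ∀ m n → (m ≤ᵇ n) ≡ true → m ≤ n
≤ᵇ-true m n e = ≤ᵇ⇒≤ m n (subst Data.Bool.Base.T (sym e) _)

holds : ∀ g → holds? g ≡ true → ⟦ g ⟧
holds (true ⇒ g) p refl = holds g p
holds (! b)      p = p
holds (m ≼ n)    p = ≤ᵇ-true m n p

Schema : ℕ → Set
Schema zero    = Goal
Schema (suc n) = Bool → Schema n

valid? : ∀ n → Schema n → Bool
valid? zero    g = holds? g
valid? (suc n) f = valid? n (f true) ∧ valid? n (f false)

Valid : ∀ n → Schema n → Set
Valid zero    g = ⟦ g ⟧
Valid (suc n) f = ∀ b → Valid n (f b)

∧-left : ∀ {a b} → a ∧ b ≡ true → a ≡ true
∧-left {true} _ = refl

∧-right : ∀ {a b} → a ∧ b ≡ true → b ≡ true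
∧-right {true} p = p

-- The equation is closed by `refl`, since evaluating `valid?` runs through all assignments. Facts
-- about graphs enter as Boolean premises of the schema.
taut : ∀ n f → valid? n f ≡ true → Valid n f
taut zero    g p = holds g p
taut (suc n) f p true  = taut n (f true) (∧-left p)
taut (suc n) f p false = taut n (f false) (∧-right {valid? n (f true)} p)

-- Linear arithmetic: multiples of hypotheses are added up, and the resulting
-- inequality is compared with the goal coefficient by coefficient.

infixl 6 _⊕_
infixl 7 _⊛_
infix  3 ⊢_≼_
infixr 2 _·_≼_⇒_

data Exp (k : ℕ) : Set where
  var : Fin k → Exp k
  con : ℕ → Exp k
  _⊕_ : Exp k → Exp k → Exp k
  _⊛_ : ℕ → Exp k → Exp k

data Claim (k : ℕ) : Set where
  ⊢_≼_    : Exp k → Exp k → Claim k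
  _·_≼_⇒_ : ℕ → Exp k → Exp k → Claim k → Claim k

eval : ∀ {k} → Exp k → Vec ℕ k → ℕ
eval (var i) ρ = lookup ρ i
eval (con n) ρ = n
eval (e ⊕ f) ρ = eval e ρ + eval f ρ
eval (n ⊛ e) ρ = n * eval e ρ

interp : ∀ {k} → Claim k → Vec ℕ k → Set
interp (⊢ l ≼ r)       ρ = eval l ρ ≤ eval r ρ
interp (_ · l ≼ r ⇒ c) ρ = eval l ρ ≤ eval r ρ → interp c ρ

dot : ∀ {k} → Vec ℕ k → Vec ℕ k → ℕ
dot []      []      = 0
dot (a ∷ c) (x ∷ ρ) = a * x + dot c ρ

unit : ∀ {k} → Fin k → Vec ℕ k
unit zero    = 1 ∷ replicate _ 0
unit (suc i) = 0 ∷ unit i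

coeffs : ∀ {k} → Exp k → ℕ × Vec ℕ k
coeffs (var i) = 0 , unit i
coeffs (con n) = n , replicate _ 0
coeffs (e ⊕ f) = proj₁ (coeffs e) + proj₁ (coeffs f) , zipWith _+_ (proj₂ (coeffs e)) (proj₂ (coeffs f))
coeffs (n ⊛ e) = n * proj₁ (coeffs e) , map (n *_) (proj₂ (coeffs e))

+-exchange : ∀ a b c d → (a + b) + (c + d) ≡ (a + c) + (b + d)
+-exchange a b c d = trans (+-assoc a b (c + d)) (trans (cong (a +_)
  (trans (sym (+-assoc b c d)) (trans (cong (_+ d) (+-comm b c)) (+-assoc c b d))))
  (sym (+-assoc a c (b + d))))

dot-zero : ∀ {k} (ρ : Vec ℕ k) → dot (replicate k 0) ρ ≡ 0
dot-zero []      = refl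
dot-zero (x ∷ ρ) = dot-zero ρ

dot-unit : ∀ {k} (i : Fin k) ρ → dot (unit i) ρ ≡ lookup ρ i
dot-unit zero    (x ∷ ρ) = trans (cong₂ _+_ (*-identityˡ x) (dot-zero ρ)) (+-identityʳ x)
dot-unit (suc i) (x ∷ ρ) = dot-unit i ρ

dot-+ : ∀ {k} (c d ρ : Vec ℕ k) → dot (zipWith _+_ c d) ρ ≡ dot c ρ + dot d ρ
dot-+ []      []      []      = refl
dot-+ (a ∷ c) (b ∷ d) (x ∷ ρ) = trans (cong₂ _+_ (*-distribʳ-+ x a b) (dot-+ c d ρ))
  (+-exchange (a * x) (b * x) (dot c ρ) (dot d ρ))

dot-* : ∀ {k} n (c ρ : Vec ℕ k) → dot (map (n *_) c) ρ ≡ n * dot c ρ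
dot-* n []      []      = sym (*-zeroʳ n)
dot-* n (a ∷ c) (x ∷ ρ) = trans (cong₂ _+_ (*-assoc n a x) (dot-* n c ρ))
  (sym (*-distribˡ-+ n (a * x) (dot c ρ)))

value-coeffs : ∀ {k} → ℕ × Vec ℕ k → Vec ℕ k → ℕ
value-coeffs (n , c) ρ = n + dot c ρ

coeffs-correct : ∀ {k} (e : Exp k) ρ → eval e ρ ≡ value-coeffs (coeffs e) ρ
coeffs-correct (var i) ρ = sym (dot-unit i ρ)
coeffs-correct (con n) ρ = sym (trans (cong (n +_) (dot-zero ρ)) (+-identityʳ n))
coeffs-correct (e ⊕ f) ρ = trans (cong₂ _+_ (coeffs-correct e ρ) (coeffs-correct f ρ))
  (trans (+-exchange (proj₁ (coeffs e)) _ (proj₁ (coeffs f)) _)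
         (cong (proj₁ (coeffs e) + proj₁ (coeffs f) +_) (sym (dot-+ (proj₂ (coeffs e)) (proj₂ (coeffs f)) ρ))))
coeffs-correct (n ⊛ e) ρ = trans (cong (n *_) (coeffs-correct e ρ))
  (trans (*-distribˡ-+ n (proj₁ (coeffs e)) _) (cong (n * proj₁ (coeffs e) +_) (sym (dot-* n (proj₂ (coeffs e)) ρ))))

dominated? : ∀ {k} → Vec ℕ k → Vec ℕ k → Bool
dominated? []      []      = true
dominated? (a ∷ c) (b ∷ d) = (a ≤ᵇ b) ∧ dominated? c d

dot-mono : ∀ {k} (c d ρ : Vec ℕ k) → dominated? c d ≡ true → dot c ρ ≤ dot d ρ
dot-mono []      []      []      p = z≤n
dot-mono (a ∷ c) (b ∷ d) (x ∷ ρ) p = +-mono-≤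
  (*-monoˡ-≤ x (≤ᵇ-true a b (∧-left p))) (dot-mono c d ρ (∧-right {a ≤ᵇ b} p))

exp≤? : ∀ {k} → Exp k → Exp k → Bool
exp≤? l r = (proj₁ (coeffs l) ≤ᵇ proj₁ (coeffs r)) ∧ dominated? (proj₂ (coeffs l)) (proj₂ (coeffs r))

exp≤ : ∀ {k} (l r : Exp k) ρ → exp≤? l r ≡ true → eval l ρ ≤ eval r ρ
exp≤ l r ρ p = ≤-respˡ (sym (coeffs-correct l ρ)) (≤-trans
  (+-mono-≤ (≤ᵇ-true _ _ (∧-left p)) (dot-mono (proj₂ (coeffs l)) (proj₂ (coeffs r)) ρ
    (∧-right {proj₁ (coeffs l) ≤ᵇ proj₁ (coeffs r)} p)))
  (≤-reflexive (sym (coeffs-correct r ρ))))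

certified? : ∀ {k} → Exp k → Exp k → Claim k → Bool
certified? L R (⊢ l ≼ r)       = exp≤? (l ⊕ R) (r ⊕ L)
certified? L R (m · l ≼ r ⇒ c) = certified? (L ⊕ m ⊛ l) (R ⊕ m ⊛ r) c

-- `L` and `R` accumulate the chosen multiples of the hypotheses. As coefficients are natural
-- numbers, l ≤ r is certified in the form l + R ≤ r + L, from which L ≤ R and cancellation of R
-- give the goal.
certified : ∀ {k} (L R : Exp k) c ρ → eval L ρ ≤ eval R ρ → certified? L R c ≡ true → interp c ρ
certified L R (⊢ l ≼ r) ρ h p = +-cancelʳ-≤ (eval R ρ) _ _
  (≤-trans (exp≤ (l ⊕ R) (r ⊕ L) ρ p) (+-monoʳ-≤ (eval r ρ) h))
certified L R (m · l ≼ r ⇒ c) ρ h p q =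
  certified (L ⊕ m ⊛ l) (R ⊕ m ⊛ r) c ρ (+-mono-≤ h (*-monoʳ-≤ m q)) p

-- Curried, so that the variables of a claim can be named by a lambda.
Multi : Set → Set → ℕ → Set
Multi A B zero    = B
Multi A B (suc n) = A → Multi A B n

apply : ∀ {A B} n → Multi A B n → (Fin n → A) → B
apply zero    f x = f
apply (suc n) f x = apply n (f (x zero)) (λ i → x (suc i))

ForAll : ∀ n → (Vec ℕ n → Set) → Set
ForAll zero    P = P []
ForAll (suc n) P = ∀ x → ForAll n (λ ρ → P (x ∷ ρ))

forAll : ∀ n (P : Vec ℕ n → Set) → (∀ ρ → P ρ) → ForAll n P
forAll zero    P f = f []
forAll (suc n) P f x = forAll n (λ ρ → P (x ∷ ρ)) (λ ρ → f (x ∷ ρ))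

linear : ∀ k (f : Multi (Exp k) (Claim k) k) → certified? (con 0) (con 0) (apply k f var) ≡ true →
         ForAll k (interp (apply k f var))
linear k f p = forAll k _ (λ ρ → certified (con 0) (con 0) (apply k f var) ρ z≤n p)

-- Finite sets as Boolean functions, and their cardinalities

variable
  N : ℕ

VSet : ℕ → Set
VSet N = Fin N → Bool

infix 4 _∈_ _⊆_
infix 7 _==_

_∈_ : Fin N → VSet N → Set
x ∈ P = P x ≡ true

_⊆_ : VSet N → VSet N → Set
P ⊆ Q = ∀ {x} → x ∈ P → x ∈ Q

infixl 5 _∪_ _∖_ _∩_

_∪_ _∖_ _∩_ : VSet N → VSet N → VSet N
(P ∪ Q) x = P x ∨ Q x
(P ∖ Q) x = P x ∧ not (Q x)
(P ∩ Q) x = P x ∧ Q x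

∅ : VSet N
∅ _ = false

opaque
  _==_ : Fin N → Fin N → Bool
  x == y = does (x Fin.≟ y)

⁅_⁆ : Fin N → VSet N
⁅ x ⁆ y = y == x

does⁻ : ∀ {A : Set} (d : Dec A) → does d ≡ true → A
does⁻ (yes a) _ = a

does⁺ : ∀ {A : Set} (d : Dec A) → A → does d ≡ true
does⁺ (yes _) _ = refl
does⁺ (no ¬a) a = ⊥-elim (¬a a)

doesnt⁺ : ∀ {A : Set} (d : Dec A) → ¬ A → does d ≡ false
doesnt⁺ (yes a) ¬a = ⊥-elim (¬a a)
doesnt⁺ (no _)  _  = refl

opaque
  unfolding _==_

  ==⁻ : ∀ {x y : Fin N} → x == y ≡ true → x ≡ y
  ==⁻ {x = x} {y} = does⁻ (x Fin.≟ y)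

  ==⁻ˢ : ∀ {x y : Fin N} → x == y ≡ true → y ≡ x
  ==⁻ˢ p = sym (==⁻ p)

  ==⁺ : (x : Fin N) → x == x ≡ true
  ==⁺ x = does⁺ (x Fin.≟ x) refl

  ≢⇒≠ : ∀ {x y : Fin N} → x ≢ y → x == y ≡ false
  ≢⇒≠ {x = x} {y} = doesnt⁺ (x Fin.≟ y)

true≢false : ∀ {b} → b ≡ true → b ≡ false → ⊥
true≢false refl ()

absurd : ∀ {A : Set} {b} → b ≡ true → b ≡ false → A
absurd refl ()

¬true⇒false : ∀ {b} → ¬ (b ≡ true) → b ≡ false
¬true⇒false = Bool.¬-not

bool : ∀ b → (b ≡ true) ⊎ (b ≡ false)
bool true  = inj₁ refl
bool false = inj₂ refl

if-true : ∀ {A : Set} {b} {x y : A} → b ≡ true → (if b then x else y) ≡ x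
if-true refl = refl

if-false : ∀ {A : Set} {b} {x y : A} → b ≡ false → (if b then x else y) ≡ y
if-false refl = refl

not⁺ : ∀ {b} → b ≡ false → not b ≡ true
not⁺ refl = refl

not⁻ : ∀ {b} → not b ≡ true → b ≡ false
not⁻ {false} _ = refl

∧⁺ : ∀ {a b} → a ≡ true → b ≡ true → a ∧ b ≡ true
∧⁺ refl refl = refl

∨-introˡ : ∀ {a b} → a ≡ true → a ∨ b ≡ true
∨-introˡ refl = refl

∨-introʳ : ∀ {a b} → b ≡ true → a ∨ b ≡ true
∨-introʳ {true}  _ = refl
∨-introʳ {false} p = p

∨⁻ : ∀ {a b} → a ∨ b ≡ true → (a ≡ true) ⊎ (b ≡ true)
∨⁻ {true}  _ = inj₁ refl
∨⁻ {false} p = inj₂ p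

opaque
  anyᵇ allᵇ : VSet N → Bool
  anyᵇ P = does (Fin.any? (λ x → P x Bool.≟ true))
  allᵇ P = does (Fin.all? (λ x → P x Bool.≟ true))

  anyᵇ⁺ : ∀ {P : VSet N} {x} → x ∈ P → anyᵇ P ≡ true
  anyᵇ⁺ {P = P} p = does⁺ (Fin.any? (λ x → P x Bool.≟ true)) (_ , p)

  anyᵇ⁻ : ∀ {P : VSet N} → anyᵇ P ≡ true → ∃ (_∈ P)
  anyᵇ⁻ {P = P} = does⁻ (Fin.any? (λ x → P x Bool.≟ true))

  allᵇ⁺ : ∀ {P : VSet N} → (∀ x → x ∈ P) → allᵇ P ≡ true
  allᵇ⁺ {P = P} p = does⁺ (Fin.all? (λ x → P x Bool.≟ true)) p

  allᵇ⁻ : ∀ {P : VSet N} → allᵇ P ≡ true → ∀ x → x ∈ P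
  allᵇ⁻ {P = P} = does⁻ (Fin.all? (λ x → P x Bool.≟ true))

find : (P : VSet N) → ∃ (_∈ P) ⊎ (∀ x → P x ≡ false)
find P with bool (anyᵇ P)
... | inj₁ p = inj₁ (anyᵇ⁻ p)
... | inj₂ p = inj₂ (λ x → ¬true⇒false (λ q → true≢false (anyᵇ⁺ {P = P} q) p))

-- Opaque, so that sets can be inferred from their cardinalities.
opaque
  sum : (Fin N → ℕ) → ℕ
  sum = ℕSum.sum

  # : VSet N → ℕ
  # P = ℕSum.sum (λ i → 𝟙 (P i))

opaque
  unfolding sum # _==_

  #-sum : (P : VSet N) → # P ≡ sum (λ i → 𝟙 (P i))
  #-sum P = refl

  sum-cong : ∀ {f g : Fin N → ℕ} → (∀ i → f i ≡ g i) → sum f ≡ sum g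
  sum-cong = ℕSum.sum-cong-≗

  sum-+ : (f g : Fin N → ℕ) → sum (λ i → f i + g i) ≡ sum f + sum g
  sum-+ = ℕSum.∑-distrib-+

  sum-swap : (f : Fin N → Fin N → ℕ) → sum (λ i → sum (λ j → f i j)) ≡ sum (λ j → sum (λ i → f i j))
  sum-swap = ℕSum.∑-comm

  sum-mono : ∀ {f g : Fin N → ℕ} → (∀ i → f i ≤ g i) → sum f ≤ sum g
  sum-mono {zero}  h = z≤n
  sum-mono {suc N} h = +-mono-≤ (h zero) (sum-mono {N} (λ i → h (suc i)))

  sum-0 : ∀ {f : Fin N → ℕ} → (∀ i → f i ≡ 0) → sum f ≡ 0
  sum-0 {zero}  p = refl
  sum-0 {suc N} p = cong₂ _+_ (p zero) (sum-0 {N} (λ i → p (suc i)))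

  sum-δ : (x : Fin N) (p : VSet N) → sum (λ z → 𝟙 (z == x ∧ p z)) ≡ 𝟙 (p x)
  sum-δ {suc N} zero    p = trans (cong (𝟙 (p zero) +_) (sum-0 {N} (λ _ → refl))) (+-identityʳ _)
  sum-δ {suc N} (suc x) p = sum-δ {N} x (λ i → p (suc i))

  sum-≥ : ∀ c {P : VSet N} {f : Fin N → ℕ} → (∀ {x} → x ∈ P → c ≤ f x) → c * # P ≤ sum f
  sum-≥ {zero}  c h = ≤-reflexive (*-zeroʳ c)
  sum-≥ {suc N} c {P} {f} h = ≤-respˡ (sym (*-distribˡ-+ c (𝟙 (P zero)) _))
    (+-mono-≤ (first (P zero) h) (sum-≥ {N} c {λ i → P (suc i)} (λ {x} → h {suc x})))
    where
    first : ∀ b → (b ≡ true → c ≤ f zero) → c * 𝟙 b ≤ f zero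
    first true  k = ≤-respˡ (sym (*-identityʳ c)) (k refl)
    first false k = ≤-respˡ (sym (*-zeroʳ c)) z≤n

sum≤+ : ∀ {f g h : Fin N → ℕ} → (∀ i → f i ≤ g i + h i) → sum f ≤ sum g + sum h
sum≤+ {g = g} {h} p = ≤-respʳ (sum-+ g h) (sum-mono p)

𝟙-mono : ∀ {a b} → (a ≡ true → b ≡ true) → 𝟙 a ≤ 𝟙 b
𝟙-mono {false} h = z≤n
𝟙-mono {true}  h = ≤-reflexive (cong 𝟙 (sym (h refl)))

opaque
  unfolding sum #

  #-mono : ∀ {P Q : VSet N} → P ⊆ Q → # P ≤ # Q
  #-mono {P = P} {Q} h = sum-mono {g = λ i → 𝟙 (Q i)} (λ i → 𝟙-mono (h {i}))

  #-cong : ∀ {P Q : VSet N} → (∀ x → P x ≡ Q x) → # P ≡ # Q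
  #-cong h = sum-cong (λ i → cong 𝟙 (h i))

  #-empty : ∀ {P : VSet N} → (∀ x → P x ≡ false) → # P ≡ 0
  #-empty {P = P} h = sum-0 {f = λ i → 𝟙 (P i)} (λ i → cong 𝟙 (h i))

  #≤+ : ∀ {P Q R : VSet N} → (∀ i → 𝟙 (P i) ≤ 𝟙 (Q i) + 𝟙 (R i)) → # P ≤ # Q + # R
  #≤+ p = sum≤+ p

  #+≤ : ∀ {P Q R : VSet N} → (∀ i → 𝟙 (P i) + 𝟙 (Q i) ≤ 𝟙 (R i)) → # P + # Q ≤ # R
  #+≤ {P = P} {Q} {R} p = ≤-respˡ (sum-+ (λ i → 𝟙 (P i)) (λ i → 𝟙 (Q i))) (sum-mono {g = λ i → 𝟙 (R i)} p)

  #-delete : (P : VSet N) (x : Fin N) → # P ≡ 𝟙 (P x) + # (P ∖ ⁅ x ⁆)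
  #-delete P x = trans (sum-cong (λ i → lemma (i == x) (P i)))
    (trans (sum-+ (λ i → 𝟙 (i == x ∧ P i)) _) (cong (_+ # (P ∖ ⁅ x ⁆)) (sum-δ x P)))
    where
    lemma : ∀ a b → 𝟙 b ≡ 𝟙 (a ∧ b) + 𝟙 (b ∧ not a)
    lemma true  true  = refl
    lemma true  false = refl
    lemma false true  = refl
    lemma false false = refl

#-∪ : (P Q : VSet N) → # (P ∪ Q) ≤ # P + # Q
#-∪ P Q = #≤+ (λ i → taut 2 (λ p q → 𝟙 (p ∨ q) ≼ 𝟙 p + 𝟙 q) refl (P i) (Q i))

#-∖ : (P Q : VSet N) → # P ≤ # Q + # (P ∖ Q)
#-∖ P Q = #≤+ (λ i → taut 2 (λ p q → 𝟙 p ≼ 𝟙 q + 𝟙 (p ∧ not q)) refl (P i) (Q i))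

∈-∖⁅⁆ : ∀ {P : VSet N} {x y} → x ∈ P → x ≢ y → x ∈ P ∖ ⁅ y ⁆
∈-∖⁅⁆ p n = ∧⁺ p (not⁺ (≢⇒≠ n))

∖⁅⁆⁻ : ∀ {P : VSet N} {x y} → x ∈ P ∖ ⁅ y ⁆ → x ∈ P × x ≢ y
∖⁅⁆⁻ {P = P} {x} {y} p with x Fin.≟ y
... | yes refl = absurd (==⁺ x) (not⁻ (∧-right {P x} p))
... | no ¬e = ∧-left p , ¬e

#-delete-∈ : ∀ {P : VSet N} {x} → x ∈ P → # P ≡ suc (# (P ∖ ⁅ x ⁆))
#-delete-∈ {P = P} {x} p = trans (#-delete P x) (cong (λ b → 𝟙 b + # (P ∖ ⁅ x ⁆)) p)

#-strict : ∀ {P Q : VSet N} {x} → P ⊆ Q → x ∈ Q → P x ≡ false → # P < # Q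
#-strict {P = P} {Q} {x} s q p = ≤-trans
  (s≤s (#-mono {P = P} (λ {y} py → ∈-∖⁅⁆ {P = Q} (s py) (λ { refl → true≢false py p }))))
  (≤-reflexive (sym (#-delete-∈ {P = Q} q)))

#-pos : ∀ {P : VSet N} {x} → x ∈ P → 1 ≤ # P
#-pos {P = P} p = ≤-respʳ (sym (#-delete-∈ {P = P} p)) (s≤s z≤n)

#-pos⁻ : ∀ {P : VSet N} → 1 ≤ # P → ∃ (_∈ P)
#-pos⁻ {P = P} h with find P
... | inj₁ r = r
... | inj₂ r = ⊥-elim (<⇒≱ h (≤-reflexive (#-empty {P = P} r)))

#-unique : ∀ {P : VSet N} → (∀ {x y} → x ∈ P → y ∈ P → x ≡ y) → # P ≤ 1
#-unique {P = P} h with find P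
... | inj₂ r = ≤-respˡ (sym (#-empty {P = P} r)) z≤n
... | inj₁ (x , p) = ≤-reflexive (trans (#-delete-∈ {P = P} p) (cong suc (#-empty
  (λ y → ¬true⇒false (λ q → let q₁ , q₂ = ∖⁅⁆⁻ {P = P} q in q₂ (h q₁ p))))))

#-size<⇒∃ : ∀ {P Q : VSet N} → # P < # Q → ∃ (_∈ Q ∖ P)
#-size<⇒∃ {P = P} {Q} h = #-pos⁻ (+-cancelˡ-≤ (# P) _ _
  (≤-respˡ (sym (+-comm (# P) 1)) (≤-trans h (#-∖ Q P))))

sum-≤# : ∀ {P : VSet N} {f : Fin N → ℕ} → (∀ {x} → x ∈ P → f x ≤ 1) → (∀ {x} → P x ≡ false → f x ≡ 0) → sum f ≤ # P
sum-≤# {P = P} {f} h k = ≤-respʳ (sym (#-sum P)) (sum-mono (λ i → lemma i (bool (P i))))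
  where
  lemma : ∀ i → (P i ≡ true) ⊎ (P i ≡ false) → f i ≤ 𝟙 (P i)
  lemma i (inj₁ e) = ≤-respʳ (cong 𝟙 (sym e)) (h e)
  lemma i (inj₂ e) = ≤-respˡ (sym (k e)) z≤n

-- Double counting of the pairs related by R.
#-inject : ∀ {P Q : VSet N} (R : Fin N → Fin N → Bool) →
           (∀ {x} → x ∈ P → ∃ λ y → y ∈ Q × R x y ≡ true) →
           (∀ {x x′ y} → x ∈ P → x′ ∈ P → R x y ≡ true → R x′ y ≡ true → x ≡ x′) →
           # P ≤ # Q
#-inject {P = P} {Q} R total inj = ≤-trans
  (≤-respˡ (*-identityˡ (# P)) (sum-≥ 1 {P} row))
  (≤-respˡ (sym swapped) (sum-≤# {P = Q} column empty))
  where
  swapped : sum (λ x → # (λ y → P x ∧ Q y ∧ R x y)) ≡ sum (λ y → # (λ x → P x ∧ Q y ∧ R x y))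
  swapped = trans (sum-cong (λ x → #-sum _)) (trans (sum-swap (λ x y → 𝟙 (P x ∧ Q y ∧ R x y)))
    (sym (sum-cong (λ y → #-sum _))))
  row : ∀ {x} → x ∈ P → 1 ≤ # (λ y → P x ∧ Q y ∧ R x y)
  row p with total p
  ... | y , q , r = #-pos {x = y} (∧⁺ p (∧⁺ q r))
  column : ∀ {y} → y ∈ Q → # (λ x → P x ∧ Q y ∧ R x y) ≤ 1
  column {y} q = #-unique (λ {x} {x′} a b → inj (∧-left a) (∧-left b)
    (∧-right {Q y} (∧-right {P x} a)) (∧-right {Q y} (∧-right {P x′} b)))
  empty : ∀ {y} → Q y ≡ false → # (λ x → P x ∧ Q y ∧ R x y) ≡ 0
  empty q = #-empty (λ x → trans (cong (λ b → P x ∧ b ∧ R x _) q) (Bool.∧-zeroʳ (P x)))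

pairs : (Fin N → Fin N → Bool) → ℕ
pairs p = sum (λ x → # (p x))

-- Turns a set into the star that joins it to u, so that edges gained or lost at one vertex can
-- enter a pointwise comparison of edge sets.
pairs-δʳ : ∀ (u : Fin N) (q : VSet N) → pairs (λ x y → y == u ∧ q x) ≡ # q
pairs-δʳ u q = trans (sum-cong (λ x → trans (#-sum _) (sum-δ u (λ _ → q x)))) (sym (#-sum q))

pairs-δˡ : ∀ (u : Fin N) (q : VSet N) → pairs (λ x y → x == u ∧ q y) ≡ # q
pairs-δˡ u q = trans (sum-cong (λ x → #-sum _)) (trans (sum-swap _)
  (trans (sum-cong (λ y → sum-δ u (λ _ → q y))) (sym (#-sum q))))

sum-3 : (f g h : Fin N → ℕ) → sum (λ i → f i + g i + h i) ≡ sum f + sum g + sum h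
sum-3 f g h = trans (sum-+ (λ i → f i + g i) h) (cong (_+ sum h) (sum-+ f g))

-- Three summands suffice: the edges of a graph, and a star at one vertex in each of its two
-- orientations.
pairs-mono₃ : ∀ {a b c a′ b′ c′ : Fin N → Fin N → Bool} →
  (∀ x y → 𝟙 (a x y) + 𝟙 (b x y) + 𝟙 (c x y) ≤ 𝟙 (a′ x y) + 𝟙 (b′ x y) + 𝟙 (c′ x y)) →
  pairs a + pairs b + pairs c ≤ pairs a′ + pairs b′ + pairs c′
pairs-mono₃ {a = a} {b} {c} {a′} {b′} {c′} h = ≤-respˡ (sum-3 _ _ _)
  (≤-respʳ (sum-3 _ _ _) (sum-mono (λ x → ≤-respˡ (sym (row x a b c))
    (≤-respʳ (sym (row x a′ b′ c′)) (sum-mono (h x))))))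
  where
  row : ∀ x (a b c : Fin _ → Fin _ → Bool) →
        # (a x) + # (b x) + # (c x) ≡ sum (λ y → 𝟙 (a x y) + 𝟙 (b x y) + 𝟙 (c x y))
  row x a b c = trans (cong₂ _+_ (cong₂ _+_ (#-sum (a x)) (#-sum (b x))) (#-sum (c x))) (sym (sum-3 _ _ _))

-- Graphs, walks and Menger's theorem

record Graph (N : ℕ) : Set where
  field
    E     : Fin N → Fin N → Bool
    E-sym : ∀ {u v} → E u v ≡ true → E v u ≡ true
    E-irr : ∀ u → E u u ≡ false

  E-distinct : ∀ {u v} → E u v ≡ true → u ≢ v
  E-distinct e refl = true≢false e (E-irr _)

open Graph

data Walk (G : Graph N) (P : Fin N → Set) : Fin N → Fin N → Set where
  stop : ∀ {u} → P u → Walk G P u u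
  step : ∀ {u v w} → P u → E G u v ≡ true → Walk G P v w → Walk G P u w

module _ {G : Graph N} {P : Fin N → Set} where

  walk-head : ∀ {u v} → Walk G P u v → P u
  walk-head (stop p)     = p
  walk-head (step p _ _) = p

  walk-last : ∀ {u v} → Walk G P u v → P v
  walk-last (stop p)     = p
  walk-last (step _ _ w) = walk-last w

  infixr 5 _⊙_
  _⊙_ : ∀ {u v w} → Walk G P u v → Walk G P v w → Walk G P u w
  stop _     ⊙ w = w
  step p e v ⊙ w = step p e (v ⊙ w)

  walk-reverse : ∀ {u v} → Walk G P u v → Walk G P v u
  walk-reverse (stop p)     = stop p
  walk-reverse (step p e w) = walk-reverse w ⊙ step (walk-head w) (E-sym G e) (stop p)

  walk-map : ∀ {H : Graph N} {Q : Fin N → Set} → (∀ {z} → P z → Q z) →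
             (∀ {x y} → P x → P y → E G x y ≡ true → E H x y ≡ true) →
             ∀ {u v} → Walk G P u v → Walk H Q u v
  walk-map f g (stop p)     = stop (f p)
  walk-map f g (step p e w) = step (f p) (g p (walk-head w) e) (walk-map f g w)

  walk-weaken : ∀ {Q : Fin N → Set} → (∀ {z} → P z → Q z) → ∀ {u v} → Walk G P u v → Walk G Q u v
  walk-weaken f = walk-map f (λ _ _ e → e)

module _ {G : Graph N} {P : Fin N → Set} where

  -- The walk is followed up to its first vertex in D. When walks are joined at a separator, the
  -- junction is then the only vertex of the first walk there.
  trim? : (D : VSet N) → ∀ {u v} → Walk G P u v →
          (∃ λ d → d ∈ D × Walk G (λ z → P z × (z ∈ D → z ≡ d)) u d) ⊎ Walk G (λ z → P z × D z ≡ false) u v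
  trim? D {u} w with bool (D u)
  trim? D {u} w            | inj₁ d = inj₁ (u , d , stop (walk-head w , λ _ → refl))
  trim? D     (stop p)     | inj₂ d = inj₂ (stop (p , d))
  trim? D     (step p e w) | inj₂ d with trim? D w
  ... | inj₁ (t , h , w′) = inj₁ (t , h , step (p , λ d′ → absurd d′ d) e w′)
  ... | inj₂ w′           = inj₂ (step (p , d) e w′)

  trim : (D : VSet N) → ∀ {u v} → v ∈ D → Walk G P u v →
         ∃ λ d → d ∈ D × Walk G (λ z → P z × (z ∈ D → z ≡ d)) u d
  trim D v∈D w with trim? D w
  ... | inj₁ r  = r
  ... | inj₂ w′ = absurd v∈D (proj₂ (walk-last w′))

infixr 4.5 _⇛_
_⇛_ : Bool → Bool → Bool
a ⇛ b = not a ∨ b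

⇛⁺ : ∀ {a b} → (a ≡ true → b ≡ true) → a ⇛ b ≡ true
⇛⁺ {true}  f = f refl
⇛⁺ {false} f = refl

⇛⁻ : ∀ {a b} → a ⇛ b ≡ true → a ≡ true → b ≡ true
⇛⁻ p refl = p

⊆ᵇ : ∀ (P Q : VSet N) → P ⊆ Q → ∀ x → P x ⇛ Q x ≡ true
⊆ᵇ P Q h x = ⇛⁺ (h {x})

==-subst : (f : VSet N) → ∀ x y → x == y ⇛ f x ⇛ f y ≡ true
==-subst f x y = ⇛⁺ (λ e → ⇛⁺ {f x} (subst (_∈ f) (==⁻ e)))

-- Small cuts, violating separations and large cliques are all given by conditions on single
-- vertices and on pairs of vertices together with a bound on sizes, so one exhaustive search
-- decides them all. The search runs over vectors; that `r` respects pointwise equality replaces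
-- function extensionality.
search : (p : Fin N → Bool → Bool → Bool) (q : Fin N → Fin N → Bool → Bool → Bool → Bool → Bool)
         {r : VSet N → VSet N → Set} → (∀ A B → Dec (r A B)) →
         (∀ {A B A′ B′} → (∀ x → A x ≡ A′ x) → (∀ x → B x ≡ B′ x) → r A B → r A′ B′) →
         let Q = λ A B → (∀ x → p x (A x) (B x) ≡ true) × (∀ x y → q x y (A x) (B x) (A y) (B y) ≡ true) × r A B
         in (∃ λ A → ∃ λ B → Q A B) ⊎ (∀ A B → ¬ Q A B)
search {N} p q {r} r? ext = decide (anySubset? λ A → anySubset? λ B → Q? (lookup A) (lookup B))
  where
  Q : VSet N → VSet N → Set
  Q A B = (∀ x → p x (A x) (B x) ≡ true) × (∀ x y → q x y (A x) (B x) (A y) (B y) ≡ true) × r A B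
  Q? : ∀ A B → Dec (Q A B)
  Q? A B = Fin.all? (λ x → p x (A x) (B x) Bool.≟ true) ×-dec
           (Fin.all? (λ x → Fin.all? (λ y → q x y (A x) (B x) (A y) (B y) Bool.≟ true)) ×-dec r? A B)
  decide : Dec (∃ λ A → ∃ λ B → Q (lookup A) (lookup B)) → (∃ λ A → ∃ λ B → Q A B) ⊎ (∀ A B → ¬ Q A B)
  decide (yes (A , B , h)) = inj₁ (lookup A , lookup B , h)
  decide (no none) = inj₂ λ A B → λ { (h , k , l) →
    let a = λ x → sym (Vec.lookup∘tabulate A x)
        b = λ x → sym (Vec.lookup∘tabulate B x)
    in none (tabulate A , tabulate B ,
      (λ x → trans (sym (cong₂ (p x) (a x) (b x))) (h x)) ,
      (λ x y → trans (sym (trans (cong₂ (λ c d → q x y c d (A y) (B y)) (a x) (b x))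
                                 (cong₂ (q x y (lookup (tabulate A) x) (lookup (tabulate B) x)) (a y) (b y))))
                                     (k x y)) ,
      ext a b l) }

cut-vertex : (v s d a b : Bool) → Bool
cut-vertex v s d a b = (v ⇛ a ∨ b) ∧ (a ⇛ v) ∧ (b ⇛ v) ∧ (s ⇛ a) ∧ (d ⇛ b)

cut-edge : (e a b a′ b′ : Bool) → Bool
cut-edge e a b a′ b′ = not (e ∧ a ∧ not b ∧ b′ ∧ not a′)

-- A and B cover V, and no edge joins A ∖ B to B ∖ A; the Boolean form makes these
-- conditions accessible to truth tables.
record Cut (G : Graph N) (V S D A B : VSet N) : Set where
  constructor cut
  field
    at-vertex : ∀ x → cut-vertex (V x) (S x) (D x) (A x) (B x) ≡ true
    at-edge   : ∀ x y → cut-edge (E G x y) (A x) (B x) (A y) (B y) ≡ true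

open Cut

-- Disjoint walks from S to D are presented as the colour classes of one colouring.
Link : Graph N → (V S D : VSet N) → Set
Link {N} G V S D = Σ[ col ∈ (Fin N → Fin N) ]
  (∀ {s} → s ∈ S → ∃ λ d → d ∈ D × Walk G (λ z → z ∈ V × col z ≡ s) s d)

cut? : ∀ (G : Graph N) V S D k →
       (∃ λ A → ∃ λ B → Cut G V S D A B × # (A ∩ B) < k) ⊎ (∀ A B → Cut G V S D A B → k ≤ # (A ∩ B))
cut? G V S D k with search (λ x → cut-vertex (V x) (S x) (D x)) (λ x y → cut-edge (E G x y))
                           (λ A B → # (A ∩ B) ℕ.<? k)
                           (λ a b → subst (_< k) (#-cong (λ x → cong₂ _∧_ (a x) (b x))))
... | inj₁ (A , B , h , h′ , l) = inj₁ (A , B , cut h h′ , l)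
... | inj₂ none = inj₂ λ A B c → ≮⇒≥ (λ l → none A B (at-vertex c , at-edge c , l))

#-⁅⁆ : (x : Fin N) → # ⁅ x ⁆ ≤ 1
#-⁅⁆ x = #-unique {P = ⁅ x ⁆} (λ a b → trans (==⁻ a) (==⁻ˢ b))

-- Induction on the number of vertices. A vertex s of S outside D is exchanged for a neighbour y
-- outside S. If no small cut arises, the walk from y is prolonged to s. Otherwise the small cut,
-- with s added to both sides, splits V into two smaller parts, and links of the parts are joined at
-- their intersection.
menger : ∀ (G : Graph N) n {V S D} → # V ≤ n → S ⊆ V → D ⊆ V →
         (∀ A B → Cut G V S D A B → # S ≤ # (A ∩ B)) → Link G V S D
menger G n {V} {S} {D} size S⊆V D⊆V large with find (S ∖ D)
... | inj₂ none = (λ z → z) , λ {s} h →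
        s , taut 2 (λ s d → not (s ∧ not d) ⇒ s ⇒ ! d) refl (S s) (D s) (not⁺ (none s)) h , stop (S⊆V h , refl)
menger G zero {V} size S⊆V D⊆V large | inj₁ (s , s∈) =
  ⊥-elim (<⇒≱ (#-pos {P = V} (S⊆V (∧-left s∈))) size)
menger {N} G (suc n) {V} {S} {D} size S⊆V D⊆V large | inj₁ (s , s∈) with find (λ y → V y ∧ not (S y) ∧ E G s y)
-- If all neighbours of s in V lie in S, then S and V without s form a cut whose order is one less
-- than the size of S.
... | inj₂ none = ⊥-elim (<⇒≱ (#-strict {P = S ∩ (V ∖ ⁅ s ⁆)} {Q = S} (λ p → ∧-left p) (∧-left s∈)
                     (trans (cong₂ (λ a b → S s ∧ (a ∧ not b)) refl (==⁺ s)) (lemma (S s) (V s))))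
                     (large S (V ∖ ⁅ s ⁆) (cut
                       (λ x → taut 4 (λ v s d t → (s ⇛ v) ⇒ (d ⇛ v) ⇒ (t ⇛ s ∧ not d ⇛ s ∧ not d) ⇒ (t ⇛ s ∧ not d) ⇒
                                ! cut-vertex v s d s (v ∧ not t)) refl (V x) (S x) (D x) (x == s)
                                (⊆ᵇ S V S⊆V x) (⊆ᵇ D V D⊆V x)
                                    (taut 2 (λ a b → ! (a ⇛ b ⇛ b)) refl (x == s) (S x ∧ not (D x)))
                                (⇛⁺ (λ e → subst (_∈ (S ∖ D)) (==⁻ˢ e) s∈)))
                       (λ x y → taut 8 (λ e vx sx tx vy sy ty e′ → (tx ⇛ e ⇛ e′) ⇒ not (vy ∧ not sy ∧ e′) ⇒
                           (sx ⇛ vx) ⇒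
                                ! cut-edge e sx (vx ∧ not tx) sy (vy ∧ not ty)) refl
                                (E G x y) (V x) (S x) (x == s) (V y) (S y) (y == s) (E G s y)
                                (==-subst (λ z → E G z y) x s) (not⁺ (none y)) (⊆ᵇ S V S⊆V x)))))
  where
  lemma : ∀ a b → a ∧ (b ∧ false) ≡ false
  lemma a b = trans (cong (a ∧_) (Bool.∧-zeroʳ b)) (Bool.∧-zeroʳ a)
... | inj₁ (y , y∈) = split (cut? G V′ S′ D (# S))
  where
  V′ S′ : VSet N
  V′ = V ∖ ⁅ s ⁆
  S′ = (S ∖ ⁅ s ⁆) ∪ ⁅ y ⁆
  s∈S : s ∈ S
  s∈S = ∧-left s∈
  s∉D : D s ≡ false
  s∉D = not⁻ (∧-right {S s} s∈)
  y∈V : y ∈ V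
  y∈V = ∧-left y∈
  y∉S : S y ≡ false
  y∉S = not⁻ (∧-left (∧-right {V y} y∈))
  s~y : E G s y ≡ true
  s~y = ∧-right {not (S y)} (∧-right {V y} y∈)
  #S : # S ≡ suc (# (S ∖ ⁅ s ⁆))
  #S = #-delete-∈ {P = S} s∈S
  V′<V : # V′ ≤ n
  V′<V = ≤-pred (≤-respˡ (#-delete-∈ {P = V} (S⊆V s∈S)) size)
  S′⊆V′ : S′ ⊆ V′
  S′⊆V′ {x} h with ∨⁻ {(S ∖ ⁅ s ⁆) x} h
  ... | inj₁ p = let a , b = ∖⁅⁆⁻ {P = S} p in ∈-∖⁅⁆ {P = V} {x} (S⊆V {x} a) b
  ... | inj₂ p = ∈-∖⁅⁆ {P = V} {x} (subst (_∈ V) (==⁻ˢ p) y∈V)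
                   (λ e → E-distinct G s~y (trans (sym e) (==⁻ p)))
  D⊆V′ : D ⊆ V′
  D⊆V′ {x} d = ∈-∖⁅⁆ {P = V} {x} (D⊆V d) (λ { refl → true≢false d s∉D })
  #S′≤#S : # S′ ≤ # S
  #S′≤#S = ≤-trans (#-∪ (S ∖ ⁅ s ⁆) ⁅ y ⁆) (≤-respʳ (trans (+-comm _ 1) (sym #S)) (+-monoʳ-≤ _ (#-⁅⁆ y)))
  #S≤#S′ : # S ≤ # S′
  #S≤#S′ = ≤-respˡ (sym #S) (≤-respʳ (sym (#-delete-∈ {P = S′} (∨-introʳ {(S ∖ ⁅ s ⁆) y} (==⁺ y))))
      (s≤s (#-mono {P = S ∖ ⁅ s ⁆} {Q = S′ ∖ ⁅ y ⁆} λ {x} p →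
    ∈-∖⁅⁆ {P = S′} (∨-introˡ p) (λ { refl → true≢false (∧-left p) y∉S }))))
  split : (∃ λ A → ∃ λ B → Cut G V′ S′ D A B × # (A ∩ B) < # S) ⊎
          (∀ A B → Cut G V′ S′ D A B → # S ≤ # (A ∩ B)) → Link G V S D
  split (inj₂ none) with menger G n V′<V S′⊆V′ D⊆V′ (λ A B c → ≤-trans #S′≤#S (none A B c))
  ... | col , link = col′ , link′
    where
    col′ : Fin N → Fin N
    col′ z = if z == s ∨ col z == y then s else col z
    link′ : ∀ {t} → t ∈ S → ∃ λ d → d ∈ D × Walk G (λ z → z ∈ V × col′ z ≡ t) t d
    link′ {t} t∈S with t Fin.≟ s
    ... | yes refl with link {y} (∨-introʳ {(S ∖ ⁅ s ⁆) y} (==⁺ y))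
    ...   | d , d∈D , w = d , d∈D , step (S⊆V t∈S , if-true (∨-introˡ (==⁺ s))) s~y
              (walk-weaken (λ {z} (a , b) → ∧-left a ,
                if-true (∨-introʳ {z == s} (trans (cong (_== y) b) (==⁺ y)))) w)
    link′ {t} t∈S | no t≢s with link {t} (∨-introˡ (∈-∖⁅⁆ {P = S} t∈S t≢s))
    ... | d , d∈D , w = d , d∈D , walk-weaken (λ {z} (a , b) → ∧-left a ,
             trans (if-false
               (cong₂ _∨_ (≢⇒≠ (proj₂ (∖⁅⁆⁻ {P = V} a)))
                          (≢⇒≠ (λ e → true≢false (subst (_∈ S) (trans (sym b) e) t∈S) y∉S)))) b) w
  -- With s on both sides, a cut of V without s becomes a cut of V of order at most the size of S.
  split (inj₁ (A , B , c , small)) = combine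
    where
    A⁺ B⁺ T : VSet N
    A⁺ = A ∪ ⁅ s ⁆
    B⁺ = B ∪ ⁅ s ⁆
    T  = A⁺ ∩ B⁺
    #T≤#S : # T ≤ # S
    #T≤#S = ≤-trans (#-mono {P = T} {Q = (A ∩ B) ∪ ⁅ s ⁆} λ {x} →
        taut 3 (λ a b t → (a ∨ t) ∧ (b ∨ t) ⇒ ! ((a ∧ b) ∨ t)) refl (A x) (B x) (x == s))
      (≤-trans (#-∪ (A ∩ B) ⁅ s ⁆) (≤-trans (+-monoʳ-≤ _ (#-⁅⁆ s))
        (≤-respˡ (sym (+-comm _ 1)) small)))
    S⊆A⁺ : ∀ x → S x ⇛ A x ∨ x == s ≡ true
    S⊆A⁺ x = taut 7 (λ v s d t y a b → cut-vertex (v ∧ not t) ((s ∧ not t) ∨ y) d a b ⇒ ! (s ⇛ a ∨ t)) refl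
      (V x) (S x) (D x) (x == s) (x == y) (A x) (B x) (at-vertex c x)
    D⊆B : ∀ x → D x ⇛ B x ≡ true
    D⊆B x = taut 5 (λ v s d a b → cut-vertex v s d a b ⇒ ! (d ⇛ b)) refl
      (V′ x) (S′ x) (D x) (A x) (B x) (at-vertex c x)
    inside : ∀ x → V x ⇛ (A x ∨ x == s) ∨ (B x ∨ x == s) ≡ true
    inside x = taut 6 (λ v s d t a b → cut-vertex (v ∧ not t) s d a b ⇒ ! (v ⇛ (a ∨ t) ∨ (b ∨ t))) refl
      (V x) (S′ x) (D x) (x == s) (A x) (B x) (at-vertex c x)
    s⊆V : ∀ x → x == s ⇛ V x ≡ true
    s⊆V x = ⇛⁺ (λ e → subst (_∈ V) (==⁻ˢ e) (S⊆V s∈S))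
    A⁺⊆V : ∀ x → A x ∨ x == s ⇛ V x ≡ true
    A⁺⊆V x = taut 6 (λ v s d t a b → cut-vertex (v ∧ not t) s d a b ⇒ (t ⇛ v) ⇒ ! (a ∨ t ⇛ v)) refl
      (V x) (S′ x) (D x) (x == s) (A x) (B x) (at-vertex c x) (s⊆V x)
    B⁺⊆V : ∀ x → B x ∨ x == s ⇛ V x ≡ true
    B⁺⊆V x = taut 6 (λ v s d t a b → cut-vertex (v ∧ not t) s d a b ⇒ (t ⇛ v) ⇒ ! (b ∨ t ⇛ v)) refl
      (V x) (S′ x) (D x) (x == s) (A x) (B x) (at-vertex c x) (s⊆V x)
    s∉A : ∀ x → x == s ⇛ not (A x ∨ B x) ≡ true
    s∉A x = taut 6 (λ v s d t a b → cut-vertex (v ∧ not t) s d a b ⇒ ! (t ⇛ not (a ∨ b))) refl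
      (V x) (S′ x) (D x) (x == s) (A x) (B x) (at-vertex c x)
    A⁺-small : # A⁺ ≤ n
    A⁺-small with find (B ∖ A)
    ... | inj₁ (z , z∈) = ≤-pred (≤-trans (#-strict {P = A⁺} {Q = V} (λ {x} → ⇛⁻ (A⁺⊆V x))
             (⇛⁻ (B⁺⊆V z) (∨-introˡ (∧-left {B z} z∈)))
             (not⁻ (taut 3 (λ a b t → (t ⇛ not (a ∨ b)) ⇒ b ∧ not a ⇒ ! not (a ∨ t)) refl (A z) (B z) (z == s)
                 (s∉A z) z∈))) size)
    -- If B had no vertex outside A, then V and B would form a cut of too small an order.
    ... | inj₂ none = ⊥-elim (<⇒≱ small (≤-trans
             (large V B (cut
               (λ x → taut 5 (λ v s d b t → (s ⇛ v) ⇒ (d ⇛ b) ⇒ (b ∨ t ⇛ v) ⇒ ! cut-vertex v s d v b) refl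
                        (V x) (S x) (D x) (B x) (x == s) (⊆ᵇ S V S⊆V x) (D⊆B x) (B⁺⊆V x))
               (λ x y → taut 6 (λ e vx bx vy by t → (by ∨ t ⇛ vy) ⇒ ! cut-edge e vx bx vy by) refl
                        (E G x y) (V x) (B x) (V y) (B y) (y == s) (B⁺⊆V y))))
             (#-mono {P = V ∩ B} {Q = A ∩ B} λ {x} → taut 3 (λ v a b → not (b ∧ not a) ⇒ v ∧ b ⇒ ! (a ∧ b)) refl
                        (V x) (A x) (B x) (not⁺ (none x)))))
    B⁺-small : # B⁺ ≤ n
    B⁺-small with find (A ∖ B)
    ... | inj₁ (z , z∈) = ≤-pred (≤-trans (#-strict {P = B⁺} {Q = V} (λ {x} → ⇛⁻ (B⁺⊆V x))
             (⇛⁻ (A⁺⊆V z) (∨-introˡ (∧-left {A z} z∈)))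
             (not⁻ (taut 3 (λ a b t → (t ⇛ not (a ∨ b)) ⇒ a ∧ not b ⇒ ! not (b ∨ t)) refl (A z) (B z) (z == s)
                 (s∉A z) z∈))) size)
    -- If A were contained in B, the cut would contain all of `S′`.
    ... | inj₂ none = ⊥-elim (<⇒≱ small (≤-trans #S≤#S′ (#-mono {P = S′} {Q = A ∩ B} λ {x} →
             taut 5 (λ v s d a b → cut-vertex v s d a b ⇒ not (a ∧ not b) ⇒ s ⇒ ! (a ∧ b)) refl
                    (V′ x) (S′ x) (D x) (A x) (B x) (at-vertex c x) (not⁺ (none x)))))
    A-link : Link G A⁺ S T
    A-link = menger G n A⁺-small (λ {x} → ⇛⁻ (S⊆A⁺ x)) (λ p → ∧-left p) λ A₁ B₁ c₁ →
      -- A cut between S and T inside `A⁺` becomes one between S and D when `B⁺` joins its far side,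
      -- without gaining order.
      ≤-trans (large A₁ (B₁ ∪ B⁺) (cut
        (λ x → taut 7 (λ v s d a b a₁ b₁ → cut-vertex a s (a ∧ b) a₁ b₁ ⇒ (s ⇛ a) ⇒ (d ⇛ b) ⇒ (v ⇛ a ∨ b) ⇒
            (a ⇛ v) ⇒ (b ⇛ v) ⇒
                 ! cut-vertex v s d a₁ (b₁ ∨ b)) refl
                 (V x) (S x) (D x) (A⁺ x) (B⁺ x) (A₁ x) (B₁ x) (at-vertex c₁ x) (S⊆A⁺ x)
                 (⇛⁺ {D x} (λ d → ∨-introˡ (⇛⁻ {D x} {B x} (D⊆B x) d))) (inside x) (A⁺⊆V x) (B⁺⊆V x))
        (λ x y → taut 13 (λ e ax bx ay by ux vx uy vy tx ty sx sy →
                   cut-vertex (ax ∨ tx) sx ((ax ∨ tx) ∧ (bx ∨ tx)) ux vx ⇒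
                   cut-vertex (ay ∨ ty) sy ((ay ∨ ty) ∧ (by ∨ ty)) uy vy ⇒
                   cut-edge e ax bx ay by ⇒ cut-edge e ux vx uy vy ⇒
                       ! cut-edge e ux (vx ∨ (bx ∨ tx)) uy (vy ∨ (by ∨ ty))) refl
                   (E G x y) (A x) (B x) (A y) (B y) (A₁ x) (B₁ x) (A₁ y) (B₁ y) (x == s) (y == s) (S x) (S y)
                   (at-vertex c₁ x) (at-vertex c₁ y) (at-edge c x y) (at-edge c₁ x y))))
      (#-mono {P = A₁ ∩ (B₁ ∪ B⁺)} {Q = A₁ ∩ B₁} λ {x} →
        taut 5 (λ s a b a₁ b₁ → cut-vertex a s (a ∧ b) a₁ b₁ ⇒ a₁ ∧ (b₁ ∨ b) ⇒ ! (a₁ ∧ b₁)) refl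
               (S x) (A⁺ x) (B⁺ x) (A₁ x) (B₁ x) (at-vertex c₁ x))
    B-link : Link G B⁺ T D
    B-link = menger G n B⁺-small (λ {x} p → ∧-right {A⁺ x} p) (λ {x} d → ∨-introˡ (⇛⁻ (D⊆B x) d)) λ A₁ B₁ c₁ →
      ≤-trans #T≤#S (≤-trans (large (A₁ ∪ A⁺) B₁ (cut
        (λ x → taut 7 (λ v s d a b a₁ b₁ → cut-vertex b (a ∧ b) d a₁ b₁ ⇒ (s ⇛ a) ⇒ (d ⇛ b) ⇒ (v ⇛ a ∨ b) ⇒
            (a ⇛ v) ⇒ (b ⇛ v) ⇒
                 ! cut-vertex v s d (a₁ ∨ a) b₁) refl
                 (V x) (S x) (D x) (A⁺ x) (B⁺ x) (A₁ x) (B₁ x) (at-vertex c₁ x) (S⊆A⁺ x)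
                 (⇛⁺ {D x} (λ d → ∨-introˡ (⇛⁻ {D x} {B x} (D⊆B x) d))) (inside x) (A⁺⊆V x) (B⁺⊆V x))
        (λ x y → taut 13 (λ e ax bx ay by ux vx uy vy tx ty dx dy →
                   cut-vertex (bx ∨ tx) ((ax ∨ tx) ∧ (bx ∨ tx)) dx ux vx ⇒
                   cut-vertex (by ∨ ty) ((ay ∨ ty) ∧ (by ∨ ty)) dy uy vy ⇒
                   cut-edge e ax bx ay by ⇒ cut-edge e ux vx uy vy ⇒
                       ! cut-edge e (ux ∨ (ax ∨ tx)) vx (uy ∨ (ay ∨ ty)) vy) refl
                   (E G x y) (A x) (B x) (A y) (B y) (A₁ x) (B₁ x) (A₁ y) (B₁ y) (x == s) (y == s) (D x) (D y)
                   (at-vertex c₁ x) (at-vertex c₁ y) (at-edge c x y) (at-edge c₁ x y))))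
      (#-mono {P = (A₁ ∪ A⁺) ∩ B₁} {Q = A₁ ∩ B₁} λ {x} →
        taut 5 (λ d a b a₁ b₁ → cut-vertex b (a ∧ b) d a₁ b₁ ⇒ (a₁ ∨ a) ∧ b₁ ⇒ ! (a₁ ∧ b₁)) refl
               (D x) (A⁺ x) (B⁺ x) (A₁ x) (B₁ x) (at-vertex c₁ x)))
    col₁ col₂ col : Fin N → Fin N
    col₁ = proj₁ A-link
    col₂ = proj₁ B-link
    -- A far walk inherits the colour of the near walk that it continues: `col₂` yields its first
    -- vertex in T, and `col₁` the origin of that vertex in S.
    col z = if B⁺ z then col₁ (col₂ z) else col₁ z
    col-B : ∀ {z} → z ∈ B⁺ → col z ≡ col₁ (col₂ z)
    col-B {z} h = if-true h
    col-A : ∀ {z} → B⁺ z ≡ false → col z ≡ col₁ z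
    col-A {z} h = if-false h
    combine : Link G V S D
    combine = col , λ {t} t∈S → connect t (proj₂ A-link t∈S)
      where
      connect : ∀ t → (∃ λ d → d ∈ T × Walk G (λ z → z ∈ A⁺ × col₁ z ≡ t) t d) →
                ∃ λ d → d ∈ D × Walk G (λ z → z ∈ V × col z ≡ t) t d
      connect t (d₀ , d₀∈T , w₀) with trim T d₀∈T w₀
      ... | d , d∈T , w with proj₂ B-link {d} d∈T
      ...   | e , e∈D , w′ = e , e∈D ,
        walk-weaken (λ {z} h → first h (bool (B⁺ z))) w ⊙
        walk-weaken (λ {z} (a , b) → ⇛⁻ (B⁺⊆V z) a , trans (col-B {z} a) (trans (cong col₁ b) col₁d)) w′
        where
        col₁d : col₁ d ≡ t
        col₁d = proj₂ (proj₁ (walk-last w))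
        first : ∀ {z} → (z ∈ A⁺ × col₁ z ≡ t) × (z ∈ T → z ≡ d) → (B⁺ z ≡ true) ⊎ (B⁺ z ≡ false) → z ∈ V × col z ≡ t
        first {z} ((a , b) , u) (inj₂ f) = ⇛⁻ (A⁺⊆V z) a , trans (col-A {z} f) b
        first {z} ((a , b) , u) (inj₁ f) with u (∧⁺ a f)
        ... | refl = ⇛⁻ (A⁺⊆V z) a , trans (col-B {z} f) (trans (cong col₁ (proj₂ (walk-head w′))) col₁d)

-- Routing labelled vertices along disjoint connected sets

AtMostTwice : VSet N → (Fin N → ℕ) → Set
AtMostTwice X l = ∀ {x y z} → x ∈ X → y ∈ X → z ∈ X → l x ≡ l y → l y ≡ l z → x ≡ y ⊎ y ≡ z ⊎ x ≡ z

-- Vertices of X with the same label are joined within a class of one colouring of V,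
-- so that walks for different labels are disjoint. A label used only once merely
-- reserves its vertex.
Routable : Graph N → (V X : VSet N) → Set
Routable {N} G V X = ∀ (l : Fin N → ℕ) → AtMostTwice X l →
  Σ[ col ∈ (Fin N → ℕ) ] (∀ {x y} → x ∈ X → y ∈ X → l x ≡ l y → Walk G (λ z → z ∈ V × col z ≡ l x) x y)

routable-weaken : ∀ {G H : Graph N} {V W X} → V ⊆ W →
                  (∀ {x y} → x ∈ V → y ∈ V → E G x y ≡ true → E H x y ≡ true) →
                  Routable G V X → Routable H W X
routable-weaken s t r l tw with r l tw
... | col , walks = col , λ x y e →
  walk-map (λ (a , b) → s a , b) (λ (a , _) (b , _) → t a b) (walks x y e)

addClique : Graph N → VSet N → Graph N
addClique G S = record
  { E     = λ u v → E G u v ∨ (S u ∧ S v ∧ not (u == v))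
  ; E-sym = λ {u} {v} p → symm u v p
  ; E-irr = λ u → taut 3 (λ e s t → not e ⇒ t ⇒ ! not (e ∨ s ∧ s ∧ not t)) refl (E G u u) (S u) (u == u)
                    (not⁺ (E-irr G u)) (==⁺ u) ▹ not⁻
  }
  where
  infixl 1 _▹_
  _▹_ : ∀ {A B : Set} → A → (A → B) → B
  a ▹ f = f a
  symm : ∀ u v → E G u v ∨ (S u ∧ S v ∧ not (u == v)) ≡ true → E G v u ∨ (S v ∧ S u ∧ not (v == u)) ≡ true
  symm u v = taut 6 (λ e e′ s t q q′ → (e ⇛ e′) ⇒ (q′ ⇛ q) ⇒ e ∨ (s ∧ t ∧ not q) ⇒ ! (e′ ∨ (t ∧ s ∧ not q′))) refl
    (E G u v) (E G v u) (S u) (S v) (u == v) (v == u) (⇛⁺ (E-sym G))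
    (⇛⁺ (λ q → subst (λ z → z == v ≡ true) (==⁻ q) (==⁺ v)))

-- The shift by N separates the labels of marked vertices from the private labels below N, which
-- reserve all other vertices.
module Relabel {N : ℕ} (M : VSet N) (c : Fin N → ℕ) where

  relabelled : Fin N → ℕ
  relabelled s = if M s then N + c s else toℕ s

  marked-label : ∀ {s} → s ∈ M → relabelled s ≡ N + c s
  marked-label = if-true

  private-label : ∀ {s} → M s ≡ false → relabelled s ≡ toℕ s
  private-label = if-false

  mixed : ∀ {s t} → s ∈ M → M t ≡ false → relabelled s ≡ relabelled t → ⊥
  mixed {s} {t} p q e = <⇒≱ (Fin.toℕ<n t)
    (≤-respʳ (trans (sym (marked-label p)) (trans e (private-label q))) (m≤m+n N (c s)))

  both-marked : ∀ {s t} → s ∈ M → relabelled s ≡ relabelled t → t ∈ M × c s ≡ c t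
  both-marked {s} {t} p e with bool (M t)
  ... | inj₁ q = q , +-cancelˡ-≡ N _ _ (trans (sym (marked-label p)) (trans e (marked-label q)))
  ... | inj₂ q = ⊥-elim (mixed p q e)

  both-private : ∀ {s t} → M s ≡ false → relabelled s ≡ relabelled t → s ≡ t
  both-private {s} {t} p e with bool (M t)
  ... | inj₁ q = ⊥-elim (mixed q p (sym e))
  ... | inj₂ q = Fin.toℕ-injective (trans (sym (private-label p)) (trans e (private-label q)))

  relabelled-twice : ∀ {S} → (∀ {x y z} → x ∈ M → y ∈ M → z ∈ M → c x ≡ c y → c y ≡ c z → x ≡ y ⊎ y ≡ z ⊎ x ≡ z) →
                     AtMostTwice S relabelled
  relabelled-twice twice {x} _ _ _ e f with bool (M x)
  ... | inj₂ p = inj₁ (both-private p e)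
  ... | inj₁ p = let q , a = both-marked p e ; r , b = both-marked q f in twice p q r a b

-- `door` takes a proof of `ok x y`, and the exits obtained from two case distinctions have to
-- agree.
uip : ∀ {b} (p q : b ≡ true) → p ≡ q
uip refl refl = refl

-- Each walk in A is cut where it enters S for the first time; the walks coming from
-- the two vertices of a label are then joined on the other side of S.
module Glue {G : Graph N} {A C S Y : VSet N} (S⊆A : S ⊆ A) (disj : ∀ {z} → z ∈ C → A z ≡ false)
            (outer : Routable (addClique G S) A Y) (inner : Routable G (C ∪ S) S)
            (l : Fin N → ℕ) (twice : AtMostTwice Y l) where

  G⁺ : Graph N
  G⁺ = addClique G S

  col : Fin N → ℕ
  col = proj₁ (outer l twice)

  ok : Fin N → Fin N → Bool
  ok x y = (Y x ∧ Y y ∧ does (l x ℕ.≟ l y)) ∧ (not (x == y) ∨ S x)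

  ok⁺ : ∀ {x y} → x ∈ Y → y ∈ Y → l x ≡ l y → not (x == y) ∨ S x ≡ true → ok x y ≡ true
  ok⁺ {x} {y} p q e h = ∧⁺ (∧⁺ p (∧⁺ q (does⁺ (l x ℕ.≟ l y) e))) h

  ok⁻ : ∀ {x y} → ok x y ≡ true → x ∈ Y × y ∈ Y × l x ≡ l y
  ok⁻ {x} {y} p = let q = ∧-left {Y x ∧ Y y ∧ does (l x ℕ.≟ l y)} p in
    ∧-left q , ∧-left (∧-right {Y x} q) , does⁻ (l x ℕ.≟ l y) (∧-right {Y y} (∧-right {Y x} q))

  ok-refl : ∀ {x} → ok x x ≡ true → x ∈ S
  ok-refl {x} p with ∨⁻ (∧-right {Y x ∧ Y x ∧ does (l x ℕ.≟ l x)} p)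
  ... | inj₁ q = absurd (==⁺ x) (not⁻ q)
  ... | inj₂ q = q

  Door : Fin N → Set
  Door x = ∃ λ d → d ∈ S × Walk G⁺ (λ z → (z ∈ A × col z ≡ l x) × (z ∈ S → z ≡ d)) x d

  door : ∀ x y → ok x y ≡ true → Door x ⊎ Walk G⁺ (λ z → (z ∈ A × col z ≡ l x) × S z ≡ false) x y
  door x y p = let a , b , e = ok⁻ p in trim? S (proj₂ (outer l twice) a b e)

  exit-at : ∀ {x y} → Door x ⊎ Walk G⁺ (λ z → (z ∈ A × col z ≡ l x) × S z ≡ false) x y → Fin N → Bool
  exit-at (inj₁ (d , _)) s = d == s
  exit-at (inj₂ _)       s = false

  exits-at′ : ∀ x y → (ok x y ≡ true) ⊎ (ok x y ≡ false) → Fin N → Bool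
  exits-at′ x y (inj₁ p) s = exit-at (door x y p) s
  exits-at′ x y (inj₂ _) s = false

  exits-at : Fin N → Fin N → Fin N → Bool
  exits-at x y = exits-at′ x y (bool (ok x y))

  exit⁻ : ∀ x y {s} → exits-at x y s ≡ true → Σ[ p ∈ ok x y ≡ true ] ∃ λ D → door x y p ≡ inj₁ D × proj₁ D ≡ s
  exit⁻ x y h with bool (ok x y)
  exit⁻ x y h | inj₁ p with door x y p in eq
  ... | inj₁ D = p , D , eq , ==⁻ h

  exit⁺ : ∀ x y p {D} → door x y p ≡ inj₁ D → exits-at x y (proj₁ D) ≡ true
  exit⁺ x y p eq with bool (ok x y)
  ... | inj₂ q = absurd p q
  ... | inj₁ q rewrite uip q p | eq = ==⁺ _

  exit-unique : ∀ {x y s t} → exits-at x y s ≡ true → exits-at x y t ≡ true → s ≡ t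
  exit-unique {x} {y} h k with exit⁻ x y h | exit⁻ x y k
  ... | p , D , eq , refl | q , D′ , eq′ , refl rewrite uip p q with trans (sym eq) eq′
  ... | refl = refl

  exit-start : ∀ {x y s} → exits-at x y s ≡ true → x ∈ S → x ≡ s
  exit-start {x} {y} h x∈S with exit⁻ x y h
  ... | _ , (_ , _ , w) , _ , refl = proj₂ (walk-head w) x∈S

  exit-col : ∀ {x y s} → exits-at x y s ≡ true → col s ≡ l x
  exit-col {x} {y} h with exit⁻ x y h
  ... | _ , (_ , _ , w) , _ , refl = proj₂ (proj₁ (walk-last w))

  exit-ok : ∀ {x y s} → exits-at x y s ≡ true → ok x y ≡ true
  exit-ok {x} {y} h = proj₁ (exit⁻ x y h)

  marked : VSet N
  marked s = anyᵇ (λ x → anyᵇ (λ y → exits-at x y s))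

  marked⁻ : ∀ {s} → s ∈ marked → ∃ λ x → ∃ λ y → exits-at x y s ≡ true
  marked⁻ h = let x , p = anyᵇ⁻ h ; y , q = anyᵇ⁻ p in x , y , q

  marked⁺ : ∀ {x y s} → exits-at x y s ≡ true → s ∈ marked
  marked⁺ {x} {y} {s} h = anyᵇ⁺ {x = x} (anyᵇ⁺ {P = λ y → exits-at x y s} h)

  open Relabel marked col renaming (relabelled to l′)

  -- Its label leaves x at most one partner, and for the pair x, x every exit is x itself; so the
  -- exit depends on x alone.
  same-start : ∀ {x y y′ s t} → exits-at x y s ≡ true → exits-at x y′ t ≡ true → s ≡ t
  same-start {x} {y} {y′} {s} {t} h k with x Fin.≟ y | x Fin.≟ y′
  ... | yes refl | _ = let p = ok-refl (exit-ok {x} {x} h) in trans (sym (exit-start {x} {x} h p)) (exit-start {x} {y′} k p)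
  ... | no _ | yes refl = let p = ok-refl (exit-ok {x} {x} k) in trans (sym (exit-start {x} {y} h p)) (exit-start {x} {x} k p)
  ... | no n | no n′ with ok⁻ {x} {y} (exit-ok {x} {y} h) | ok⁻ {x} {y′} (exit-ok {x} {y′} k)
  ... | a , b , e | _ , b′ , e′ with twice a b b′ e (trans (sym e) e′)
  ...   | inj₁ q        = ⊥-elim (n q)
  ...   | inj₂ (inj₁ q) = exit-unique {x} {y} h (subst (λ z → exits-at x z t ≡ true) (sym q) k)
  ...   | inj₂ (inj₂ q) = ⊥-elim (n′ q)

  -- Exits of one colour come from vertices of Y with one label, and each of these has a single
  -- exit.
  twice′ : AtMostTwice S l′
  twice′ = relabelled-twice triple
    where
    triple : ∀ {s t u} → s ∈ marked → t ∈ marked → u ∈ marked → col s ≡ col t → col t ≡ col u → s ≡ t ⊎ t ≡ u ⊎ s ≡ u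
    triple m m′ m″ c c′ with marked⁻ m | marked⁻ m′ | marked⁻ m″
    ... | x , x′ , p | y , y′ , q | z , z′ , r
      with twice (proj₁ (ok⁻ {x} {x′} (exit-ok {x} {x′} p))) (proj₁ (ok⁻ {y} {y′} (exit-ok {y} {y′} q)))
                 (proj₁ (ok⁻ {z} {z′} (exit-ok {z} {z′} r)))
                 (trans (sym (exit-col {x} {x′} p)) (trans c (exit-col {y} {y′} q)))
                 (trans (sym (exit-col {y} {y′} q)) (trans c′ (exit-col {z} {z′} r)))
    ...   | inj₁ refl        = inj₁ (same-start {x} {x′} {y′} p q)
    ...   | inj₂ (inj₁ refl) = inj₂ (inj₁ (same-start {y} {y′} {z′} q r))
    ...   | inj₂ (inj₂ refl) = inj₂ (inj₂ (same-start {x} {x′} {z′} p r))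

  col′ : Fin N → ℕ
  col′ = proj₁ (inner l′ twice′)

  -- Vertices of S take their colour from the far side, whose walks may pass through S again.
  -- Subtracting N undoes the shift of `Relabel`.
  final : Fin N → ℕ
  final z = if A z ∧ not (S z) then col z else col′ z ∸ N

  final-A : ∀ {z} → z ∈ A → S z ≡ false → final z ≡ col z
  final-A {z} a s = if-true (∧⁺ a (not⁺ s))

  final-C : ∀ {z c} → z ∈ C ∪ S → col′ z ≡ N + c → final z ≡ c
  final-C {z} {c} h e = trans (if-false outside)
                              (trans (cong (_∸ N) e) (m+n∸m≡n N c))
    where
    outside : A z ∧ not (S z) ≡ false
    outside with ∨⁻ {C z} h
    ... | inj₁ p = cong (_∧ not (S z)) (disj p)
    ... | inj₂ p = trans (cong (λ b → A z ∧ not b) p) (Bool.∧-zeroʳ (A z))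

  Final : ℕ → Fin N → Set
  Final c z = z ∈ A ∪ C × final z ≡ c

  -- An edge of the clique has two different ends in S, but a trimmed walk meets S at most in d.
  edge-G : ∀ {d x y} → (x ∈ S → x ≡ d) → (y ∈ S → y ≡ d) → E G⁺ x y ≡ true → E G x y ≡ true
  edge-G {d} {x} {y} p q e with ∨⁻ {E G x y} e
  ... | inj₁ r = r
  ... | inj₂ r with p (∧-left r) | q (∧-left (∧-right {S x} r))
  ...   | refl | refl = absurd (==⁺ d) (not⁻ (∧-right {S d} (∧-right {S d} r)))

  start : ∀ {x y} p (D : Door x) → door x y p ≡ inj₁ D → Walk G (Final (l x)) x (proj₁ D) × l′ (proj₁ D) ≡ N + l x
  start {x} {y} p D@(d , d∈S , w) eq = walk-map (λ {z} → inside {z}) (λ (_ , a) (_ , b) → edge-G a b) w , l′d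
    where
    mark : d ∈ marked
    mark = marked⁺ {x} {y} (exit⁺ x y p eq)
    l′d : l′ d ≡ N + l x
    l′d = trans (marked-label mark) (cong (N +_) (proj₂ (proj₁ (walk-last w))))
    inside : ∀ {z} → (z ∈ A × col z ≡ l x) × (z ∈ S → z ≡ d) → Final (l x) z
    inside {z} ((a , b) , u) with bool (S z)
    ... | inj₂ s = ∨-introˡ a , trans (final-A a s) b
    ... | inj₁ s with u s
    ...   | refl = ∨-introˡ a , final-C (∨-introʳ {C z} s) (trans
        (proj₂ (walk-head (proj₂ (inner l′ twice′) d∈S d∈S refl))) l′d)

  direct : ∀ {x y} → Walk G⁺ (λ z → (z ∈ A × col z ≡ l x) × S z ≡ false) x y → Walk G (Final (l x)) x y
  direct = walk-map (λ { ((a , b) , s) → ∨-introˡ a , trans (final-A a s) b })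
    (λ {x} {y} (_ , s) (_ , t) → edge-G {x} (λ p → absurd p s) (λ p → absurd p t))

  swap-ok : ∀ {x y} → ok x y ≡ true → x ≢ y → ok y x ≡ true
  swap-ok {x} {y} p n = let a , b , e = ok⁻ p in ok⁺ b a (sym e) (∨-introˡ (not⁺ (≢⇒≠ (λ q → n (sym q)))))

  relabel : ∀ {c d x y} → c ≡ d → Walk G (Final c) x y → Walk G (Final d) x y
  relabel refl w = w

  join : ∀ {x y} → ok x y ≡ true → ok y x ≡ true → Walk G (Final (l x)) x y
  join {x} {y} p q with door x y p in eq | door y x q in eq′
  ... | inj₂ w | _      = direct w
  ... | inj₁ D | inj₂ w = relabel (sym (proj₂ (proj₂ (ok⁻ {x} {y} p)))) (walk-reverse (direct w))
  ... | inj₁ D@(d , d∈S , _) | inj₁ D′@(d′ , d′∈S , _) =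
    let e = proj₂ (proj₂ (ok⁻ {x} {y} p))
        u , m = start p D eq
        u′ , m′ = start q D′ eq′
    in u ⊙ walk-weaken (λ {z} (a , b) →
                taut 3 (λ c s a → (s ⇛ a) ⇒ c ∨ s ⇒ ! (a ∨ c)) refl (C z) (S z) (A z) (⇛⁺ S⊆A) a ,
                final-C a (trans b m))
              (proj₂ (inner l′ twice′) d∈S d′∈S (trans m (trans (cong (N +_) e) (sym m′))))
         ⊙ relabel (sym e) (walk-reverse u′)

  joined : ∀ {x y} → x ∈ Y → y ∈ Y → l x ≡ l y → Walk G (Final (l x)) x y
  joined {x} {y} a b e with x Fin.≟ y
  ... | no n = let p = ok⁺ a b e (∨-introˡ (not⁺ (≢⇒≠ n))) in join p (swap-ok p n)
  ... | yes refl with bool (S x)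
  ...   | inj₁ s = let p = ok⁺ a a e (∨-introʳ {not (x == x)} s) in join p p
  ...   | inj₂ s = let h , k = walk-head (proj₂ (outer l twice) a a refl) in
                   stop (∨-introˡ h , trans (final-A h s) k)

glue : ∀ {G : Graph N} {A C S Y} → S ⊆ A → (∀ {z} → z ∈ C → A z ≡ false) →
       Routable (addClique G S) A Y → Routable G (C ∪ S) S → Routable G (A ∪ C) Y
glue {G = G} {A} {C} {S} S⊆A disj outer inner l twice = final , joined
  where open Glue {G = G} {A} {C} {S} S⊆A disj outer inner l twice

-- Separations and massed sets

sep-vertex : (v x c s : Bool) → Bool
sep-vertex v x c s = (c ⇛ v) ∧ (s ⇛ v) ∧ not (c ∧ s) ∧ not (x ∧ c)

sep-edge : (e v′ c s c′ s′ : Bool) → Bool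
sep-edge e v′ c s c′ s′ = not (e ∧ c ∧ v′ ∧ not c′ ∧ not s′)

-- C is disjoint from X, and its neighbours outside C lie in S.
record Sep (G : Graph N) (V X C S : VSet N) : Set where
  constructor sep
  field
    sep-at     : ∀ x → sep-vertex (V x) (X x) (C x) (S x) ≡ true
    sep-across : ∀ x y → sep-edge (E G x y) (V y) (C x) (S x) (C y) (S y) ≡ true

open Sep

pair : (v v′ e c c′ : Bool) → Bool
pair v v′ e c c′ = v ∧ v′ ∧ e ∧ (c ∨ c′)

-- Twice the number of edges that meet C.
incidence : Graph N → (V C : VSet N) → ℕ
incidence G V C = pairs (λ x y → pair (V x) (V y) (E G x y) (C x) (C y))

incidence-mono : ∀ {G H : Graph N} {V W C D : VSet N} →
                 (∀ x y → pair (V x) (V y) (E G x y) (C x) (C y) ⇛ pair (W x) (W y) (E H x y) (D x) (D y) ≡ true) →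
                 incidence G V C ≤ incidence H W D
incidence-mono h = sum-mono (λ x → #-mono (λ {y} → ⇛⁻ (h x y)))

incidence-cong : ∀ {G : Graph N} {V C D : VSet N} → (∀ x → C x ≡ D x) → incidence G V C ≡ incidence G V D
incidence-cong {G = G} {V} h = sum-cong (λ x → #-cong (λ y → cong₂ (pair (V x) (V y) (E G x y)) (h x) (h y)))

-- The factor 30 is 15 doubled, as `incidence` counts ordered pairs.
record Massed (G : Graph N) (V X : VSet N) : Set where
  field
    X⊆V   : X ⊆ V
    heavy : 30 * # (V ∖ X) < incidence G V (V ∖ X)
    light : ∀ C S → Sep G V X C S → # S < # X → incidence G V C ≤ 30 * # C

open Massed

violation? : ∀ (G : Graph N) V X k →
             (∃ λ C → ∃ λ S → Sep G V X C S × # S < k × 30 * # C < incidence G V C) ⊎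
             (∀ C S → Sep G V X C S → # S < k → incidence G V C ≤ 30 * # C)
violation? G V X k with search (λ x → sep-vertex (V x) (X x)) (λ x y → sep-edge (E G x y) (V y))
    (λ C S → (# S ℕ.<? k) ×-dec (30 * # C ℕ.<? incidence G V C))
    (λ c s (h , h′) → subst (_< k) (#-cong s) h ,
       <-≤-trans (≤-<-trans (≤-reflexive (cong (30 *_) (sym (#-cong c)))) h′)
                   (≤-reflexive (incidence-cong {G = G} {V} c)))
... | inj₁ (C , S , h , h′ , l) = inj₁ (C , S , sep h h′ , l)
... | inj₂ none = inj₂ λ C S σ l → ≮⇒≥ (λ v → none C S (sep-at σ , sep-across σ , l , v))

massed? : ∀ {G : Graph N} {V X} → X ⊆ V → 30 * # (V ∖ X) < incidence G V (V ∖ X) →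
          Massed G V X ⊎ (∃ λ C → ∃ λ S → Sep G V X C S × # S < # X × 30 * # C < incidence G V C)
massed? {G = G} {V} {X} s h with violation? G V X (# X)
... | inj₁ v = inj₂ v
... | inj₂ l = inj₁ (record { X⊆V = s ; heavy = h ; light = l })

sep⇒⊆ : ∀ {G : Graph N} {V X C S} → Sep G V X C S → C ∪ S ⊆ V
sep⇒⊆ {V = V} {X} {C} {S} σ {x} = taut 4 (λ v x c s → sep-vertex v x c s ⇒ c ∨ s ⇒ ! v) refl
  (V x) (X x) (C x) (S x) (sep-at σ x)

-- If S is not massed within the part, a violating separation of smaller order lies inside and again
-- violates the bound in V. The order therefore decreases until S is massed.
massed-part : ∀ {G : Graph N} {V X} n C S → # S ≤ n → Sep G V X C S → 30 * # C < incidence G V C →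
              ∃ λ C′ → ∃ λ S′ → Sep G V X C′ S′ × C′ ∪ S′ ⊆ C ∪ S × # S′ ≤ # S × 30 * # C′ < incidence G V C′ ×
                  Massed G (C′ ∪ S′) S′
massed-part {G = G} {V} {X} n C S size σ v with massed? {G = G} {V = C ∪ S} {X = S} (λ {x} → ∨-introʳ {C x})
    (≤-<-trans (≤-reflexive (cong (30 *_) (#-cong same)))
      (<-≤-trans v (incidence-mono {G = G} {G} {V} {C ∪ S} {C} {(C ∪ S) ∖ S} local)))
  where
  same : ∀ x → ((C ∪ S) ∖ S) x ≡ C x
  same x = cancel (C x) (S x) (taut 4 (λ v x c s → sep-vertex v x c s ⇒ ! not (c ∧ s)) refl (V x) (X x) (C x) (S x)
      (sep-at σ x))
    where
    cancel : ∀ c s → not (c ∧ s) ≡ true → (c ∨ s) ∧ not s ≡ c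
    cancel true  false _ = refl
    cancel false true  _ = refl
    cancel false false _ = refl
  -- An edge that meets C has both ends in C and S, so the restriction loses none of them.
  local : ∀ x y → pair (V x) (V y) (E G x y) (C x) (C y) ⇛
                  pair ((C ∪ S) x) ((C ∪ S) y) (E G x y) (((C ∪ S) ∖ S) x) (((C ∪ S) ∖ S) y) ≡ true
  local x y = taut 10 (λ e e′ vx vy ux uy cx cy sx sy → (e ⇛ e′) ⇒ sep-vertex vx ux cx sx ⇒ sep-vertex vy uy cy sy ⇒
      sep-edge e vy cx sx cy sy ⇒ sep-edge e′ vx cy sy cx sx ⇒
      ! (pair vx vy e cx cy ⇛ pair (cx ∨ sx) (cy ∨ sy) e ((cx ∨ sx) ∧ not sx) ((cy ∨ sy) ∧ not sy))) refl
      (E G x y) (E G y x) (V x) (V y) (X x) (X y) (C x) (C y) (S x) (S y)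
      (⇛⁺ (E-sym G)) (sep-at σ x) (sep-at σ y) (sep-across σ x y) (sep-across σ y x)
... | inj₁ m = C , S , σ , (λ p → p) , ≤-refl , v , m
... | inj₂ (C₂ , S₂ , σ₂ , smaller , v₂) = recurse n size
  where
  σ′ : Sep G V X C₂ S₂
  σ′ = sep (λ x → taut 6 (λ v u c s c₂ s₂ → sep-vertex v u c s ⇒ sep-vertex (c ∨ s) s c₂ s₂ ⇒
      ! sep-vertex v u c₂ s₂) refl
             (V x) (X x) (C x) (S x) (C₂ x) (S₂ x) (sep-at σ x) (sep-at σ₂ x))
           (λ x y → taut 10 (λ e v cx sx cy sy px qx py qy → sep-edge e v cx sx cy sy ⇒
               sep-vertex (cx ∨ sx) sx px qx ⇒
             sep-edge e (cy ∨ sy) px qx py qy ⇒ ! sep-edge e v px qx py qy) refl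
             (E G x y) (V y) (C x) (S x) (C y) (S y) (C₂ x) (S₂ x) (C₂ y) (S₂ y)
             (sep-across σ x y) (sep-at σ₂ x) (sep-across σ₂ x y))
  v′ : 30 * # C₂ < incidence G V C₂
  v′ = <-≤-trans v₂ (incidence-mono {G = G} {G} {C ∪ S} {V} {C₂} {C₂} (λ x y →
    taut 7 (λ e vx vy wx wy c c′ → (vx ⇛ wx) ⇒ (vy ⇛ wy) ⇒ ! (pair vx vy e c c′ ⇛ pair wx wy e c c′)) refl
      (E G x y) ((C ∪ S) x) ((C ∪ S) y) (V x) (V y) (C₂ x) (C₂ y) (⇛⁺ (sep⇒⊆ σ {x})) (⇛⁺ (sep⇒⊆ σ {y}))))
  recurse : ∀ n → # S ≤ n → _
  recurse zero    size = ⊥-elim (n≮0 (<-≤-trans smaller size))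
  recurse (suc n) size with massed-part n C₂ S₂ (≤-pred (<-≤-trans smaller size)) σ′ v′
  ... | C₃ , S₃ , σ₃ , sub , le , v₃ , m = C₃ , S₃ , σ₃ , (λ {x} p → sep⇒⊆ {G = G} σ₂ {x} (sub {x} p)) ,
      ≤-trans le (<⇒≤ smaller) , v₃ , m

Inductive : ℕ → ℕ → Set
Inductive N n = ∀ {G : Graph N} {V X} → # V < n → # X ≤ 8 → Massed G V X → Routable G V X

-- Once C can be routed through S, it may be replaced by a clique on S.
shrink : ∀ {G : Graph N} {V X} → Inductive N (# V) → # X ≤ 8 → Massed G V X → ∀ k C S → # (V ∖ C) ≤ k →
         Sep G V X C S → # S < # X → ∃ (_∈ C) → Routable G (C ∪ S) S → Routable G V X
shrink {N} {G} {V} {X} IH X≤8 m k C S size σ S<X (c , c∈C) r = decide (massed? {G = G′} {V = V′} {X = X} X⊆V′ heavy′)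
  where
  G′ : Graph N
  G′ = addClique G S
  V′ : VSet N
  V′ = V ∖ C
  X⊆V′ : X ⊆ V′
  X⊆V′ {x} = taut 4 (λ v x c s → sep-vertex v x c s ⇒ (x ⇛ v) ⇒ x ⇒ ! (v ∧ not c)) refl
    (V x) (X x) (C x) (S x) (sep-at σ x) (⇛⁺ (X⊆V m))
  bound₁ : # (V′ ∖ X) + # C ≤ # (V ∖ X)
  bound₁ = #+≤ {P = V′ ∖ X} {C} {V ∖ X} (λ x →
    taut 4 (λ v x c s → sep-vertex v x c s ⇒ 𝟙 ((v ∧ not c) ∧ not x) + 𝟙 c ≼ 𝟙 (v ∧ not x)) refl
      (V x) (X x) (C x) (S x) (sep-at σ x))
  bound₂ : incidence G V (V ∖ X) ≤ incidence G′ V′ (V′ ∖ X) + incidence G V C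
  bound₂ = sum≤+ (λ x → #≤+ (λ y → taut 8 (λ e f vx vy cx cy ux uy →
      𝟙 (pair vx vy e (vx ∧ not ux) (vy ∧ not uy)) ≼
      𝟙 (pair (vx ∧ not cx) (vy ∧ not cy) (e ∨ f) ((vx ∧ not cx) ∧ not ux)
          ((vy ∧ not cy) ∧ not uy)) + 𝟙 (pair vx vy e cx cy)) refl
      (E G x y) (S x ∧ S y ∧ not (x == y)) (V x) (V y) (C x) (C y) (X x) (X y)))
  -- By `light`, C accounts for at most 30 per vertex, so the surplus survives its removal.
  heavy′ : 30 * # (V′ ∖ X) < incidence G′ V′ (V′ ∖ X)
  heavy′ = linear 6 (λ I I′ J v v′ c → 1 · con 1 ⊕ 30 ⊛ v ≼ I ⇒ 1 · I ≼ I′ ⊕ J ⇒ 1 · J ≼ 30 ⊛ c ⇒ 30 · v′ ⊕ c ≼ v ⇒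
      ⊢ con 1 ⊕ 30 ⊛ v′ ≼ I′) refl
    (incidence G V (V ∖ X)) (incidence G′ V′ (V′ ∖ X)) (incidence G V C) (# (V ∖ X)) (# (V′ ∖ X)) (# C)
    (heavy m) bound₂ (light m C S σ S<X) bound₁
  decide : Massed G′ V′ X ⊎ (∃ λ C₂ → ∃ λ S₂ → Sep G′ V′ X C₂ S₂ × # S₂ < # X × 30 * # C₂ < incidence G′ V′ C₂) →
      Routable G V X
  decide (inj₁ m′) = routable-weaken
      (λ {x} → taut 4 (λ v x c s → sep-vertex v x c s ⇒ (v ∧ not c) ∨ c ⇒ ! v) refl (V x) (X x) (C x) (S x)
          (sep-at σ x))
      (λ _ _ e → e)
      (glue {G = G} {A = V ∖ C} {C = C} {S = S}
        (λ {x} → taut 4 (λ v x c s → sep-vertex v x c s ⇒ s ⇒ ! (v ∧ not c)) refl (V x) (X x) (C x) (S x)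
            (sep-at σ x))
        (λ {x} p → trans (cong (λ b → V x ∧ not b) p) (Bool.∧-zeroʳ (V x)))
        (IH (#-strict {P = V ∖ C} {Q = V} ∧-left (sep⇒⊆ σ (∨-introˡ c∈C))
              (trans (cong (λ b → V c ∧ not b) c∈C) (Bool.∧-zeroʳ (V c)))) X≤8 m′) r)
  decide (inj₂ (C₂ , S₂ , σ₂ , S₂<X , v₂)) with massed-part (# S₂) C₂ S₂ ≤-refl σ₂ v₂
  ... | C₃ , S₃ , σ₃ , _ , S₃≤S₂ , v₃ , m₃ = continue (find (S ∩ C₃))
    where
    S₃<X : # S₃ < # X
    S₃<X = ≤-<-trans S₃≤S₂ S₂<X
    inner : Routable G′ (C₃ ∪ S₃) S₃
    inner = IH (#-strict {P = C₃ ∪ S₃} {Q = V}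
        (λ {x} → taut 5 (λ v x c c₃ s₃ → sep-vertex (v ∧ not c) x c₃ s₃ ⇒ c₃ ∨ s₃ ⇒ ! v) refl
                   (V x) (X x) (C x) (C₃ x) (S₃ x) (sep-at σ₃ x))
        (sep⇒⊆ σ (∨-introˡ c∈C))
        (not⁻ (taut 5 (λ v x c c₃ s₃ → sep-vertex (v ∧ not c) x c₃ s₃ ⇒ c ⇒ ! not (c₃ ∨ s₃)) refl
                   (V c) (X c) (C c) (C₃ c) (S₃ c) (sep-at σ₃ c) c∈C)))
      (≤-trans (<⇒≤ S₃<X) X≤8) m₃
    continue : ∃ (_∈ S ∩ C₃) ⊎ (∀ x → (S ∩ C₃) x ≡ false) → Routable G V X
    -- If C₃ misses S, no edge of the clique meets C₃ and no edge of G leads from C₃ into C; so this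
    -- separation already violates `light` in G.
    continue (inj₂ none) = ⊥-elim (<⇒≱ v₃ (≤-trans less (light m C₃ S₃ σ′ S₃<X)))
      where
      σ′ : Sep G V X C₃ S₃
      σ′ = sep
        (λ x → taut 5 (λ v x c c₃ s₃ → sep-vertex (v ∧ not c) x c₃ s₃ ⇒ ! sep-vertex v x c₃ s₃) refl
                 (V x) (X x) (C x) (C₃ x) (S₃ x) (sep-at σ₃ x))
        (λ x y → taut 14 (λ e e′ f vx vy cx cy sx sy px py qx qy u → (e ⇛ e′) ⇒ sep-edge e′ vx cy sy cx sx ⇒
            not (sx ∧ px) ⇒
                 sep-vertex (vx ∧ not cx) u px qx ⇒ sep-edge (e ∨ f) (vy ∧ not cy) px qx py qy ⇒
                     ! sep-edge e vy px qx py qy) refl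
                 (E G x y) (E G y x) (S x ∧ S y ∧ not (x == y)) (V x) (V y) (C x) (C y) (S x) (S y) (C₃ x) (C₃ y)
                     (S₃ x) (S₃ y) (X x)
                 (⇛⁺ (E-sym G)) (sep-across σ y x) (not⁺ (none x)) (sep-at σ₃ x) (sep-across σ₃ x y))
      less : incidence G′ (V ∖ C) C₃ ≤ incidence G V C₃
      less = incidence-mono {G = G′} {G} {V ∖ C} {V} {C₃} {C₃} (λ x y → taut 10 (λ e sx sy q vx vy cx cy px py →
               not (sx ∧ px) ⇒ not (sy ∧ py) ⇒
               ! (pair (vx ∧ not cx) (vy ∧ not cy) (e ∨ (sx ∧ sy ∧ not q)) px py ⇛ pair vx vy e px py)) refl
               (E G x y) (S x) (S y) (x == y) (V x) (V y) (C x) (C y) (C₃ x) (C₃ y) (not⁺ (none x)) (not⁺ (none y)))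
    -- S is a clique in the new graph, so one vertex of S in C₃ forces all of S into C₃ and S₃.
    -- Hence C₃ together with C is cut off by S₃, routable by gluing, and can be removed instead.
    -- This ends because what remains of V shrinks.
    continue (inj₁ (p , p∈)) = next k size
      where
      p∈S : p ∈ S
      p∈S = ∧-left p∈
      p∈C₃ : p ∈ C₃
      p∈C₃ = ∧-right {S p} p∈
      S⊆ : ∀ x → S x ⇛ C₃ x ∨ S₃ x ≡ true
      S⊆ x with bool (x == p)
      ... | inj₁ q = ⇛⁺ {S x} (λ _ → ∨-introˡ (subst (_∈ C₃) (==⁻ˢ q) p∈C₃))
      ... | inj₂ q = taut 11 (λ e q sp sx vx cx px qx pp qp u → sp ⇒ pp ⇒ not q ⇒ sep-vertex vx u cx sx ⇒
                       sep-edge (e ∨ (sp ∧ sx ∧ not q)) (vx ∧ not cx) pp qp px qx ⇒ ! (sx ⇛ px ∨ qx)) refl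
                       (E G p x) (p == x) (S p) (S x) (V x) (C x) (C₃ x) (S₃ x) (C₃ p) (S₃ p) (X x)
                       p∈S p∈C₃ (not⁺ (≢⇒≠ (λ r → true≢false (subst (λ z → x == z ≡ true) (sym r) (==⁺ x)) q)))
                           (sep-at σ x) (sep-across σ₃ p x)
      σ′ : Sep G V X (C₃ ∪ C) S₃
      σ′ = sep
        (λ x → taut 6 (λ v x c s c₃ s₃ → sep-vertex v x c s ⇒ sep-vertex (v ∧ not c) x c₃ s₃ ⇒
            ! sep-vertex v x (c₃ ∨ c) s₃) refl
                 (V x) (X x) (C x) (S x) (C₃ x) (S₃ x) (sep-at σ x) (sep-at σ₃ x))
        (λ x y → taut 11 (λ e f vy cx cy sx sy px py qx qy → sep-edge e vy cx sx cy sy ⇒ (sy ⇛ py ∨ qy) ⇒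
                 sep-edge (e ∨ f) (vy ∧ not cy) px qx py qy ⇒ ! sep-edge e vy (px ∨ cx) qx (py ∨ cy) qy) refl
                 (E G x y) (S x ∧ S y ∧ not (x == y)) (V y) (C x) (C y) (S x) (S y) (C₃ x) (C₃ y) (S₃ x) (S₃ y)
                 (sep-across σ x y) (S⊆ y) (sep-across σ₃ x y))
      r′ : Routable G ((C₃ ∪ C) ∪ S₃) S₃
      r′ = routable-weaken
        (λ {x} → taut 3 (λ c c₃ s₃ → (c₃ ∨ s₃) ∨ c ⇒ ! ((c₃ ∨ c) ∨ s₃)) refl (C x) (C₃ x) (S₃ x)) (λ _ _ e → e)
        (glue {G = G} {A = C₃ ∪ S₃} {C = C} {S = S} (λ {x} → ⇛⁻ (S⊆ x))
          (λ {x} h → not⁻ (taut 5 (λ v x c c₃ s₃ → sep-vertex (v ∧ not c) x c₃ s₃ ⇒ c ⇒ ! not (c₃ ∨ s₃)) refl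
                   (V x) (X x) (C x) (C₃ x) (S₃ x) (sep-at σ₃ x) h)) inner r)
      p∈V′ : p ∈ V ∖ C
      p∈V′ = sep⇒⊆ σ₃ (∨-introˡ p∈C₃)
      fewer : # (V ∖ (C₃ ∪ C)) < # (V ∖ C)
      fewer = #-strict {P = V ∖ (C₃ ∪ C)} {Q = V ∖ C}
        (λ {x} → taut 3 (λ v c c₃ → v ∧ not (c₃ ∨ c) ⇒ ! (v ∧ not c)) refl (V x) (C x) (C₃ x)) p∈V′
        (trans (cong (λ b → V p ∧ not (b ∨ C p)) p∈C₃) (Bool.∧-zeroʳ (V p)))
      next : ∀ k → # (V ∖ C) ≤ k → Routable G V X
      next zero    size = ⊥-elim (n≮0 (<-≤-trans fewer size))
      next (suc k) size = shrink IH X≤8 m k (C₃ ∪ C) S₃ (≤-pred (<-≤-trans fewer size)) σ′ S₃<X (p , ∨-introˡ p∈C₃) r′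

-- Routing to a target

-- The vertices of S outside T receive private labels.
routable-⊆ : ∀ {G : Graph N} {V S T} → T ⊆ S → Routable G V S → Routable G V T
routable-⊆ {N} {G} {V} {S} {T} T⊆S r l twice = (λ z → proj₁ routed z ∸ N) , λ {x} {y} x∈ y∈ e →
  walk-weaken (λ (a , b) → a , trans (cong (_∸ N) (trans b (marked-label x∈))) (m+n∸m≡n N (l x)))
    (proj₂ routed (T⊆S x∈) (T⊆S y∈) (trans (marked-label x∈) (trans (cong (N +_) e) (sym (marked-label y∈)))))
  where
  open Relabel T l
  routed : Σ[ col ∈ (Fin N → ℕ) ] (∀ {x y} → x ∈ S → y ∈ S → relabelled x ≡ relabelled y →
      Walk G (λ z → z ∈ V × col z ≡ relabelled x) x y)
  routed = r relabelled (relabelled-twice twice)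

-- The walks are cut at their first vertices in D; these form T and inherit the labels of their
-- origins. A vertex of S in D is its own end, whence `S ∩ D ⊆ T`: terminals in the target stay
-- terminals, on which the degrees in a neighbourhood depend.
routable-via : ∀ {G : Graph N} {B S D Z} → Link G B S D → (∀ {z} → z ∈ B → z ∈ Z → z ∈ D) →
               (∀ T → T ⊆ D → # T ≤ # S → S ∩ D ⊆ T → Routable G Z T) → Routable G (B ∪ Z) S
routable-via {N} {G} {B} {S} {D} {Z} (col , link) B∩Z⊆D route l twice = final , walks
  where
  Path′ : Fin N → Set
  Path′ s = ∃ λ d → d ∈ D × Walk G (λ z → (z ∈ B × col z ≡ s) × (z ∈ D → z ≡ d)) s d
  path : ∀ {s} → s ∈ S → Path′ s
  path p = let d , d∈D , w = link p in trim D d∈D w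
  end : Fin N → Fin N
  end s = [ (λ p → proj₁ (path p)) , (λ _ → s) ]′ (bool (S s))
  to-end : ∀ {s} → s ∈ S → end s ∈ D × Walk G (λ z → (z ∈ B × col z ≡ s) × (z ∈ D → z ≡ end s)) s (end s)
  to-end {s} p with bool (S s)
  ... | inj₁ q = proj₂ (path q)
  ... | inj₂ q = absurd p q
  col-end : ∀ {s} → s ∈ S → col (end s) ≡ s
  col-end p = proj₂ (proj₁ (walk-last (proj₂ (to-end p))))
  T : VSet N
  T d = D d ∧ S (col d) ∧ end (col d) == d
  T⁺ : ∀ {s} → s ∈ S → end s ∈ T
  T⁺ {s} p = ∧⁺ (proj₁ (to-end p)) (∧⁺ (subst (_∈ S) (sym (col-end p)) p)
    (subst (λ z → end z == end s ≡ true) (sym (col-end p)) (==⁺ (end s))))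
  T-S : ∀ {d} → d ∈ T → col d ∈ S
  T-S {d} p = ∧-left (∧-right {D d} p)
  T-end : ∀ {d} → d ∈ T → end (col d) ≡ d
  T-end {d} p = ==⁻ (∧-right {S (col d)} (∧-right {D d} p))
  T-inj : ∀ {d e} → d ∈ T → e ∈ T → col d ≡ col e → d ≡ e
  T-inj p q e = trans (sym (T-end p)) (trans (cong end e) (T-end q))
  T≤S : # T ≤ # S
  T≤S = #-inject (λ d s → col d == s) (λ {d} p → col d , T-S p , ==⁺ (col d))
    (λ p q a b → T-inj p q (trans (==⁻ a) (==⁻ˢ b)))
  S∩D⊆T : S ∩ D ⊆ T
  S∩D⊆T {s} p = let a = ∧-left p in
    subst (_∈ T) (sym (proj₂ (walk-head (proj₂ (to-end a))) (∧-right {S s} p))) (T⁺ a)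
  l′ : Fin N → ℕ
  l′ d = l (col d)
  twice′ : AtMostTwice T l′
  twice′ p q r e f with twice (T-S p) (T-S q) (T-S r) e f
  ... | inj₁ h        = inj₁ (T-inj p q h)
  ... | inj₂ (inj₁ h) = inj₂ (inj₁ (T-inj q r h))
  ... | inj₂ (inj₂ h) = inj₂ (inj₂ (T-inj p r h))
  routed : Σ[ col′ ∈ (Fin N → ℕ) ] (∀ {x y} → x ∈ T → y ∈ T → l′ x ≡ l′ y → Walk G (λ z → z ∈ Z × col′ z ≡ l′ x) x y)
  routed = route T ∧-left T≤S S∩D⊆T l′ twice′
  col′ : Fin N → ℕ
  col′ = proj₁ routed
  final : Fin N → ℕ
  final z = if Z z then col′ z else l (col z)
  final-Z : ∀ {z} → z ∈ Z → final z ≡ col′ z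
  final-Z {z} h = if-true h
  final-B : ∀ {z} → Z z ≡ false → final z ≡ l (col z)
  final-B {z} h = if-false h
  l′-end : ∀ {s} → s ∈ S → l′ (end s) ≡ l s
  l′-end p = cong l (col-end p)
  first : ∀ {s} → s ∈ S → Walk G (λ z → z ∈ B ∪ Z × final z ≡ l s) s (end s)
  first {s} p = walk-weaken (λ {z} h → inside z h) (proj₂ (to-end p))
    where
    inside : ∀ z → (z ∈ B × col z ≡ s) × (z ∈ D → z ≡ end s) → z ∈ B ∪ Z × final z ≡ l s
    inside z ((a , b) , u) with bool (Z z)
    ... | inj₂ h = ∨-introˡ a , trans (final-B h) (cong l b)
    ... | inj₁ h with u (B∩Z⊆D a h)
    ...   | refl = ∨-introˡ a , trans (final-Z h) (trans (proj₂ (walk-head (proj₂ routed (T⁺ p) (T⁺ p) refl)))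
        (l′-end p))
  relabel : ∀ {a b x y} → a ≡ b → Walk G (λ z → z ∈ B ∪ Z × final z ≡ a) x y →
      Walk G (λ z → z ∈ B ∪ Z × final z ≡ b) x y
  relabel refl w = w
  walks : ∀ {x y} → x ∈ S → y ∈ S → l x ≡ l y → Walk G (λ z → z ∈ B ∪ Z × final z ≡ l x) x y
  walks {x} {y} p q e = first p ⊙
    walk-weaken (λ {z} (a , b) → ∨-introʳ {B z} a , trans (final-Z a) (trans b (l′-end p)))
      (proj₂ routed (T⁺ p) (T⁺ q) (trans (l′-end p) (trans e (sym (l′-end q))))) ⊙
    relabel (sym e) (walk-reverse (first q))

smallest-cut : ∀ (G : Graph N) V S D n A B → # (A ∩ B) ≤ n → Cut G V S D A B →
               ∃ λ A → ∃ λ B → Cut G V S D A B × (∀ A′ B′ → Cut G V S D A′ B′ → # (A ∩ B) ≤ # (A′ ∩ B′))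
smallest-cut G V S D n A B size c with cut? G V S D (# (A ∩ B))
... | inj₂ none = A , B , c , none
smallest-cut G V S D zero A B size c | inj₁ (A′ , B′ , c′ , less) = ⊥-elim (n≮0 (<-≤-trans less size))
smallest-cut G V S D (suc n) A B size c | inj₁ (A′ , B′ , c′ , less) =
  smallest-cut G V S D n A′ B′ (≤-pred (<-≤-trans less size)) c′

-- A smallest cut between X and D is taken in V without the interior of Z. If its order reaches the
-- size of X, Menger's theorem leads the terminals to D. Otherwise all that lies beyond the cut,
-- including the interior of Z, is cut off from X by too few vertices and can be routed through the
-- cut, so `shrink` removes it. The disjunction in the hypotheses makes that part nonempty.
route-to : ∀ {G : Graph N} {V X Z D} → Inductive N (# V) → # X ≤ 8 → Massed G V X →
           Z ⊆ V → D ⊆ Z → (∀ {x y} → x ∈ Z ∖ D → y ∈ V → E G x y ≡ true → y ∈ Z) →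
           (∀ {x} → x ∈ X → x ∈ Z → x ∈ D) → ∃ (_∈ Z ∖ D) ⊎ # X ≤ # D →
           (∀ T → T ⊆ D → # T ≤ 8 → X ∩ D ⊆ T → Routable G Z T) → Routable G V X
route-to {N} {G} {V} {X} {Z} {D} IH X≤8 m Z⊆V D⊆Z closed X-out large route =
  finish (smallest-cut G V₀ X D (# (X ∩ V₀)) X V₀ ≤-refl (cut
    (λ x → taut 4 (λ v x z d → (x ⇛ v) ⇒ (d ⇛ z) ⇒ (z ⇛ v) ⇒ (x ⇛ z ⇛ d) ⇒
             ! cut-vertex (v ∧ not (z ∧ not d)) x d x (v ∧ not (z ∧ not d))) refl
             (V x) (X x) (Z x) (D x) (⊆ᵇ X V (X⊆V m) x) (D⊆Zᵇ x) (Z⊆Vᵇ x) (X-outᵇ x))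
    (λ x y → taut 5 (λ e x v y w → (x ⇛ v) ⇒ ! cut-edge e x v y w) refl
             (E G x y) (X x) (V₀ x) (X y) (V₀ y) (⊆ᵇ X V₀ X⊆V₀ x))))
  where
  V₀ : VSet N
  V₀ = V ∖ (Z ∖ D)
  D⊆Zᵇ : ∀ x → D x ⇛ Z x ≡ true
  D⊆Zᵇ = ⊆ᵇ D Z D⊆Z
  Z⊆Vᵇ : ∀ x → Z x ⇛ V x ≡ true
  Z⊆Vᵇ = ⊆ᵇ Z V Z⊆V
  X-outᵇ : ∀ x → X x ⇛ Z x ⇛ D x ≡ true
  X-outᵇ x = ⇛⁺ (λ p → ⇛⁺ (X-out p))
  X⊆V₀ : X ⊆ V₀
  X⊆V₀ {x} = taut 4 (λ v x z d → (x ⇛ v) ⇒ (x ⇛ z ⇛ d) ⇒ x ⇒ ! (v ∧ not (z ∧ not d))) refl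
    (V x) (X x) (Z x) (D x) (⊆ᵇ X V (X⊆V m) x) (X-outᵇ x)
  D⊆V₀ : D ⊆ V₀
  D⊆V₀ {x} = taut 3 (λ v z d → (d ⇛ z) ⇒ (z ⇛ v) ⇒ d ⇒ ! (v ∧ not (z ∧ not d))) refl
    (V x) (Z x) (D x) (D⊆Zᵇ x) (Z⊆Vᵇ x)
  finish : (∃ λ A → ∃ λ B → Cut G V₀ X D A B × (∀ A′ B′ → Cut G V₀ X D A′ B′ → # (A ∩ B) ≤ # (A′ ∩ B′))) →
      Routable G V X
  finish (A , B , c , least) with <-≤-connex (# (A ∩ B)) (# X)
  ... | inj₂ X≤AB = routable-weaken
      (λ {x} → taut 3 (λ v z d → (z ⇛ v) ⇒ (v ∧ not (z ∧ not d)) ∨ z ⇒ ! v) refl (V x) (Z x) (D x) (Z⊆Vᵇ x))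
          (λ _ _ e → e)
      (routable-via {B = V₀} {Z = Z} (menger G (# V₀) ≤-refl X⊆V₀ D⊆V₀ (λ A′ B′ c′ → ≤-trans X≤AB (least A′ B′ c′)))
        (λ {x} → taut 3 (λ v z d → v ∧ not (z ∧ not d) ⇒ z ⇒ ! d) refl (V x) (Z x) (D x))
        (λ T T⊆D T≤X → route T T⊆D (≤-trans T≤X X≤8)))
  ... | inj₁ AB<X = shrink IH X≤8 m (# (V ∖ C)) C S₀ ≤-refl σ AB<X (nonempty large)
      (routable-weaken
        (λ {x} → taut 6 (λ v x a b z d → cut-vertex (v ∧ not (z ∧ not d)) x d a b ⇒ b ∨ z ⇒
                 ! (((b ∧ not a) ∨ (z ∧ not d)) ∨ (a ∧ b))) refl (V x) (X x) (A x) (B x) (Z x) (D x) (at-vertex c x))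
        (λ _ _ e → e)
        (routable-via {B = B} {Z = Z} B-link
          (λ {x} → taut 6 (λ v x a b z d → cut-vertex (v ∧ not (z ∧ not d)) x d a b ⇒ b ⇒ z ⇒ ! d) refl
                     (V x) (X x) (A x) (B x) (Z x) (D x) (at-vertex c x))
          (λ T T⊆D T≤S S∩D⊆T → route T T⊆D (≤-trans T≤S (≤-trans (<⇒≤ AB<X) X≤8))
            (λ {x} p → S∩D⊆T {x} (taut 5 (λ v x a b d → cut-vertex v x d a b ⇒ x ∧ d ⇒ ! ((a ∧ b) ∧ d)) refl
                     (V₀ x) (X x) (A x) (B x) (D x) (at-vertex c x) p)))))
    where
    C S₀ : VSet N
    C = (B ∖ A) ∪ (Z ∖ D)
    S₀ = A ∩ B
    σ : Sep G V X C S₀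
    σ = sep
      (λ x → taut 6 (λ v x a b z d → cut-vertex (v ∧ not (z ∧ not d)) x d a b ⇒ (z ⇛ v) ⇒ (x ⇛ z ⇛ d) ⇒
               ! sep-vertex v x ((b ∧ not a) ∨ (z ∧ not d)) (a ∧ b)) refl
               (V x) (X x) (A x) (B x) (Z x) (D x) (at-vertex c x) (Z⊆Vᵇ x) (X-outᵇ x))
      (λ x y → taut 12 (λ e e′ vy uy ax bx zx dx ay by zy dy → (e ⇛ e′) ⇒ cut-edge e′ ay by ax bx ⇒
               cut-vertex (vy ∧ not (zy ∧ not dy)) uy dy ay by ⇒ (zx ∧ not dx ⇛ vy ⇛ e ⇛ zy) ⇒
               ! sep-edge e vy ((bx ∧ not ax) ∨ (zx ∧ not dx)) (ax ∧ bx) ((by ∧ not ay) ∨ (zy ∧ not dy))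
                   (ay ∧ by)) refl
               (E G x y) (E G y x) (V y) (X y) (A x) (B x) (Z x) (D x) (A y) (B y) (Z y) (D y)
               (⇛⁺ (E-sym G)) (at-edge c y x) (at-vertex c y)
               (⇛⁺ {Z x ∧ not (D x)} (λ p → ⇛⁺ {V y} (λ q → ⇛⁺ (closed {x} p q)))))
    -- By minimality: a smaller cut inside B would give one between X and D after adding A to its
    -- near side.
    B-link : Link G B S₀ D
    B-link = menger G (# B) ≤-refl (λ {x} p → ∧-right {A x} p)
      (λ {x} → taut 5 (λ v x a b d → cut-vertex v x d a b ⇒ d ⇒ ! b) refl (V₀ x) (X x) (A x) (B x) (D x)
          (at-vertex c x))
      (λ A₁ B₁ c₁ → ≤-trans (least (A₁ ∪ A) B₁ (cut
        (λ x → taut 7 (λ v x d a b a₁ b₁ → cut-vertex v x d a b ⇒ cut-vertex b (a ∧ b) d a₁ b₁ ⇒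
            ! cut-vertex v x d (a₁ ∨ a) b₁) refl
                 (V₀ x) (X x) (D x) (A x) (B x) (A₁ x) (B₁ x) (at-vertex c x) (at-vertex c₁ x))
        (λ x y → taut 11 (λ e ax bx ay by px qx py qy dx dy → cut-edge e ax bx ay by ⇒ cut-edge e px qx py qy ⇒
                   cut-vertex bx (ax ∧ bx) dx px qx ⇒ cut-vertex by (ay ∧ by) dy py qy ⇒
                   ! cut-edge e (px ∨ ax) qx (py ∨ ay) qy) refl
                   (E G x y) (A x) (B x) (A y) (B y) (A₁ x) (B₁ x) (A₁ y) (B₁ y) (D x) (D y)
                   (at-edge c x y) (at-edge c₁ x y) (at-vertex c₁ x) (at-vertex c₁ y))))
        (#-mono {P = (A₁ ∪ A) ∩ B₁} {Q = A₁ ∩ B₁} λ {x} →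
          taut 5 (λ d a b a₁ b₁ → cut-vertex b (a ∧ b) d a₁ b₁ ⇒ (a₁ ∨ a) ∧ b₁ ⇒ ! (a₁ ∧ b₁)) refl
                 (D x) (A x) (B x) (A₁ x) (B₁ x) (at-vertex c₁ x)))
    nonempty : ∃ (_∈ Z ∖ D) ⊎ # X ≤ # D → ∃ (_∈ C)
    nonempty (inj₁ (z , p)) = z , ∨-introʳ {(B ∖ A) z} p
    nonempty (inj₂ X≤D) with #-size<⇒∃ {P = A ∩ B} {Q = D} (<-≤-trans AB<X X≤D)
    ... | z , p = z , taut 6 (λ v x a b d t → cut-vertex v x d a b ⇒ d ∧ not (a ∧ b) ⇒ ! ((b ∧ not a) ∨ t)) refl
                  (V₀ z) (X z) (A z) (B z) (D z) ((Z ∖ D) z) (at-vertex c z) p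

-- By `light` the massed part has a separator no smaller than X, so this separator is a target; the
-- vertex w makes the part smaller than V. Such separations arise when one more vertex turns a
-- separation of a modified graph into one of G.
route-to-separator : ∀ {G : Graph N} {V X C S w} → Inductive N (# V) → # X ≤ 8 → Massed G V X →
                     Sep G V X C S → # S ≤ # X → 30 * # C < incidence G V C → w ∈ V → (C ∪ S) w ≡ false →
                         Routable G V X
route-to-separator {N} {G} {V} {X} {C} {S} IH X≤8 m σ S≤X v w∈V w∉ with massed-part (# S) C S ≤-refl σ v
... | C′ , S′ , σ′ , sub , S′≤S , v′ , m′ with <-≤-connex (# S′) (# X)
...   | inj₁ S′<X = ⊥-elim (<⇒≱ v′ (light m C′ S′ σ′ S′<X))
...   | inj₂ X≤S′ = route-to {Z = C′ ∪ S′} {D = S′} IH X≤8 m (sep⇒⊆ σ′) (λ {x} → ∨-introʳ {C′ x})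
        (λ {x} {y} p q e → taut 6 (λ e v c s c′ s′ → sep-edge e v c s c′ s′ ⇒ (c ∨ s) ∧ not s ⇒ v ⇒ e ⇒
            ! (c′ ∨ s′)) refl
          (E G x y) (V y) (C′ x) (S′ x) (C′ y) (S′ y) (sep-across σ′ x y) p q e)
        (λ {x} → taut 4 (λ v x c s → sep-vertex v x c s ⇒ x ⇒ c ∨ s ⇒ ! s) refl (V x) (X x) (C′ x) (S′ x)
            (sep-at σ′ x))
        (inj₂ X≤S′)
        (λ T T⊆S′ _ _ → routable-⊆ T⊆S′
          (IH (#-strict {P = C′ ∪ S′} {Q = V} (sep⇒⊆ σ′) w∈V
                (¬true⇒false (λ h → true≢false (sub h) w∉))) (≤-trans S′≤S (≤-trans S≤X X≤8)) m′))

-- Contracting and deleting an edge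

-- All graphs share one vertex type, so v is not removed here; the set V loses it instead.
contract : Graph N → Fin N → Fin N → Graph N
contract G u v = record
  { E     = λ x y → E G x y ∨ (x == u ∧ not (y == u) ∧ E G v y) ∨ (y == u ∧ not (x == u) ∧ E G v x)
  ; E-sym = λ {x} {y} → taut 6 (λ e e′ p q f g → (e ⇛ e′) ⇒ e ∨ (p ∧ not q ∧ f) ∨ (q ∧ not p ∧ g) ⇒
              ! (e′ ∨ (q ∧ not p ∧ g) ∨ (p ∧ not q ∧ f))) refl
              (E G x y) (E G y x) (x == u) (y == u) (E G v y) (E G v x) (⇛⁺ (E-sym G))
  ; E-irr = λ x → not⁻ (taut 3 (λ e p f → not e ⇒ ! not (e ∨ (p ∧ not p ∧ f) ∨ (p ∧ not p ∧ f))) refl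
              (E G x x) (x == u) (E G v x) (not⁺ (E-irr G x)))
  }

contract⁻ : ∀ {G : Graph N} {u v x y} → E (contract G u v) x y ≡ true →
            E G x y ≡ true ⊎ (x ≡ u × E G v y ≡ true) ⊎ (y ≡ u × E G v x ≡ true)
contract⁻ {G = G} {u} {v} {x} {y} e with ∨⁻ {E G x y} e
... | inj₁ p = inj₁ p
... | inj₂ p with ∨⁻ {x == u ∧ not (y == u) ∧ E G v y} p
...   | inj₁ q = inj₂ (inj₁ (==⁻ (∧-left q) , ∧-right {not (y == u)} (∧-right {x == u} q)))
...   | inj₂ q = inj₂ (inj₂ (==⁻ (∧-left q) , ∧-right {not (x == u)} (∧-right {y == u} q)))

-- v takes the colour of u, and an edge that u inherited from v is replaced by a detour through v.
uncontract : ∀ {G : Graph N} {u v W X} → E G u v ≡ true → W v ≡ false →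
             Routable (contract G u v) W X → Routable G (W ∪ ⁅ v ⁆) X
uncontract {N} {G} {u} {v} {W} {X} u~v v∉W r l twice with r l twice
... | col , walks = final , λ x y e → expand (walks x y e)
  where
  final : Fin N → ℕ
  final z = if z == v then col u else col z
  In : ℕ → Fin N → Set
  In c z = z ∈ W ∪ ⁅ v ⁆ × final z ≡ c
  keep : ∀ {c z} → z ∈ W × col z ≡ c → In c z
  keep {c} {z} (a , b) = ∨-introˡ a ,
    trans (if-false (≢⇒≠ (λ { refl → true≢false a v∉W }))) b
  middle : ∀ {c} → u ∈ W × col u ≡ c → In c v
  middle (a , b) = ∨-introʳ {W v} (==⁺ v) , trans (if-true (==⁺ v)) b
  expand : ∀ {c x y} → Walk (contract G u v) (λ z → z ∈ W × col z ≡ c) x y → Walk G (In c) x y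
  expand (stop p) = stop (keep p)
  expand (step {a} {b} p e w) with contract⁻ {G = G} {u} {v} {a} {b} e
  ... | inj₁ e′               = step (keep p) e′ (expand w)
  ... | inj₂ (inj₁ (refl , f)) = step (keep p) u~v (step (middle p) f (expand w))
  ... | inj₂ (inj₂ (refl , f)) = step (keep p) (E-sym G f) (step (middle (walk-head w)) (E-sym G u~v) (expand w))

-- The bound 15 concerns the neighbours of v whose edges leave no new counted edge at u: u itself,
-- common neighbours, and terminals if u is a terminal. If the contracted graph violates `light`,
-- the position of u relative to the offending part decides how that part is used in G.
contractible : ∀ {G : Graph N} {V X u v} → Inductive N (# V) → # X ≤ 8 → Massed G V X →
               u ∈ V → v ∈ V → X v ≡ false → E G u v ≡ true →
               # (λ w → V w ∧ E G v w ∧ (w == u ∨ E G u w ∨ (X u ∧ X w))) ≤ 15 → Routable G V X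
contractible {N} {G} {V} {X} {u} {v} IH X≤8 m u∈V v∈V v∉X u~v lost≤15 =
    decide (massed? {G = G′} {V = V′} {X = X} X⊆V′ heavy′)
  where
  G′ : Graph N
  G′ = contract G u v
  V′ lost new nbr : VSet N
  V′ = V ∖ ⁅ v ⁆
  lost w = V w ∧ E G v w ∧ (w == u ∨ E G u w ∨ (X u ∧ X w))
  new w = V w ∧ E G v w ∧ not (w == u ∨ E G u w ∨ (X u ∧ X w))
  nbr w = V w ∧ E G v w
  u≢v : u ≢ v
  u≢v = E-distinct G u~v
  V′<V : ∀ {P : VSet N} → P ⊆ V → P v ≡ false → # P < # V
  V′<V {P} s = #-strict {P = P} {Q = V} s v∈V
  X⊆V′ : X ⊆ V′
  X⊆V′ {x} p = ∈-∖⁅⁆ {P = V} {x} (X⊆V m p) (λ { refl → true≢false p v∉X })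
  uᵇ : ∀ x → x == u ⇛ V x ∧ not (x == v) ≡ true
  uᵇ x = ⇛⁺ (λ e → subst (λ z → V z ∧ not (z == v) ≡ true) (==⁻ˢ e) (∧⁺ u∈V (not⁺ (≢⇒≠ u≢v))))
  vᵇ : ∀ x → x == v ⇛ V x ∧ not (X x) ≡ true
  vᵇ x = ⇛⁺ (λ e → subst (λ z → V z ∧ not (X z) ≡ true) (==⁻ˢ e) (∧⁺ v∈V (not⁺ v∉X)))
  irrᵇ : ∀ x → x == v ⇛ not (E G v x) ≡ true
  irrᵇ x = ⇛⁺ (λ e → subst (λ z → not (E G v z) ≡ true) (==⁻ˢ e) (not⁺ (E-irr G v)))
  fromᵇ : ∀ z x y → x == z ⇛ E G x y ⇛ E G z y ≡ true
  fromᵇ z x y = ==-subst (λ t → E G t y) x z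
  toᵇ : ∀ z x y → y == z ⇛ E G x y ⇛ E G z x ≡ true
  toᵇ z x y = ⇛⁺ (λ e → ⇛⁺ (λ f → E-sym G (subst (λ t → E G x t ≡ true) (==⁻ e) f)))
  -- Every edge from v to `new` reappears at u with an end outside X, so only the edges to `lost`
  -- disappear.
  balance : incidence G V (V ∖ X) + # new + # new ≤ incidence G′ V′ (V′ ∖ X) + # nbr + # nbr
  balance = ≤-respˡ (cong₂ _+_ (cong (incidence G V (V ∖ X) +_) (pairs-δˡ u new)) (pairs-δʳ u new))
    (≤-respʳ (cong₂ _+_ (cong (incidence G′ V′ (V′ ∖ X) +_) (pairs-δˡ v nbr)) (pairs-δʳ v nbr))
        (pairs-mono₃ (λ x y → taut 14 (λ e vx vy Xx Xy xu yu xv yv ux uy fx fy U →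
        (xu ⇛ e ⇛ uy) ⇒ (yu ⇛ e ⇛ ux) ⇒ (xv ⇛ e ⇛ fy) ⇒ (yv ⇛ e ⇛ fx) ⇒ (xv ⇛ not fx) ⇒ (yv ⇛ not fy) ⇒
        (xu ⇛ vx ∧ not xv) ⇒ (yu ⇛ vy ∧ not yv) ⇒ (xu ⇛ Xx ⇛ U) ⇒ (yu ⇛ Xy ⇛ U) ⇒
        𝟙 (pair vx vy e (vx ∧ not Xx) (vy ∧ not Xy)) + 𝟙 (xu ∧ vy ∧ fy ∧ not (yu ∨ uy ∨ (U ∧ Xy))) + 𝟙 (yu ∧ vx ∧ fx ∧ not (xu ∨ ux ∨ (U ∧ Xx)))
        ≼ 𝟙 (pair (vx ∧ not xv) (vy ∧ not yv) (e ∨ (xu ∧ not yu ∧ fy) ∨ (yu ∧ not xu ∧ fx)) ((vx ∧ not xv) ∧ not Xx)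
            ((vy ∧ not yv) ∧ not Xy))
          + 𝟙 (xv ∧ vy ∧ fy) + 𝟙 (yv ∧ vx ∧ fx)) refl
        (E G x y) (V x) (V y) (X x) (X y) (x == u) (y == u) (x == v) (y == v) (E G u x) (E G u y) (E G v x)
            (E G v y) (X u)
        (fromᵇ u x y) (toᵇ u x y) (fromᵇ v x y) (toᵇ v x y) (irrᵇ x) (irrᵇ y) (uᵇ x) (uᵇ y)
        (==-subst X x u) (==-subst X y u))))
  nbr≤ : # nbr ≤ # lost + # new
  nbr≤ = #≤+ (λ w → taut 3 (λ a b c → 𝟙 (a ∧ b) ≼ 𝟙 (a ∧ b ∧ c) + 𝟙 (a ∧ b ∧ not c)) refl (V w) (E G v w)
      (w == u ∨ E G u w ∨ (X u ∧ X w)))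
  fewer : suc (# (V′ ∖ X)) ≤ # (V ∖ X)
  fewer = ≤-respʳ (sym (#-delete-∈ {P = V ∖ X} {v} (∧⁺ v∈V (not⁺ v∉X))))
      (s≤s (#-mono {P = V′ ∖ X} {Q = (V ∖ X) ∖ ⁅ v ⁆} λ {x} →
      taut 3 (λ a b c → (a ∧ not b) ∧ not c ⇒ ! ((a ∧ not c) ∧ not b)) refl (V x) (x == v) (X x)))
  heavy′ : 30 * # (V′ ∖ X) < incidence G′ V′ (V′ ∖ X)
  -- Twice at most 15 lost edges are offset by the 30 that v contributed to the threshold.
  heavy′ = linear 7 (λ I I′ c n k s s′ →
      1 · con 1 ⊕ 30 ⊛ s ≼ I ⇒ 1 · I ⊕ n ⊕ n ≼ I′ ⊕ k ⊕ k ⇒ 2 · k ≼ c ⊕ n ⇒ 2 · c ≼ con 15 ⇒ 30 · con 1 ⊕ s′ ≼ s ⇒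
      ⊢ con 1 ⊕ 30 ⊛ s′ ≼ I′) refl
    (incidence G V (V ∖ X)) (incidence G′ V′ (V′ ∖ X)) (# lost) (# new) (# nbr) (# (V ∖ X)) (# (V′ ∖ X))
    (heavy m) balance nbr≤ lost≤15 fewer
  restore : V′ ∪ ⁅ v ⁆ ⊆ V
  restore {x} = taut 3 (λ a b c → (b ⇛ a ∧ c) ⇒ (a ∧ not b) ∨ b ⇒ ! a) refl (V x) (x == v) (not (X x)) (vᵇ x)
  v∉V′ : V′ v ≡ false
  v∉V′ = trans (cong (λ b → V v ∧ not b) (==⁺ v)) (Bool.∧-zeroʳ (V v))
  decide : Massed G′ V′ X ⊎ (∃ λ C → ∃ λ S → Sep G′ V′ X C S × # S < # X × 30 * # C < incidence G′ V′ C) →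
      Routable G V X
  decide (inj₁ m′) = routable-weaken restore (λ _ _ e → e)
    (uncontract {W = V′} u~v v∉V′ (IH (V′<V {V′} ∧-left v∉V′) X≤8 m′))
  decide (inj₂ (C₂ , S₂ , σ₂ , S₂<X , w₂)) with massed-part (# S₂) C₂ S₂ ≤-refl σ₂ w₂
  ... | C , S , σ , _ , S≤S₂ , viol , m′ = lift (bool (C u)) (bool (S u))
    where
    S<X : # S < # X
    S<X = ≤-<-trans S≤S₂ S₂<X
    v∉ : (C ∪ S) v ≡ false
    v∉ = ¬true⇒false (λ h → true≢false (sep⇒⊆ σ h) v∉V′)
    r : Routable G′ (C ∪ S) S
    r = IH (V′<V {C ∪ S} (λ {x} h → ∧-left (sep⇒⊆ σ {x} h)) v∉) (≤-trans (<⇒≤ S<X) X≤8) m′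
    across : ∀ {x y} → x ∈ C → y ∈ V → y ≢ v → E G′ x y ≡ true → y ∈ C ∪ S
    across {x} {y} c a n e = taut 6 (λ e v c s c′ s′ → sep-edge e v c s c′ s′ ⇒ c ⇒ v ⇒ e ⇒ ! (c′ ∨ s′)) refl
      (E G′ x y) (V′ y) (C x) (S x) (C y) (S y) (sep-across σ x y) c (∈-∖⁅⁆ {P = V} a n) e
    E-from : ∀ {y} → y ≢ u → E G v y ≡ true → E G′ u y ≡ true
    E-from {y} n f = ∨-introʳ {E G u y} (∨-introˡ (∧⁺ (==⁺ u) (∧⁺ (not⁺ (≢⇒≠ n)) f)))
    E-to : ∀ {x} → x ≢ u → E G v x ≡ true → E G′ x u ≡ true
    E-to n f = E-sym G′ (E-from n f)
    acrossᵇ : ∀ x y → C x ∧ V y ∧ not (y == v) ∧ E G x y ⇛ C y ∨ S y ≡ true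
    acrossᵇ x y = ⇛⁺ {C x ∧ V y ∧ not (y == v) ∧ E G x y} λ h →
      let a , b = ∖⁅⁆⁻ {P = V} {y} (taut 4 (λ c a q e → c ∧ a ∧ not q ∧ e ⇒ ! (a ∧ not q)) refl (C x) (V y) (y == v) (E G x y) h)
      in across {x} (∧-left h) a b (∨-introˡ (taut 4 (λ c a q e → c ∧ a ∧ not q ∧ e ⇒ ! e) refl (C x) (V y) (y == v)
          (E G x y) h))
    at : ∀ x → sep-vertex (V x ∧ not (x == v)) (X x) (C x) (S x) ≡ true
    at = sep-at σ
    lift : (C u ≡ true) ⊎ (C u ≡ false) → (S u ≡ true) ⊎ (S u ≡ false) → Routable G V X
    -- v joins u in C. The order stays below the size of X, and undoing the contraction routes the
    -- enlarged part.
    lift (inj₁ u∈C) _ = shrink IH X≤8 m (# (V ∖ (C ∪ ⁅ v ⁆))) (C ∪ ⁅ v ⁆) S ≤-refl σ′ S<X (u , ∨-introˡ u∈C)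
      (routable-weaken (λ {x} → taut 3 (λ c s t → (c ∨ s) ∨ t ⇒ ! ((c ∨ t) ∨ s)) refl (C x) (S x) (x == v))
          (λ _ _ e → e)
        (uncontract {W = C ∪ S} u~v v∉ r))
      where
      fromu : ∀ y → V y ∧ not (y == v) ∧ E G v y ⇛ C y ∨ S y ≡ true
      fromu y = ⇛⁺ {V y ∧ not (y == v) ∧ E G v y} λ h → helper (∧-left h)
        (λ { refl → true≢false (==⁺ v) (not⁻ (∧-left {not (v == v)} (∧-right {V v} h))) })
        (∧-right {not (y == v)} (∧-right {V y} h)) (y Fin.≟ u)
        where
        helper : y ∈ V → y ≢ v → E G v y ≡ true → Dec (y ≡ u) → y ∈ C ∪ S
        helper a n f (yes refl) = ∨-introˡ u∈C
        helper a n f (no y≢u)   = across u∈C a n (E-from y≢u f)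
      σ′ : Sep G V X (C ∪ ⁅ v ⁆) S
      σ′ = sep
        (λ x → taut 5 (λ a x c s t → sep-vertex (a ∧ not t) x c s ⇒ (t ⇛ a ∧ not x) ⇒ ! sep-vertex a x (c ∨ t) s) refl
                 (V x) (X x) (C x) (S x) (x == v) (at x) (vᵇ x))
        (λ x y → taut 9 (λ e f a p q c s c′ s′ → (c ∧ a ∧ not q ∧ e ⇛ c′ ∨ s′) ⇒ (p ⇛ e ⇛ f) ⇒
            (a ∧ not q ∧ f ⇛ c′ ∨ s′) ⇒
                 ! sep-edge e a (c ∨ p) s (c′ ∨ q) s′) refl
                 (E G x y) (E G v y) (V y) (x == v) (y == v) (C x) (S x) (C y) (S y)
                 (acrossᵇ x y) (fromᵇ v x y) (fromu y))
    -- v joins u in S, which raises the order to at most the size of X. A terminal outside S remains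
    -- outside, as v is no terminal.
    lift (inj₂ u∉C) (inj₁ u∈S) with #-size<⇒∃ {P = S} {Q = X} S<X
    ... | w , h = route-to-separator IH X≤8 m σ′ size v′ (X⊆V m (∧-left h)) outside
      where
      σ′ : Sep G V X C (S ∪ ⁅ v ⁆)
      σ′ = sep
        (λ x → taut 5 (λ a x c s t → sep-vertex (a ∧ not t) x c s ⇒ (t ⇛ a ∧ not x) ⇒ ! sep-vertex a x c (s ∨ t)) refl
                 (V x) (X x) (C x) (S x) (x == v) (at x) (vᵇ x))
        (λ x y → taut 7 (λ e a q c t c′ s′ → (c ∧ a ∧ not q ∧ e ⇛ c′ ∨ s′) ⇒ ! sep-edge e a c t c′ (s′ ∨ q)) refl
                 (E G x y) (V y) (y == v) (C x) ((S ∪ ⁅ v ⁆) x) (C y) (S y) (acrossᵇ x y))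
      size : # (S ∪ ⁅ v ⁆) ≤ # X
      size = ≤-trans (#-∪ S ⁅ v ⁆) (≤-trans (+-monoʳ-≤ (# S) (#-⁅⁆ v)) (≤-respˡ (sym (+-comm (# S) 1)) S<X))
      K : VSet N
      K x = C x ∧ E G v x
      -- Contraction hands the edges from v into C over to u. The star from v to K on the left and
      -- the one from u to K on the right make this a pointwise comparison.
      more : incidence G′ V′ C + # K + # K ≤ incidence G V C + # K + # K
      more = ≤-respˡ (cong₂ _+_ (cong (incidence G′ V′ C +_) (pairs-δˡ v K)) (pairs-δʳ v K))
        (≤-respʳ (cong₂ _+_ (cong (incidence G V C +_) (pairs-δˡ u K)) (pairs-δʳ u K))
            (pairs-mono₃ (λ x y → taut 13 (λ e vx vy cx cy xu yu xv yv fx fy sx sy →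
            (xu ⇛ vx ∧ not xv) ⇒ (yu ⇛ vy ∧ not yv) ⇒ (xv ⇛ vx ∧ sx) ⇒ (yv ⇛ vy ∧ sy) ⇒
                (cx ⇛ vx ∧ not xv ∧ not xu) ⇒ (cy ⇛ vy ∧ not yv ∧ not yu) ⇒
            (xv ⇛ fy ⇛ e) ⇒ (yv ⇛ fx ⇛ e) ⇒
            𝟙 (pair (vx ∧ not xv) (vy ∧ not yv) (e ∨ (xu ∧ not yu ∧ fy) ∨ (yu ∧ not xu ∧ fx)) cx cy) + 𝟙 (xv ∧ cy ∧ fy) + 𝟙 (yv ∧ cx ∧ fx)
            ≼ 𝟙 (pair vx vy e cx cy) + 𝟙 (xu ∧ cy ∧ fy) + 𝟙 (yu ∧ cx ∧ fx)) refl
            (E G x y) (V x) (V y) (C x) (C y) (x == u) (y == u) (x == v) (y == v) (E G v x) (E G v y) (not (X x))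
                (not (X y))
            (uᵇ x) (uᵇ y) (vᵇ x) (vᵇ y) (C-in x) (C-in y)
            (⇛⁺ (λ e → ⇛⁺ (subst (λ t → E G t y ≡ true) (==⁻ˢ e))))
            (⇛⁺ (λ e → ⇛⁺ (λ f → subst (λ t → E G x t ≡ true) (==⁻ˢ e) (E-sym G f)))))))
        where
        C-in : ∀ x → C x ⇛ V x ∧ not (x == v) ∧ not (x == u) ≡ true
        C-in x = taut 6 (λ a x c s t p → sep-vertex (a ∧ not t) x c s ⇒ (p ⇛ not c) ⇒ ! (c ⇛ a ∧ not t ∧ not p)) refl
                   (V x) (X x) (C x) (S x) (x == v) (x == u) (at x)
                   (⇛⁺ (λ e → subst (λ z → not (C z) ≡ true) (==⁻ˢ e) (not⁺ u∉C)))
      v′ : 30 * # C < incidence G V C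
      v′ = <-≤-trans viol (+-cancelʳ-≤ (# K) _ _ (+-cancelʳ-≤ (# K) _ _ more))
      outside : (C ∪ (S ∪ ⁅ v ⁆)) w ≡ false
      outside = not⁻ (taut 5 (λ a x c s t → sep-vertex (a ∧ not t) x c s ⇒ x ∧ not s ⇒ (t ⇛ a ∧ not x) ⇒
          ! not (c ∨ (s ∨ t))) refl
                  (V w) (X w) (C w) (S w) (w == v) (at w) h (vᵇ w))
    -- With u beyond S, no neighbour of v lies in C, so the edges at C are unchanged.
    lift (inj₂ u∉C) (inj₂ u∉S) = ⊥-elim (<⇒≱ viol (≤-trans less (light m C S σ′ S<X)))
      where
      u∉ : ∀ x → x == u ⇛ not (C x) ≡ true
      u∉ x = ⇛⁺ (λ e → subst (λ z → not (C z) ≡ true) (==⁻ˢ e) (not⁺ u∉C))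
      far : ∀ x → C x ⇛ not (E G v x) ≡ true
      far x = ⇛⁺ {C x} (λ c → not⁺ (¬true⇒false (λ f → true≢false
        (across c u∈V u≢v (E-to (λ { refl → true≢false c u∉C }) f)) (cong₂ _∨_ u∉C u∉S))))
      σ′ : Sep G V X C S
      σ′ = sep
        (λ x → taut 5 (λ a x c s t → sep-vertex (a ∧ not t) x c s ⇒ ! sep-vertex a x c s) refl
                 (V x) (X x) (C x) (S x) (x == v) (at x))
        (λ x y → taut 8 (λ e f a q c s c′ s′ → (c ∧ a ∧ not q ∧ e ⇛ c′ ∨ s′) ⇒ (c ⇛ not f) ⇒ (q ⇛ e ⇛ f) ⇒
            ! sep-edge e a c s c′ s′) refl
                 (E G x y) (E G v x) (V y) (y == v) (C x) (S x) (C y) (S y) (acrossᵇ x y) (far x) (toᵇ v x y))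
      less : incidence G′ V′ C ≤ incidence G V C
      less = incidence-mono {G = G′} {G} {V′} {V} {C} {C} (λ x y → taut 11 (λ e a b p q c d xu yu f g →
        (c ⇛ not f) ⇒ (d ⇛ not g) ⇒ (xu ⇛ not c) ⇒ (yu ⇛ not d) ⇒
        ! (pair (a ∧ not p) (b ∧ not q) (e ∨ (xu ∧ not yu ∧ g) ∨ (yu ∧ not xu ∧ f)) c d ⇛ pair a b e c d)) refl
        (E G x y) (V x) (V y) (x == v) (y == v) (C x) (C y) (x == u) (y == u) (E G v x) (E G v y)
        (far x) (far y) (u∉ x) (u∉ y))

delete : Graph N → Fin N → Fin N → Graph N
delete G u v = record
  { E     = λ x y → E G x y ∧ not ((x == u ∧ y == v) ∨ (x == v ∧ y == u))
  ; E-sym = λ {x} {y} → taut 6 (λ e e′ p q r s → (e ⇛ e′) ⇒ e ∧ not ((p ∧ q) ∨ (r ∧ s)) ⇒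
      ! (e′ ∧ not ((s ∧ r) ∨ (q ∧ p)))) refl
              (E G x y) (E G y x) (x == u) (y == v) (x == v) (y == u) (⇛⁺ (E-sym G))
  ; E-irr = λ x → cong (_∧ not ((x == u ∧ x == v) ∨ (x == v ∧ x == u))) (E-irr G x)
  }

incidence-delete : ∀ {G : Graph N} {V C} u v → incidence G V C ≤ 2 + incidence (delete G u v) V C
incidence-delete {N} {G} {V} {C} u v = linear 6 (λ I I′ a b c d →
    1 · I ⊕ a ⊕ b ≼ I′ ⊕ c ⊕ d ⇒ 1 · c ≼ con 1 ⇒ 1 · d ≼ con 1 ⇒ ⊢ I ≼ con 2 ⊕ I′) refl
  (incidence G V C) (incidence (delete G u v) V C) (pairs {N} (λ _ _ → false)) (pairs {N} (λ _ _ → false))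
  (pairs (λ x y → x == u ∧ ⁅ v ⁆ y)) (pairs (λ x y → x == v ∧ ⁅ u ⁆ y))
  (pairs-mono₃ (λ x y → taut 9 (λ e a b c d p q r s →
     𝟙 (pair a b e c d) + 𝟙 false + 𝟙 false ≼ 𝟙 (pair a b (e ∧ not ((p ∧ q) ∨ (r ∧ s))) c d) + 𝟙 (p ∧ q) + 𝟙 (r ∧ s)) refl
     (E G x y) (V x) (V y) (C x) (C y) (x == u) (y == v) (x == v) (y == u)))
  (≤-respˡ (sym (pairs-δˡ u ⁅ v ⁆)) (#-⁅⁆ v)) (≤-respˡ (sym (pairs-δˡ v ⁅ u ⁆)) (#-⁅⁆ u))

-- Deletion costs two ordered pairs, hence the 3 in the hypothesis. A violating separation that is
-- none of G has one end of the edge in C and the other beyond S; the latter is added to S. As it is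
-- no terminal, some terminal stays outside the part.
deletable : ∀ {G : Graph N} {V X u v} → Inductive N (# V) → # X ≤ 8 → Massed G V X →
            u ∈ V ∖ X → v ∈ V ∖ X → 3 + 30 * # (V ∖ X) ≤ incidence G V (V ∖ X) →
            (Massed (delete G u v) V X → Routable (delete G u v) V X) → Routable G V X
deletable {N} {G} {V} {X} {u} {v} IH X≤8 m u∈ v∈ spare IH′ with massed? {G = delete G u v} {V = V} {X = X} (X⊆V m)
    (≤-pred (≤-pred (≤-trans spare (incidence-delete {G = G} {V} {V ∖ X} u v))))
... | inj₁ m′ = routable-weaken (λ h → h) (λ _ _ e → ∧-left e) (IH′ m′)
... | inj₂ (C , S , σ , S<X , viol) = decide (bool (C u ∧ not (C v ∨ S v))) (bool (C v ∧ not (C u ∨ S u)))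
  where
  viol′ : 30 * # C < incidence G V C
  viol′ = <-≤-trans viol (incidence-mono {G = delete G u v} {G} {V} {V} {C} {C} (λ x y →
    taut 6 (λ e a b c d f → ! (pair a b (e ∧ f) c d ⇛ pair a b e c d)) refl
      (E G x y) (V x) (V y) (C x) (C y) (not ((x == u ∧ y == v) ∨ (x == v ∧ y == u)))))
  enlarge : ∀ w → w ∈ V ∖ X → C w ∨ S w ≡ false →
            (∀ x y → (x == u ∧ y == v) ∨ (x == v ∧ y == u) ⇛ C x ⇛ y == w ∨ (C y ∨ S y) ≡ true) → Routable G V X
  enlarge w w∈ w∉ only with #-size<⇒∃ {P = S} {Q = X} S<X
  ... | z , h = route-to-separator IH X≤8 m σ′
      (≤-trans (#-∪ S ⁅ w ⁆) (≤-trans (+-monoʳ-≤ (# S) (#-⁅⁆ w)) (≤-respˡ (sym (+-comm (# S) 1)) S<X)))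
      viol′ (X⊆V m (∧-left h))
      (not⁻ (taut 5 (λ a x c s t → sep-vertex a x c s ⇒ x ∧ not s ⇒ (t ⇛ not x) ⇒ ! not (c ∨ (s ∨ t))) refl
                  (V z) (X z) (C z) (S z) (z == w) (sep-at σ z) h
                  (⇛⁺ (λ e → subst (λ t → not (X t) ≡ true) (==⁻ˢ e) (∧-right {V w} w∈)))))
    where
    σ′ : Sep G V X C (S ∪ ⁅ w ⁆)
    σ′ = sep
      (λ x → taut 5 (λ a x c s t → sep-vertex a x c s ⇒ (t ⇛ a ∧ not x ∧ not (c ∨ s)) ⇒
          ! sep-vertex a x c (s ∨ t)) refl
               (V x) (X x) (C x) (S x) (x == w) (sep-at σ x)
               (⇛⁺ (λ e → subst (λ t → V t ∧ not (X t) ∧ not (C t ∨ S t) ≡ true) (==⁻ˢ e)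
                 (∧⁺ (∧-left {V w} w∈) (∧⁺ (∧-right {V w} w∈) (not⁺ w∉))))))
      (λ x y → taut 9 (λ e f a q c s c′ s′ t → sep-edge (e ∧ not f) a c s c′ s′ ⇒ (f ⇛ c ⇛ q ∨ (c′ ∨ s′)) ⇒
          ! sep-edge e a c (s ∨ t) c′ (s′ ∨ q)) refl
               (E G x y) ((x == u ∧ y == v) ∨ (x == v ∧ y == u)) (V y) (y == w) (C x) (S x) (C y) (S y) (x == w)
               (sep-across σ x y) (only x y))
  ends : ∀ {x y} → (x == u ∧ y == v) ∨ (x == v ∧ y == u) ≡ true → (x ≡ u × y ≡ v) ⊎ (x ≡ v × y ≡ u)
  ends {x} {y} h with ∨⁻ {x == u ∧ y == v} h
  ... | inj₁ p = inj₁ (==⁻ (∧-left p) , ==⁻ (∧-right {x == u} p))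
  ... | inj₂ p = inj₂ (==⁻ (∧-left p) , ==⁻ (∧-right {x == v} p))
  decide : (C u ∧ not (C v ∨ S v) ≡ true) ⊎ (C u ∧ not (C v ∨ S v) ≡ false) →
           (C v ∧ not (C u ∨ S u) ≡ true) ⊎ (C v ∧ not (C u ∨ S u) ≡ false) → Routable G V X
  decide (inj₁ p) _ = enlarge v v∈ (not⁻ (∧-right {C u} p)) (λ x y → ⇛⁺ (λ h → case (ends h)))
    where
    case : ∀ {x y} → (x ≡ u × y ≡ v) ⊎ (x ≡ v × y ≡ u) → C x ⇛ y == v ∨ (C y ∨ S y) ≡ true
    case (inj₁ (refl , refl)) = ⇛⁺ {C u} (λ _ → ∨-introˡ (==⁺ v))
    case (inj₂ (refl , refl)) = ⇛⁺ {C v} (λ c → absurd (∨-introˡ {C v} {S v} c) (not⁻ (∧-right {C u} p)))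
  decide (inj₂ _) (inj₁ p) = enlarge u u∈ (not⁻ (∧-right {C v} p)) (λ x y → ⇛⁺ (λ h → case (ends h)))
    where
    case : ∀ {x y} → (x ≡ u × y ≡ v) ⊎ (x ≡ v × y ≡ u) → C x ⇛ y == u ∨ (C y ∨ S y) ≡ true
    case (inj₂ (refl , refl)) = ⇛⁺ {C v} (λ _ → ∨-introˡ (==⁺ u))
    case (inj₁ (refl , refl)) = ⇛⁺ {C u} (λ c → absurd (∨-introˡ {C u} {S u} c) (not⁻ (∧-right {C v} p)))
  decide (inj₂ p) (inj₂ q) = ⊥-elim (<⇒≱ viol′ (light m C S σ′ S<X))
    where
    case : ∀ {x y} → (x ≡ u × y ≡ v) ⊎ (x ≡ v × y ≡ u) → C x ⇛ C y ∨ S y ≡ true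
    case (inj₁ (refl , refl)) = taut 2 (λ a b → not (a ∧ not b) ⇒ ! (a ⇛ b)) refl (C u) (C v ∨ S v) (not⁺ p)
    case (inj₂ (refl , refl)) = taut 2 (λ a b → not (a ∧ not b) ⇒ ! (a ⇛ b)) refl (C v) (C u ∨ S u) (not⁺ q)
    σ′ : Sep G V X C S
    σ′ = sep (sep-at σ) (λ x y → taut 7 (λ e f a c s c′ s′ → sep-edge (e ∧ not f) a c s c′ s′ ⇒ (f ⇛ c ⇛ c′ ∨ s′) ⇒
        ! sep-edge e a c s c′ s′) refl
      (E G x y) ((x == u ∧ y == v) ∨ (x == v ∧ y == u)) (V y) (C x) (S x) (C y) (S y)
      (sep-across σ x y) (⇛⁺ {(x == u ∧ y == v) ∨ (x == v ∧ y == u)} (λ h → case (ends h))))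

-- Lists of vertices, and paths as lists

mem : List (Fin N) → VSet N
mem []      z = false
mem (x ∷ ℓ) z = z == x ∨ mem ℓ z

count : VSet N → List (Fin N) → ℕ
count P []      = 0
count P (x ∷ ℓ) = 𝟙 (P x) + count P ℓ

mult : List (Fin N) → Fin N → ℕ
mult ℓ z = count (λ x → z == x) ℓ

-- Phrased by multiplicities, so that rearranging and splitting concatenations is linear arithmetic.
Distinct : List (Fin N) → Set
Distinct ℓ = ∀ z → mult ℓ z ≤ 1

count-++ : ∀ (P : VSet N) ℓ ℓ′ → count P (ℓ ++ ℓ′) ≡ count P ℓ + count P ℓ′
count-++ P []      ℓ′ = refl
count-++ P (x ∷ ℓ) ℓ′ = trans (cong (𝟙 (P x) +_) (count-++ P ℓ ℓ′)) (sym (+-assoc (𝟙 (P x)) _ _))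

𝟙≤1 : ∀ b → 𝟙 b ≤ 1
𝟙≤1 = taut 1 (λ b → 𝟙 b ≼ 1) refl

count≤length : ∀ (P : VSet N) ℓ → count P ℓ ≤ length ℓ
count≤length P []      = z≤n
count≤length P (x ∷ ℓ) = +-mono-≤ (𝟙≤1 (P x)) (count≤length P ℓ)

count-mono : ∀ {P Q : VSet N} → P ⊆ Q → ∀ ℓ → count P ℓ ≤ count Q ℓ
count-mono s []      = z≤n
count-mono s (x ∷ ℓ) = +-mono-≤ (𝟙-mono s) (count-mono s ℓ)

mem⇒mult : ∀ {ℓ} {z : Fin N} → z ∈ mem ℓ → 1 ≤ mult ℓ z
mem⇒mult {ℓ = x ∷ ℓ} {z} h with bool (z == x)
... | inj₁ p = ≤-respˡ (sym (cong 𝟙 (sym p))) (m≤m+n _ _)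
... | inj₂ p = ≤-trans (mem⇒mult {ℓ = ℓ} (subst (λ b → b ∨ mem ℓ z ≡ true) p h)) (m≤n+m _ _)

mult⇒mem : ∀ ℓ {z : Fin N} → 1 ≤ mult ℓ z → z ∈ mem ℓ
mult⇒mem (x ∷ ℓ) {z} h with bool (z == x)
... | inj₁ p = ∨-introˡ p
... | inj₂ p = ∨-introʳ {z == x} (mult⇒mem ℓ (subst (λ b → 1 ≤ 𝟙 b + mult ℓ z) p h))

mult-∉ : ∀ ℓ {z : Fin N} → mem ℓ z ≡ false → mult ℓ z ≤ 0
mult-∉ ℓ {z} h = ≮⇒≥ (λ p → true≢false (mult⇒mem ℓ p) h)

∉-mult : ∀ ℓ {z : Fin N} → mult ℓ z ≤ 0 → mem ℓ z ≡ false
∉-mult ℓ h = ¬true⇒false (λ p → <⇒≱ (mem⇒mult {ℓ = ℓ} p) h)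

mem-++⁻ : ∀ ℓ ℓ′ {z : Fin N} → z ∈ mem (ℓ ++ ℓ′) → z ∈ mem ℓ ⊎ z ∈ mem ℓ′
mem-++⁻ []      ℓ′ h = inj₂ h
mem-++⁻ (x ∷ ℓ) ℓ′ {z} h with ∨⁻ {z == x} h
... | inj₁ p = inj₁ (∨-introˡ p)
... | inj₂ p with mem-++⁻ ℓ ℓ′ p
...   | inj₁ q = inj₁ (∨-introʳ {z == x} q)
...   | inj₂ q = inj₂ q

mem-++ˡ : ∀ ℓ ℓ′ {z : Fin N} → z ∈ mem ℓ → z ∈ mem (ℓ ++ ℓ′)
mem-++ˡ (x ∷ ℓ) ℓ′ {z} h with ∨⁻ {z == x} h
... | inj₁ p = ∨-introˡ p
... | inj₂ p = ∨-introʳ {z == x} (mem-++ˡ ℓ ℓ′ p)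

mem-++ʳ : ∀ ℓ ℓ′ {z : Fin N} → z ∈ mem ℓ′ → z ∈ mem (ℓ ++ ℓ′)
mem-++ʳ []      ℓ′ h = h
mem-++ʳ (x ∷ ℓ) ℓ′ {z} h = ∨-introʳ {z == x} (mem-++ʳ ℓ ℓ′ h)

distinct-tail : ∀ {x : Fin N} {ℓ} → Distinct (x ∷ ℓ) → Distinct ℓ
distinct-tail {x = x} d z = ≤-trans (m≤n+m _ (𝟙 (z == x))) (d z)

distinct-head : ∀ {x : Fin N} {ℓ} → Distinct (x ∷ ℓ) → mem ℓ x ≡ false
distinct-head {x = x} {ℓ} d = ∉-mult ℓ (≤-pred (≤-respˡ (sym (cong (λ b → 𝟙 b + mult ℓ x) (sym (==⁺ x)))) (d x)))

distinct-∷ : ∀ {x : Fin N} {ℓ} → mem ℓ x ≡ false → Distinct ℓ → Distinct (x ∷ ℓ)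
distinct-∷ {x = x} {ℓ} h d z with bool (z == x)
... | inj₂ p = subst (λ b → 𝟙 b + mult ℓ z ≤ 1) (sym p) (d z)
... | inj₁ p = +-mono-≤ (𝟙≤1 (z == x)) (mult-∉ ℓ (subst (λ y → mem ℓ y ≡ false) (==⁻ˢ p) h))

distinct-++ : ∀ (ℓ ℓ′ : List (Fin N)) → Distinct ℓ → Distinct ℓ′ → (∀ {z} → z ∈ mem ℓ → mem ℓ′ z ≡ false) →
    Distinct (ℓ ++ ℓ′)
distinct-++ ℓ ℓ′ d d′ apart z = ≤-respˡ (sym (count-++ _ ℓ ℓ′)) (split (bool (mem ℓ z)))
  where
  split : (mem ℓ z ≡ true) ⊎ (mem ℓ z ≡ false) → mult ℓ z + mult ℓ′ z ≤ 1
  split (inj₁ p) = +-mono-≤ (d z) (mult-∉ ℓ′ (apart p))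
  split (inj₂ p) = +-mono-≤ (mult-∉ ℓ p) (d′ z)

distinct-++⁻ : ∀ (ℓ ℓ′ : List (Fin N)) → Distinct (ℓ ++ ℓ′) → ∀ z → mult ℓ z + mult ℓ′ z ≤ 1
distinct-++⁻ ℓ ℓ′ d z = ≤-respˡ (count-++ _ ℓ ℓ′) (d z)

distinct-apart : ∀ (ℓ ℓ′ : List (Fin N)) → Distinct (ℓ ++ ℓ′) → ∀ {z} → z ∈ mem ℓ → mem ℓ′ z ≡ false
distinct-apart ℓ ℓ′ d {z} h = ∉-mult ℓ′ (linear 2 (λ a b → 1 · a ⊕ b ≼ con 1 ⇒ 1 · con 1 ≼ a ⇒ ⊢ b ≼ con 0) refl
  (mult ℓ z) (mult ℓ′ z) (distinct-++⁻ ℓ ℓ′ d z) (mem⇒mult {ℓ = ℓ} h))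

#-∖-distinct : ∀ {W : VSet N} ℓ → Distinct ℓ → mem ℓ ⊆ W → # (W ∖ mem ℓ) + length ℓ ≤ # W
#-∖-distinct {W = W} [] d s = ≤-respˡ (sym (+-identityʳ _)) (#-mono {P = W ∖ mem []} {Q = W} ∧-left)
#-∖-distinct {W = W} (x ∷ ℓ) d s = ≤-respˡ (sym (+-suc _ _))
    (≤-respʳ (sym (#-delete-∈ {P = W} {x} (s (∨-introˡ (==⁺ x))))) (s≤s
    (≤-trans (+-monoˡ-≤ (length ℓ) (#-mono {P = W ∖ mem (x ∷ ℓ)} {Q = (W ∖ ⁅ x ⁆) ∖ mem ℓ} λ {z} →
        taut 3 (λ w p q → w ∧ not (p ∨ q) ⇒ ! ((w ∧ not p) ∧ not q)) refl (W z) (z == x) (mem ℓ z)))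
      (#-∖-distinct {W = W ∖ ⁅ x ⁆} ℓ (distinct-tail {ℓ = ℓ} d) (λ {z} h →
        ∈-∖⁅⁆ {P = W} (s (∨-introʳ {z == x} h)) (λ { refl → true≢false h (distinct-head {ℓ = ℓ} d) }))))))

#-count : ∀ (P : VSet N) ℓ → # P ≤ # (P ∖ mem ℓ) + count P ℓ
#-count P [] = ≤-trans (#-mono {P = P} {Q = P ∖ mem []} (λ p → ∧⁺ p refl)) (m≤m+n _ 0)
#-count P (x ∷ ℓ) = linear 6 (λ p d q r c c′ → 1 · p ≼ d ⊕ q ⇒ 1 · q ≼ r ⊕ c ⇒ 1 · c ≼ c′ ⇒ ⊢ p ≼ r ⊕ (d ⊕ c′)) refl
  (# P) (𝟙 (P x)) (# (P ∖ ⁅ x ⁆)) (# (P ∖ mem (x ∷ ℓ))) (count (P ∖ ⁅ x ⁆) ℓ) (count P ℓ)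
  (≤-reflexive (#-delete P x))
  (≤-trans (#-count (P ∖ ⁅ x ⁆) ℓ) (+-monoˡ-≤ _ (#-mono {P = (P ∖ ⁅ x ⁆) ∖ mem ℓ} {Q = P ∖ mem (x ∷ ℓ)} λ {z} →
    taut 3 (λ w p q → (w ∧ not p) ∧ not q ⇒ ! (w ∧ not (p ∨ q))) refl (P z) (z == x) (mem ℓ z))))
  (count-mono ∧-left ℓ)

count-miss : ∀ (P : VSet N) ℓ {x} → x ∈ mem ℓ → P x ≡ false → suc (count P ℓ) ≤ length ℓ
count-miss P (y ∷ ℓ) {x} h p with bool (x == y)
... | inj₁ q = s≤s (≤-respˡ (sym (cong (λ b → 𝟙 b + count P ℓ) (subst (λ z → P z ≡ false) (==⁻ q) p)))
                              (count≤length P ℓ))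
... | inj₂ q = ≤-respˡ (+-suc (𝟙 (P y)) _)
    (+-mono-≤ (𝟙≤1 (P y)) (count-miss P ℓ (subst (λ b → b ∨ mem ℓ x ≡ true) q h) p))

infixr 5 _∷_

data Chain (G : Graph N) : Fin N → List (Fin N) → Fin N → Set where
  [_] : ∀ s → Chain G s (s ∷ []) s
  _∷_ : ∀ {s x ℓ t} → E G s x ≡ true → Chain G x ℓ t → Chain G s (s ∷ ℓ) t

module _ {G : Graph N} where

  chain-start : ∀ {s ℓ t} → Chain G s ℓ t → s ∈ mem ℓ
  chain-start [ s ]         = ∨-introˡ (==⁺ s)
  chain-start (_∷_ {s} _ _) = ∨-introˡ (==⁺ s)

  chain-end : ∀ {s ℓ t} → Chain G s ℓ t → t ∈ mem ℓ
  chain-end [ s ]             = ∨-introˡ (==⁺ s)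
  chain-end {t = t} (_∷_ {s} _ c) = ∨-introʳ {t == s} (chain-end c)

  chain-walk : ∀ {P : Fin N → Set} {s ℓ t} → Chain G s ℓ t → (∀ {z} → z ∈ mem ℓ → P z) → Walk G P s t
  chain-walk [ s ]         f = stop (f (∨-introˡ (==⁺ s)))
  chain-walk (_∷_ {s} e c) f = step (f (∨-introˡ (==⁺ s))) e (chain-walk c (λ {z} h → f (∨-introʳ {z == s} h)))

  walk-chain : ∀ {P : Fin N → Set} {s t} → Walk G P s t → ∃ λ ℓ → Chain G s ℓ t × (∀ {z} → z ∈ mem ℓ → P z)
  walk-chain {P} (stop {s} p) = s ∷ [] , [ s ] , λ {z} h → subst P (==⁻ˢ (single h)) p
    where
    single : ∀ {b} → b ∨ false ≡ true → b ≡ true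
    single {true} _ = refl
  walk-chain {P} (step {s} p e w) with walk-chain w
  ... | ℓ , c , f = s ∷ ℓ , e ∷ c , λ {z} h → inside z (∨⁻ {z == s} h)
    where
    inside : ∀ z → (z == s ≡ true) ⊎ z ∈ mem ℓ → P z
    inside z (inj₁ q) = subst P (==⁻ˢ q) p
    inside z (inj₂ q) = f q

  chain-++ : ∀ {s ℓ x y ℓ′ t} → Chain G s ℓ x → E G x y ≡ true → Chain G y ℓ′ t → Chain G s (ℓ ++ ℓ′) t
  chain-++ [ s ]   e c′ = e ∷ c′
  chain-++ (f ∷ c) e c′ = f ∷ chain-++ c e c′

  chain-from : ∀ {x ℓ t u} → Chain G x ℓ t → u ∈ mem ℓ → Distinct ℓ →
               ∃ λ ℓ′ → Chain G u ℓ′ t × Distinct ℓ′ × length ℓ′ ≤ length ℓ × mem ℓ′ ⊆ mem ℓ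
  chain-from {x} {ℓ} {u = u} c h d with bool (u == x)
  chain-from {x} {ℓ} {u = u} c h d | inj₁ q = ℓ , subst (λ y → Chain G y ℓ _) (==⁻ˢ q) c , d , ≤-refl , (λ p → p)
  chain-from {x} {u = u} [ x ] h d | inj₂ q = absurd h (cong (_∨ false) q)
  chain-from {x} {x ∷ ℓ} {u = u} (e ∷ c) h d | inj₂ q
    with chain-from c (subst (λ b → b ∨ mem ℓ u ≡ true) q h) (distinct-tail {ℓ = ℓ} d)
  ... | ℓ′ , c′ , d′ , le , s = ℓ′ , c′ , d′ , m≤n⇒m≤1+n le , λ {z} p → ∨-introʳ {z == x} (s p)

  erase : ∀ {s ℓ t} → Chain G s ℓ t → ∃ λ ℓ′ → Chain G s ℓ′ t × Distinct ℓ′ × length ℓ′ ≤ length ℓ × mem ℓ′ ⊆ mem ℓ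
  erase [ s ] = s ∷ [] , [ s ] , (λ z → ≤-respˡ (sym (+-identityʳ _)) (𝟙≤1 (z == s))) , ≤-refl , (λ p → p)
  erase (_∷_ {s} {x} {ℓ} e c) with erase c
  ... | ℓ′ , c′ , d′ , le , sub with bool (mem ℓ′ s)
  ...   | inj₂ h = s ∷ ℓ′ , e ∷ c′ , distinct-∷ {ℓ = ℓ′} h d′ , s≤s le ,
                   λ {z} → taut 3 (λ p q r → (q ⇛ r) ⇒ p ∨ q ⇒ ! (p ∨ r)) refl (z == s) (mem ℓ′ z) (mem ℓ z) (⇛⁺ sub)
  ...   | inj₁ h with chain-from c′ h d′
  ...     | ℓ″ , c″ , d″ , le′ , sub′ = ℓ″ , c″ , d″ , m≤n⇒m≤1+n (≤-trans le′ le) , λ {z} p →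
      ∨-introʳ {z == s} (sub (sub′ p))

  -- The chain is entered at the last neighbour of z, which skips all its other neighbours.
  to-last : ∀ z {x ℓ t} → Chain G x ℓ t → 1 ≤ count (E G z) ℓ →
            ∃ λ ℓ′ → Chain G z (z ∷ ℓ′) t × length ℓ′ + count (E G z) ℓ ≤ length ℓ + 1 × mem ℓ′ ⊆ mem ℓ
  to-last z [ s ] h with bool (E G z s)
  ... | inj₁ e = s ∷ [] , e ∷ [ s ] , s≤s (≤-respˡ (sym (+-identityʳ _)) (𝟙≤1 (E G z s))) , (λ p → p)
  ... | inj₂ e = ⊥-elim (<⇒≱ h (≤-reflexive (cong (λ b → 𝟙 b + 0) e)))
  to-last z (_∷_ {s} {x} {ℓ} e c) h with <-≤-connex 0 (count (E G z) ℓ)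
  ... | inj₁ k with to-last z c k
  ...   | ℓ′ , c′ , le , sub = ℓ′ , c′ , linear 4 (λ b n a m → 1 · a ⊕ n ≼ m ⊕ con 1 ⇒ 1 · b ≼ con 1 ⇒
      ⊢ a ⊕ (b ⊕ n) ≼ (con 1 ⊕ m) ⊕ con 1) refl
            (𝟙 (E G z s)) (count (E G z) ℓ) (length ℓ′) (length ℓ) le (𝟙≤1 _) , λ {y} p → ∨-introʳ {y == s} (sub p)
  to-last z (_∷_ {s} {x} {ℓ} e c) h | inj₂ k with bool (E G z s)
  ... | inj₁ f = s ∷ ℓ , f ∷ (e ∷ c) , +-monoʳ-≤ (suc (length ℓ)) (+-mono-≤ (𝟙≤1 (E G z s)) k) , (λ p → p)
  ... | inj₂ f = ⊥-elim (<⇒≱ h (≤-respˡ (sym (cong (λ b → 𝟙 b + count (E G z) ℓ) f)) k))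

  -- The chain is left at the first neighbour of z and entered again at the last. Of at least four
  -- neighbours two or more are skipped, while only z is added.
  shortcut : ∀ z {s ℓ t} → Chain G s ℓ t → 4 ≤ count (E G z) ℓ →
             ∃ λ ℓ′ → Chain G s ℓ′ t × length ℓ′ < length ℓ × mem ℓ′ ⊆ ⁅ z ⁆ ∪ mem ℓ
  shortcut z [ s ] h = ⊥-elim (<⇒≱ (<-≤-trans (s≤s (s≤s z≤n)) h) (≤-respˡ (sym (+-identityʳ _)) (𝟙≤1 (E G z s))))
  shortcut z (_∷_ {s} {x} {ℓ} e c) h with bool (E G z s)
  ... | inj₁ f with to-last z c (≤-trans (s≤s z≤n) (≤-pred (subst (λ b → 4 ≤ 𝟙 b + count (E G z) ℓ) f h)))
  ...   | ℓ′ , c′ , le , sub = s ∷ z ∷ ℓ′ , E-sym G f ∷ c′ ,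
            linear 4 (λ b n a m → 1 · con 4 ≼ b ⊕ n ⇒ 1 · b ≼ con 1 ⇒ 1 · a ⊕ n ≼ m ⊕ con 1 ⇒
                ⊢ con 1 ⊕ (con 2 ⊕ a) ≼ con 1 ⊕ m) refl
              (𝟙 (E G z s)) (count (E G z) ℓ) (length ℓ′) (length ℓ) h (𝟙≤1 _) le ,
            λ {y} → taut 4 (λ p q r t → (r ⇛ t) ⇒ p ∨ (q ∨ r) ⇒ ! (q ∨ (p ∨ t))) refl (y == s) (y == z) (mem ℓ′ y)
                (mem ℓ y) (⇛⁺ sub)
  shortcut z (_∷_ {s} {x} {ℓ} e c) h | inj₂ f with shortcut z c (subst (λ b → 4 ≤ 𝟙 b + count (E G z) ℓ) f h)
  ... | ℓ′ , c′ , le , sub = s ∷ ℓ′ , e ∷ c′ , s≤s le ,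
          λ {y} → taut 4 (λ p q r t → (r ⇛ q ∨ t) ⇒ p ∨ r ⇒ ! (q ∨ (p ∨ t))) refl (y == s) (y == z) (mem ℓ′ y)
              (mem ℓ y)
            (⇛⁺ {mem ℓ′ y} (sub {y}))

  component : ∀ {F : VSet N} {a} → a ∈ F → ∃ λ A → A ⊆ F × a ∈ A ×
              (∀ {x y} → x ∈ A → y ∈ F → E G x y ≡ true → y ∈ A) × (∀ {x} → x ∈ A → Walk G (_∈ F) a x)
  component {F} {a} a∈F = grow (# (F ∖ ⁅ a ⁆)) ⁅ a ⁆ ≤-refl (λ h → subst (_∈ F) (==⁻ˢ h) a∈F) (==⁺ a)
      (λ h → subst (Walk G (_∈ F) a) (==⁻ˢ h) (stop a∈F))
    where
    grow : ∀ n A → # (F ∖ A) ≤ n → A ⊆ F → a ∈ A → (∀ {x} → x ∈ A → Walk G (_∈ F) a x) →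
           ∃ λ A → A ⊆ F × a ∈ A × (∀ {x y} → x ∈ A → y ∈ F → E G x y ≡ true → y ∈ A) ×
               (∀ {x} → x ∈ A → Walk G (_∈ F) a x)
    grow n A size A⊆F a∈A reach with find (λ y → F y ∧ not (A y) ∧ anyᵇ (λ x → A x ∧ E G x y))
    grow n A size A⊆F a∈A reach | inj₂ none = A , A⊆F , a∈A ,
      (λ {x} {y} x∈A y∈F e → taut 3 (λ f b c → not (f ∧ not b ∧ c) ⇒ f ⇒ c ⇒ ! b) refl (F y) (A y)
          (anyᵇ (λ x → A x ∧ E G x y))
        (not⁺ (none y)) y∈F (anyᵇ⁺ {P = λ x → A x ∧ E G x y} (∧⁺ x∈A e))) , reach
    grow zero A size A⊆F a∈A reach | inj₁ (y , h) =
      ⊥-elim (<⇒≱ (#-pos {P = F ∖ A} {y} (taut 3 (λ f b c → f ∧ not b ∧ c ⇒ ! (f ∧ not b)) refl (F y)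
          (A y) _ h)) size)
    grow (suc n) A size A⊆F a∈A reach | inj₁ (y , h) with anyᵇ⁻ (∧-right {not (A y)} (∧-right {F y} h))
    ... | x , p = grow n (A ∪ ⁅ y ⁆)
      (≤-pred (≤-trans (#-strict {P = F ∖ (A ∪ ⁅ y ⁆)} {Q = F ∖ A} {y}
        (λ {z} → taut 3 (λ f b c → f ∧ not (b ∨ c) ⇒ ! (f ∧ not b)) refl (F z) (A z) (z == y))
        (taut 3 (λ f b c → f ∧ not b ∧ c ⇒ ! (f ∧ not b)) refl (F y) (A y) _ h)
        (not⁻ (taut 3 (λ f b c → c ⇒ ! not (f ∧ not (b ∨ c))) refl (F y) (A y) (y == y) (==⁺ y)))) size))
      (λ {z} q → into z (∨⁻ {A z} q)) (∨-introˡ a∈A) (λ {z} q → onto z (∨⁻ {A z} q))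
      where
      y∈F : y ∈ F
      y∈F = ∧-left h
      into : ∀ z → z ∈ A ⊎ z ∈ ⁅ y ⁆ → z ∈ F
      into z (inj₁ q) = A⊆F q
      into z (inj₂ q) = subst (_∈ F) (==⁻ˢ q) y∈F
      onto : ∀ z → z ∈ A ⊎ z ∈ ⁅ y ⁆ → Walk G (_∈ F) a z
      onto z (inj₁ q) = reach q
      onto z (inj₂ q) = subst (Walk G (_∈ F) a) (==⁻ˢ q)
        (reach (∧-left p) ⊙ step (A⊆F (∧-left p)) (∧-right {A x} p) (stop y∈F))

-- Cliques

Clique : Graph N → VSet N → Set
Clique G K = ∀ {x y} → x ∈ K → y ∈ K → x ≢ y → E G x y ≡ true

BigClique : Graph N → VSet N → Set
BigClique G V = ∃ λ K → K ⊆ V × 8 ≤ # K × Clique G K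

clique-insert : ∀ {G : Graph N} {K x} → Clique G K → (∀ {y} → y ∈ K → E G x y ≡ true) → Clique G (K ∪ ⁅ x ⁆)
clique-insert {G = G} {K} {x} q adj {a} {b} p p′ n with ∨⁻ {K a} p | ∨⁻ {K b} p′
... | inj₁ h | inj₁ h′ = q h h′ n
... | inj₁ h | inj₂ h′ = E-sym G (subst (λ z → E G z a ≡ true) (==⁻ˢ h′) (adj h))
... | inj₂ h | inj₁ h′ = subst (λ z → E G z b ≡ true) (==⁻ˢ h) (adj h′)
... | inj₂ h | inj₂ h′ = ⊥-elim (n (trans (==⁻ h) (==⁻ˢ h′)))

#-insert : ∀ {P : VSet N} {x} → P x ≡ false → suc (# P) ≤ # (P ∪ ⁅ x ⁆)
#-insert {P = P} {x} h = #-strict {P = P} {Q = P ∪ ⁅ x ⁆} ∨-introˡ (∨-introʳ {P x} (==⁺ x)) h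

insert-⊆ : ∀ {P V : VSet N} {x} → P ⊆ V → x ∈ V → P ∪ ⁅ x ⁆ ⊆ V
insert-⊆ {P = P} {V} s h {z} p with ∨⁻ {P z} p
... | inj₁ q = s q
... | inj₂ q = subst (_∈ V) (==⁻ˢ q) h

insert-∉ : ∀ {P : VSet N} {x y} → P y ≡ false → y ≢ x → (P ∪ ⁅ x ⁆) y ≡ false
insert-∉ h n = cong₂ _∨_ h (≢⇒≠ n)

#≤1⇒≡ : ∀ {P : VSet N} {x y} → # P ≤ 1 → x ∈ P → y ∈ P → x ≡ y
#≤1⇒≡ {P = P} {x} {y} h p q with x Fin.≟ y
... | yes e = e
... | no n = ⊥-elim (<⇒≱ (s≤s (#-pos {P = P ∖ ⁅ x ⁆} {y} (∈-∖⁅⁆ {P = P} q (λ e → n (sym e)))))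
                (≤-respˡ (#-delete-∈ {P = P} {x} p) h))

opaque
  unfolding sum #

  #≤-4 : ∀ {a b c d e : VSet N} → (∀ i → 𝟙 (a i) + 𝟙 (b i) + (𝟙 (c i) + 𝟙 (d i)) ≤ 𝟙 (e i)) →
         # a + # b + (# c + # d) ≤ # e
  #≤-4 {a = a} {b} {c} {d} h = ≤-respˡ (sym (cong₂ _+_ (sym (sum-+ (λ i → 𝟙 (a i)) (λ i → 𝟙 (b i))))
      (sym (sum-+ (λ i → 𝟙 (c i)) (λ i → 𝟙 (d i))))))
    (≤-respˡ (sum-+ (λ i → 𝟙 (a i) + 𝟙 (b i)) (λ i → 𝟙 (c i) + 𝟙 (d i))) (sum-mono h))

nonneighbours : Graph N → VSet N → Fin N → VSet N
nonneighbours G F z w = F w ∧ not (w == z) ∧ not (E G z w)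

-- The complement of G on F is a matching. P picks one end of each of its edges and
-- all of U, the vertices it misses; P and v form a clique, to which ends of the edges
-- j₁j₂ and j₃j₄ can be added, since only vertices of U miss any of them.
near-clique : ∀ {G : Graph N} {F V v j₁ j₂ j₃ j₄} → F ⊆ V → v ∈ V → F v ≡ false →
              (∀ {z} → z ∈ F → E G v z ≡ true) →
              (∀ {j} → j ∈ mem (j₁ ∷ j₂ ∷ j₃ ∷ j₄ ∷ []) → j ∈ V × F j ≡ false × E G v j ≡ true) →
              E G j₁ j₂ ≡ true → E G j₃ j₄ ≡ true →
              (∀ {z} → z ∈ F → # (nonneighbours G F z) +
                (𝟙 (not (E G z j₁)) + 𝟙 (not (E G z j₂)) + (𝟙 (not (E G z j₃)) + 𝟙 (not (E G z j₄)))) ≤ 1) →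
              9 ≤ # F → BigClique G V
near-clique {N} {G} {F} {V} {v} {j₁} {j₂} {j₃} {j₄} F⊆V v∈V v∉F v~F js e₁₂ e₃₄ defect 9≤F = main
  where
  non : Fin N → VSet N
  non = nonneighbours G F
  less : Fin N → Fin N → Bool
  less z w = does (toℕ z ℕ.<? toℕ w)
  P U : VSet N
  -- Of two nonadjacent vertices of F the one with the smaller number is picked.
  P z = F z ∧ allᵇ (λ w → non z w ⇛ less z w)
  U z = F z ∧ not (anyᵇ (non z))
  non-sym : ∀ {z w} → z ∈ F → w ∈ non z → z ∈ non w
  non-sym {z} {w} z∈F h = ∧⁺ z∈F (∧⁺ (not⁺ (≢⇒≠ (λ { refl → true≢false (==⁺ z) (not⁻ (∧-left (∧-right {F w} h))) })))
    (not⁺ (¬true⇒false (λ e → true≢false (E-sym G e) (not⁻ (∧-right {not (w == z)} (∧-right {F w} h)))))))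
  non-unique : ∀ {z x y} → z ∈ F → x ∈ non z → y ∈ non z → x ≡ y
  non-unique {z} z∈F = #≤1⇒≡ {P = non z} (≤-trans (m≤m+n _ _) (defect z∈F))
  pick : ∀ {z} → z ∈ F → P z ≡ false → ∃ λ w → w ∈ P ∖ U × w ∈ non z
  pick {z} z∈F z∉P with find (λ w → not (non z w ⇛ less z w))
  ... | inj₂ none = absurd (∧⁺ z∈F (allᵇ⁺ (λ w → flip (none w)))) z∉P
    where
    flip : ∀ {b} → not b ≡ false → b ≡ true
    flip {true} _ = refl
  ... | inj₁ (w , h) = w , ∧⁺ (∧⁺ w∈F (allᵇ⁺ (λ x → ⇛⁺ (λ x∈ → does⁺ (toℕ w ℕ.<? toℕ x)
          (subst (λ y → toℕ w < toℕ y) (non-unique w∈F (non-sym z∈F w∈non) x∈) w<z)))))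
        (not⁺ (cong₂ _∧_ w∈F (cong not (anyᵇ⁺ {P = non w} (non-sym z∈F w∈non))))) , w∈non
    where
    w∈non : w ∈ non z
    w∈non = taut 2 (λ a b → not (a ⇛ b) ⇒ ! a) refl (non z w) (less z w) h
    w∈F : w ∈ F
    w∈F = ∧-left w∈non
    w<z : toℕ w < toℕ z
    w<z with <-cmp (toℕ w) (toℕ z)
    ... | tri< p _ _ = p
    ... | tri≈ _ p _ with Fin.toℕ-injective p
    ...   | refl = absurd (==⁺ w) (not⁻ (∧-left (∧-right {F w} w∈non)))
    w<z | tri> _ _ p = absurd (does⁺ (toℕ z ℕ.<? toℕ w) p)
      (not⁻ (taut 2 (λ a b → not (a ⇛ b) ⇒ ! not b) refl (non z w) (less z w) h))
  matched : # (F ∖ P) ≤ # (P ∖ U)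
  matched = #-inject non (λ {z} h → let w , a , b = pick {z} (∧-left h) (not⁻ (∧-right {F z} h)) in w , a , b)
    (λ {x} {x′} {y} p p′ a a′ → non-unique (∧-left a) (non-sym (∧-left p) a) (non-sym (∧-left p′) a′))
  -- Vertices of U count twice on the left because they are picked without having a partner.
  halves : # F + # U ≤ # P + # P
  halves = linear 5 (λ f u p q r → 1 · f ≼ p ⊕ q ⇒ 1 · q ≼ r ⇒ 1 · r ⊕ u ≼ p ⇒ ⊢ f ⊕ u ≼ p ⊕ p) refl
    (# F) (# U) (# P) (# (F ∖ P)) (# (P ∖ U)) (#-∖ F P) matched
    (#+≤ {P = P ∖ U} {U} {P} (λ z → taut 2 (λ p u → (u ⇛ p) ⇒ 𝟙 (p ∧ not u) + 𝟙 u ≼ 𝟙 p) refl (P z) (U z) (U⊆P z)))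
    where
    U⊆P : ∀ z → U z ⇛ P z ≡ true
    U⊆P z = ⇛⁺ {U z} (λ h → ∧⁺ {F z} (∧-left h) (allᵇ⁺ (λ w → ⇛⁺ {non z w} (λ q →
      absurd (anyᵇ⁺ {P = non z} {w} q) (not⁻ (∧-right {F z} h))))))
  misses : Fin N → VSet N
  misses j z = P z ∧ not (E G z j)
  few-misses : # (misses j₁) + # (misses j₂) + (# (misses j₃) + # (misses j₄)) ≤ # U
  few-misses = #≤-4 (λ z → pointwise z (bool (P z)) (bool (anyᵇ (non z))))
    where
    pointwise : ∀ z → (P z ≡ true) ⊎ (P z ≡ false) → (anyᵇ (non z) ≡ true) ⊎ (anyᵇ (non z) ≡ false) →
      𝟙 (misses j₁ z) + 𝟙 (misses j₂ z) + (𝟙 (misses j₃ z) + 𝟙 (misses j₄ z)) ≤ 𝟙 (U z)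
    pointwise z (inj₂ h) _ = taut 6 (λ p a b c d u → not p ⇒
        𝟙 (p ∧ a) + 𝟙 (p ∧ b) + (𝟙 (p ∧ c) + 𝟙 (p ∧ d)) ≼ 𝟙 u) refl
      (P z) _ _ _ _ (U z) (not⁺ h)
    pointwise z (inj₁ h) (inj₁ k) = ≤-trans (drop (P z)) (≤-trans (≤-pred (≤-trans
        (+-monoˡ-≤ _ (let w , q = anyᵇ⁻ k in #-pos {P = non z} {w} q)) (defect (∧-left h)))) z≤n)
      where
      drop : ∀ p → 𝟙 (p ∧ not (E G z j₁)) + 𝟙 (p ∧ not (E G z j₂)) + (𝟙 (p ∧ not (E G z j₃)) + 𝟙 (p ∧ not (E G z j₄))) ≤
             𝟙 (not (E G z j₁)) + 𝟙 (not (E G z j₂)) + (𝟙 (not (E G z j₃)) + 𝟙 (not (E G z j₄)))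
      drop p = taut 5 (λ p a b c d → 𝟙 (p ∧ a) + 𝟙 (p ∧ b) + (𝟙 (p ∧ c) + 𝟙 (p ∧ d)) ≼ 𝟙 a + 𝟙 b + (𝟙 c + 𝟙 d)) refl p _ _ _ _
    pointwise z (inj₁ h) (inj₂ k) = ≤-respʳ (sym (cong 𝟙 (∧⁺ (∧-left h) (not⁺ k))))
        (≤-trans (taut 5 (λ p a b c d → 𝟙 (p ∧ a) + 𝟙 (p ∧ b) + (𝟙 (p ∧ c) + 𝟙 (p ∧ d)) ≼ 𝟙 a + 𝟙 b + (𝟙 c + 𝟙 d)) refl (P z) _ _ _ _)
      (≤-trans (m≤n+m _ (# (non z))) (defect (∧-left h))))
  P⊆F : P ⊆ F
  P⊆F = ∧-left
  P-clique : Clique G P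
  P-clique {x} {y} p q n with bool (E G x y)
  ... | inj₁ e = e
  ... | inj₂ e = ⊥-elim (<-asym (before p q n e) (before q p (λ r → n (sym r))
                   (¬true⇒false (λ f → true≢false (E-sym G f) e))))
    where
    before : ∀ {x y} → x ∈ P → y ∈ P → x ≢ y → E G x y ≡ false → toℕ x < toℕ y
    before {x} {y} p q n e = does⁻ (toℕ x ℕ.<? toℕ y) (⇛⁻ (allᵇ⁻ (∧-right {F x} p) y)
      (∧⁺ (P⊆F q) (∧⁺ (not⁺ (≢⇒≠ (λ r → n (sym r)))) (not⁺ e))))
  K : VSet N
  K = P ∪ ⁅ v ⁆
  K⊆V : K ⊆ V
  K⊆V = insert-⊆ {P = P} {V = V} (λ p → F⊆V (P⊆F p)) v∈V
  K-clique : Clique G K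
  K-clique = clique-insert {G = G} {K = P} P-clique (λ p → v~F (P⊆F p))
  P∌ : ∀ {x} → F x ≡ false → P x ≡ false
  P∌ h = ¬true⇒false (λ p → true≢false (P⊆F p) h)
  #K : suc (# P) ≤ # K
  #K = #-insert (P∌ v∉F)
  J : List (Fin N)
  J = j₁ ∷ j₂ ∷ j₃ ∷ j₄ ∷ []
  K∌ : ∀ {j} → j ∈ mem J → K j ≡ false
  K∌ h = insert-∉ {P = P} (P∌ (proj₁ (proj₂ (js h)))) (λ e → E-distinct G (proj₂ (proj₂ (js h))) (sym e))
  no-miss : ∀ {j} → # (misses j) ≤ 0 → ∀ {z} → z ∈ P → E G z j ≡ true
  no-miss {j} h {z} p = taut 2 (λ p e → not (p ∧ not e) ⇒ p ⇒ ! e) refl (P z) (E G z j)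
    (not⁺ (¬true⇒false (λ q → <⇒≱ (#-pos {P = misses j} q) h))) p
  adj : ∀ {j} → j ∈ mem J → # (misses j) ≤ 0 → ∀ {y} → y ∈ K → E G j y ≡ true
  adj {j} m h = insert-⊆ {P = P} {V = E G j} (λ p → E-sym G (no-miss h p)) (E-sym G (proj₂ (proj₂ (js m))))
  add-one : ∀ {j} → j ∈ mem J → # (misses j) ≤ 0 → 6 ≤ # P → BigClique G V
  add-one {j} m h 6≤P = K ∪ ⁅ j ⁆ , insert-⊆ {P = K} {V = V} K⊆V (proj₁ (js m)) ,
    ≤-trans (s≤s (≤-trans (s≤s 6≤P) #K)) (#-insert (K∌ m)) , clique-insert {G = G} {K = K} K-clique (adj m h)
  add-two : ∀ {i j} → i ∈ mem J → j ∈ mem J → E G i j ≡ true → # (misses i) ≤ 0 → # (misses j) ≤ 0 → 5 ≤ # P →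
      BigClique G V
  add-two {i} {j} m m′ e h h′ 5≤P = (K ∪ ⁅ i ⁆) ∪ ⁅ j ⁆ ,
    insert-⊆ {P = K ∪ ⁅ i ⁆} {V = V} (insert-⊆ {P = K} {V = V} K⊆V (proj₁ (js m))) (proj₁ (js m′)) ,
    ≤-trans (s≤s (≤-trans (s≤s (≤-trans (s≤s 5≤P) #K)) (#-insert (K∌ m))))
      (#-insert (insert-∉ {P = K} (K∌ m′) (λ r → E-distinct G e (sym r)))) ,
    clique-insert {G = G} {K = K ∪ ⁅ i ⁆} (clique-insert {G = G} {K = K} K-clique (adj m h))
      (insert-⊆ {P = K} {V = E G j} (adj m′ h′) (E-sym G e))
  m₁ m₂ m₃ m₄ : _
  m₁ = # (misses j₁)
  m₂ = # (misses j₂)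
  m₃ = # (misses j₃)
  m₄ = # (misses j₄)
  J₁ : j₁ ∈ mem J
  J₁ = ∨-introˡ (==⁺ j₁)
  J₂ : j₂ ∈ mem J
  J₂ = ∨-introʳ {j₂ == j₁} (∨-introˡ (==⁺ j₂))
  J₃ : j₃ ∈ mem J
  J₃ = ∨-introʳ {j₃ == j₁} (∨-introʳ {j₃ == j₂} (∨-introˡ (==⁺ j₃)))
  J₄ : j₄ ∈ mem J
  J₄ = ∨-introʳ {j₄ == j₁} (∨-introʳ {j₄ == j₂} (∨-introʳ {j₄ == j₃} (∨-introˡ (==⁺ j₄))))
  main : BigClique G V
  main with <-≤-connex 6 (# P)
  ... | inj₁ big = K , K⊆V , ≤-trans (s≤s big) #K , K-clique
  ... | inj₂ small with <-≤-connex 5 (# P)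
  -- If P has six vertices, `halves` leaves at most three in U, too few for all four ends to be
  -- missed by some vertex.
  ...   | inj₁ 6≤P with <-≤-connex 0 m₁ | <-≤-connex 0 m₂ | <-≤-connex 0 m₃ | <-≤-connex 0 m₄
  ...     | inj₂ h | _ | _ | _ = add-one J₁ h 6≤P
  ...     | inj₁ _ | inj₂ h | _ | _ = add-one J₂ h 6≤P
  ...     | inj₁ _ | inj₁ _ | inj₂ h | _ = add-one J₃ h 6≤P
  ...     | inj₁ _ | inj₁ _ | inj₁ _ | inj₂ h = add-one J₄ h 6≤P
  ...     | inj₁ a | inj₁ b | inj₁ c | inj₁ d = ⊥-elim (<-irrefl refl (linear 7 (λ f u p a b c d →
              1 · con 9 ≼ f ⇒ 1 · f ⊕ u ≼ p ⊕ p ⇒ 2 · p ≼ con 6 ⇒ 1 · (a ⊕ b) ⊕ (c ⊕ d) ≼ u ⇒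
              1 · con 1 ≼ a ⇒ 1 · con 1 ≼ b ⇒ 1 · con 1 ≼ c ⇒ 1 · con 1 ≼ d ⇒ ⊢ con 1 ≼ con 0) refl
              (# F) (# U) (# P) m₁ m₂ m₃ m₄ 9≤F halves small few-misses a b c d))
  -- If P has five vertices, U has at most one, so one of the two edges has both ends adjacent to
  -- all of P.
  main | inj₂ small | inj₂ 5≥P = case (<-≤-connex 0 m₁) (<-≤-connex 0 m₂)
    where
    5≤P : 5 ≤ # P
    5≤P = ≮⇒≥ (λ h → <-irrefl refl (linear 3 (λ f u p → 1 · con 9 ≼ f ⇒ 1 · f ⊕ u ≼ p ⊕ p ⇒ 2 · con 1 ⊕ p ≼ con 5 ⇒
        ⊢ con 1 ≼ con 0) refl
      (# F) (# U) (# P) 9≤F halves h))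
    total : m₁ + m₂ + (m₃ + m₄) ≤ 1
    total = linear 7 (λ f u p a b c d → 1 · con 9 ≼ f ⇒ 1 · f ⊕ u ≼ p ⊕ p ⇒ 2 · p ≼ con 5 ⇒
        1 · (a ⊕ b) ⊕ (c ⊕ d) ≼ u ⇒
      ⊢ (a ⊕ b) ⊕ (c ⊕ d) ≼ con 1) refl (# F) (# U) (# P) m₁ m₂ m₃ m₄ 9≤F halves 5≥P few-misses
    one : ∀ (x y z : ℕ) → 1 ≤ x → x + y + z ≤ 1 → z ≤ 0
    one = linear 3 (λ x y z → 1 · con 1 ≼ x ⇒ 1 · (x ⊕ y) ⊕ z ≼ con 1 ⇒ ⊢ z ≼ con 0) refl
    case : 0 < m₁ ⊎ m₁ ≤ 0 → 0 < m₂ ⊎ m₂ ≤ 0 → BigClique G V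
    case (inj₂ h) (inj₂ h′) = add-two J₁ J₂ e₁₂ h h′ 5≤P
    case (inj₁ h) _ = let k = one m₁ m₂ (m₃ + m₄) h total in
      add-two J₃ J₄ e₃₄ (≤-trans (m≤m+n m₃ m₄) k) (≤-trans (m≤n+m m₄ m₃) k) 5≤P
    case (inj₂ _) (inj₁ h) = let k = linear 3 (λ x y z → 1 · con 1 ≼ y ⇒ 1 · (x ⊕ y) ⊕ z ≼ con 1 ⇒ ⊢ z ≼ con 0) refl m₁ m₂ (m₃ + m₄) h total in
      add-two J₃ J₄ e₃₄ (≤-trans (m≤m+n m₃ m₄) k) (≤-trans (m≤n+m m₄ m₃) k) 5≤P

-- Short paths in dense graphs

ball : Graph N → VSet N → Fin N → VSet N
ball G F z = (F ∩ E G z) ∪ ⁅ z ⁆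

-- The second alternative records that the balls were disjoint, so that F has at least 2m vertices;
-- for the first path this is impossible.
Joined : Graph N → VSet N → ℕ → Fin N → Fin N → Set
Joined G F m a b = ∃ λ ℓ → Chain G a ℓ b × mem ℓ ⊆ F × (length ℓ ≤ 3 ⊎ (length ℓ ≤ 4 × m + m ≤ # F))

-- If the balls around a and b are disjoint, they fill F, and either an edge joins them
-- or the ball around a is a clique.
dense-join : ∀ {G : Graph N} {F a b} m → a ∈ F → b ∈ F → 8 ≤ m → (∀ {z} → z ∈ F → m ≤ suc (# (F ∩ E G z))) →
             # F ≤ m + m → BigClique G F ⊎ Joined G F m a b
dense-join {N} {G} {F} {a} {b} m a∈F b∈F 8≤m degree F≤2m = decide (find (B a ∩ B b))
    (find (λ x → B a x ∧ anyᵇ (λ y → B b y ∧ E G x y)))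
  where
  B : Fin N → VSet N
  B = ball G F
  B⊆F : ∀ {z} → z ∈ F → B z ⊆ F
  B⊆F {z} h = insert-⊆ {P = F ∩ E G z} {V = F} ∧-left h
  B-size : ∀ {z} → z ∈ F → m ≤ # (B z)
  B-size {z} h = ≤-trans (degree h) (#-insert {P = F ∩ E G z}
      (trans (cong (F z ∧_) (E-irr G z)) (Bool.∧-zeroʳ (F z))))
  B⁻ : ∀ {z x} → x ∈ B z → (x ∈ F × E G z x ≡ true) ⊎ x ≡ z
  B⁻ {z} {x} h with ∨⁻ {F x ∧ E G z x} h
  ... | inj₁ p = inj₁ (∧-left p , ∧-right {F x} p)
  ... | inj₂ p = inj₂ (==⁻ p)
  one-⊆ : ∀ x → x ∈ F → mem (x ∷ []) ⊆ F
  one-⊆ x h {z} p with ∨⁻ {z == x} p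
  ... | inj₁ q = subst (_∈ F) (==⁻ˢ q) h
  two-⊆ : ∀ x y → x ∈ F → y ∈ F → mem (x ∷ y ∷ []) ⊆ F
  two-⊆ x y h k {z} p with ∨⁻ {z == x} p
  ... | inj₁ q = subst (_∈ F) (==⁻ˢ q) h
  ... | inj₂ q = one-⊆ y k q
  to : ∀ {z x} → z ∈ F → x ∈ B z → ∃ λ ℓ → Chain G z ℓ x × mem ℓ ⊆ F × length ℓ ≤ 2
  to {z} {x} h p with B⁻ {z} p
  ... | inj₂ refl      = z ∷ [] , [ z ] , one-⊆ z h , s≤s z≤n
  ... | inj₁ (q , e)   = z ∷ x ∷ [] , e ∷ [ x ] , two-⊆ z x h q , ≤-refl
  from : ∀ {z x} → z ∈ F → x ∈ B z → ∃ λ ℓ → Chain G x ℓ z × mem ℓ ⊆ F × length ℓ ≤ 2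
  from {z} {x} h p with B⁻ {z} p
  ... | inj₂ refl      = z ∷ [] , [ z ] , one-⊆ z h , s≤s z≤n
  ... | inj₁ (q , e)   = x ∷ z ∷ [] , E-sym G e ∷ [ z ] , two-⊆ x z q h , ≤-refl
  ++-⊆ : ∀ ℓ ℓ′ → mem ℓ ⊆ F → mem ℓ′ ⊆ F → mem (ℓ ++ ℓ′) ⊆ F
  ++-⊆ ℓ ℓ′ s s′ h with mem-++⁻ ℓ ℓ′ h
  ... | inj₁ p = s p
  ... | inj₂ p = s′ p
  decide : ∃ (_∈ B a ∩ B b) ⊎ (∀ x → (B a ∩ B b) x ≡ false) →
           ∃ (_∈ λ x → B a x ∧ anyᵇ (λ y → B b y ∧ E G x y)) ⊎ (∀ x → B a x ∧ anyᵇ (λ y → B b y ∧ E G x y) ≡ false) →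
           BigClique G F ⊎ Joined G F m a b
  decide (inj₁ (c , h)) _ with to a∈F (∧-left h) | B⁻ {b} (∧-right {B a c} h)
  ... | ℓ , ch , s , le | inj₂ refl    = inj₂ (ℓ , ch , s , inj₁ (m≤n⇒m≤1+n le))
  ... | ℓ , ch , s , le | inj₁ (_ , e) = inj₂ (ℓ ++ b ∷ [] , chain-++ ch (E-sym G e) [ b ] ,
      ++-⊆ ℓ (b ∷ []) s (one-⊆ b b∈F) ,
      inj₁ (≤-respˡ (sym (List.length-++ ℓ)) (+-monoˡ-≤ 1 le)))
  decide (inj₂ apart) edge = rest edge
    where
    disjoint : # (B a) + # (B b) ≤ # (B a ∪ B b)
    disjoint = #+≤ {P = B a} {B b} {B a ∪ B b} (λ x →
      taut 2 (λ p q → not (p ∧ q) ⇒ 𝟙 p + 𝟙 q ≼ 𝟙 (p ∨ q)) refl (B a x) (B b x) (not⁺ (apart x)))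
    union⊆F : B a ∪ B b ⊆ F
    union⊆F {x} h with ∨⁻ {B a x} h
    ... | inj₁ p = B⊆F a∈F p
    ... | inj₂ p = B⊆F b∈F p
    both : m + m ≤ # (B a ∪ B b)
    both = ≤-trans (+-mono-≤ (B-size a∈F) (B-size b∈F)) disjoint
    F⊆union : ∀ {x} → x ∈ F → x ∈ B a ∪ B b
    F⊆union {x} h with bool ((B a ∪ B b) x)
    ... | inj₁ p = p
    ... | inj₂ p = ⊥-elim (<⇒≱ (#-strict {P = B a ∪ B b} {Q = F} union⊆F h p) (≤-trans F≤2m both))
    rest : _ → BigClique G F ⊎ Joined G F m a b
    rest (inj₁ (x , h)) with anyᵇ⁻ (∧-right {B a x} h)
    ... | y , k with to a∈F (∧-left h) | from b∈F (∧-left k)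
    ...   | ℓ , ch , s , le | ℓ′ , ch′ , s′ , le′ =
        inj₂ (ℓ ++ ℓ′ , chain-++ ch (∧-right {B b y} k) ch′ , ++-⊆ ℓ ℓ′ s s′ ,
          inj₂ (≤-respˡ (sym (List.length-++ ℓ)) (+-mono-≤ le le′) ,
              ≤-trans both (#-mono {P = B a ∪ B b} {Q = F} union⊆F)))
    rest (inj₂ none) = inj₁ (B a , B⊆F a∈F , ≤-trans 8≤m (B-size a∈F) , clique)
      where
      -- Two disjoint balls of at least m vertices each share at most 2m vertices.
      Ba≤m : # (B a) ≤ m
      Ba≤m = linear 5 (λ p q u f m → 1 · p ⊕ q ≼ u ⇒ 1 · u ≼ f ⇒ 1 · f ≼ m ⊕ m ⇒ 1 · m ≼ q ⇒ ⊢ p ≼ m) refl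
        (# (B a)) (# (B b)) (# (B a ∪ B b)) (# F) m disjoint (#-mono {P = B a ∪ B b} {Q = F} union⊆F) F≤2m
            (B-size b∈F)
      clique : Clique G (B a)
      clique {x} {y} p q n with bool (E G x y)
      ... | inj₁ e = e
      -- No edge joins the two balls, which fill F. So the ball of x lies in that of a, and without
      -- y it would be too small.
      ... | inj₂ e = ⊥-elim (<⇒≱ (#-strict {P = B x} {Q = B a} Bx⊆Ba q
              (cong₂ _∨_ (trans (cong (F y ∧_) e) (Bool.∧-zeroʳ (F y))) (≢⇒≠ (λ r → n (sym r)))))
              (≤-trans Ba≤m (B-size (B⊆F a∈F p))))
        where
        Bx⊆Ba : B x ⊆ B a
        Bx⊆Ba {z} h with B⁻ {x} h
        ... | inj₂ refl = p
        ... | inj₁ (z∈F , f) with ∨⁻ {B a z} (F⊆union z∈F)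
        ...   | inj₁ r = r
        ...   | inj₂ r = absurd (∧⁺ p (anyᵇ⁺ {P = λ y → B b y ∧ E G x y} {z} (∧⁺ r f))) (none x)

-- How a vertex of F sees a path that no vertex of F can shorten. In a short path an
-- edge xy is singled out such that missing x or y lowers the bound M.
record Profile (G : Graph N) (F : VSet N) (ℓ : List (Fin N)) : Set where
  field
    M     : ℕ
    M≤3   : M ≤ 3
    seen  : ∀ {z} → z ∈ F → count (E G z) ℓ ≤ M
    2M≤   : M + M ≤ length ℓ + 3
    short : (M + M ≤ length ℓ + 1) ⊎
            (∃ λ x → ∃ λ y → x ∈ mem ℓ × y ∈ mem ℓ × E G x y ≡ true ×
             (∀ {z} → z ∈ F → count (E G z) ℓ + (𝟙 (not (E G z x)) + 𝟙 (not (E G z y))) ≤ M))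

Shorter : Graph N → VSet N → Fin N → List (Fin N) → Fin N → Set
Shorter G F s ℓ t = ∃ λ z → z ∈ F × ∃ λ ℓ′ → Chain G s ℓ′ t × length ℓ′ < length ℓ × mem ℓ′ ⊆ ⁅ z ⁆ ∪ mem ℓ

-- If no vertex of F sees four vertices of the path, M = 3 is a bound, or M = 2 for a single edge.
-- In a path of two or three vertices the first edge can be singled out.
profile : ∀ {G : Graph N} {F s ℓ t} → s ≢ t → Chain G s ℓ t → Shorter G F s ℓ t ⊎ Profile G F ℓ
profile {N} {G} {F} {s} {ℓ} {t} s≢t c with find (λ z → F z ∧ does (4 ℕ.≤? count (E G z) ℓ))
... | inj₁ (z , h) = inj₁ (z , ∧-left h , shortcut z c (does⁻ (4 ℕ.≤? count (E G z) ℓ) (∧-right {F z} h)))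
... | inj₂ none = shape c ≤3
  where
  ≤3 : ∀ {z} → z ∈ F → count (E G z) ℓ ≤ 3
  ≤3 {z} h = ≤-pred (≰⇒> (λ k → true≢false (∧⁺ h (does⁺ (4 ℕ.≤? count (E G z) ℓ) k)) (none z)))
  drop : ∀ a b c → a + (b + c) ≤ c → a ≤ c
  drop = linear 3 (λ a b c → 1 · a ⊕ (b ⊕ c) ≼ c ⇒ ⊢ a ≼ c) refl
  shape : ∀ {ℓ} → Chain G s ℓ t → (∀ {z} → z ∈ F → count (E G z) ℓ ≤ 3) → Shorter G F s ℓ t ⊎ Profile G F ℓ
  shape [ _ ] _ = ⊥-elim (s≢t refl)
  shape (e ∷ [ _ ]) _ = inj₂ (record
    { M = 2 ; M≤3 = s≤s (s≤s z≤n) ; 2M≤ = s≤s (s≤s (s≤s (s≤s z≤n)))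
    ; seen = λ {z} _ → taut 2 (λ a b → 𝟙 a + (𝟙 b + 0) ≼ 2) refl (E G z s) (E G z t)
    ; short = inj₂ (s , t , ∨-introˡ (==⁺ s) , ∨-introʳ {t == s} (∨-introˡ (==⁺ t)) , e ,
        λ {z} _ → taut 2 (λ a b → 𝟙 a + (𝟙 b + 0) + (𝟙 (not a) + 𝟙 (not b)) ≼ 2) refl (E G z s) (E G z t)) })
  shape (_∷_ {x = x} e (e′ ∷ [ _ ])) ≤3 = inj₂ (record
    { M = 3 ; M≤3 = ≤-refl ; 2M≤ = ≤-refl ; seen = ≤3
    ; short = inj₂ (s , x , ∨-introˡ (==⁺ s) , ∨-introʳ {x == s} (∨-introˡ (==⁺ x)) , e ,
        λ {z} _ → taut 3 (λ a b c → 𝟙 a + (𝟙 b + (𝟙 c + 0)) + (𝟙 (not a) + 𝟙 (not b)) ≼ 3) refl (E G z s) (E G z x)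
            (E G z t)) })
  -- With four vertices the middle edge is taken. A vertex of F adjacent to both ends would shorten
  -- the path, so the ends contribute at most one.
  shape (_∷_ {x = x} e (_∷_ {x = y} e′ (e″ ∷ [ _ ]))) ≤3 with find (λ z → F z ∧ E G z s ∧ E G z t)
  ... | inj₁ (z , h) = inj₁ (z , ∧-left h , s ∷ z ∷ t ∷ [] ,
          E-sym G (∧-left (∧-right {F z} h)) ∷ (∧-right {E G z s} (∧-right {F z} h) ∷ [ t ]) , ≤-refl ,
          λ {w} → taut 5 (λ a b c d f → a ∨ (b ∨ (c ∨ false)) ⇒ ! (b ∨ (a ∨ (d ∨ (f ∨ (c ∨ false)))))) refl
                    (w == s) (w == z) (w == t) (w == x) (w == y))
  ... | inj₂ none = inj₂ (record
    { M = 3 ; M≤3 = ≤-refl ; 2M≤ = n≤1+n 6 ; seen = ≤3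
    ; short = inj₂ (x , y , ∨-introʳ {x == s} (∨-introˡ (==⁺ x)) ,
        ∨-introʳ {y == s} (∨-introʳ {y == x} (∨-introˡ (==⁺ y))) , e′ ,
        λ {z} z∈F → taut 5 (λ f a b c d → not (f ∧ a ∧ d) ⇒ f ⇒
            𝟙 a + (𝟙 b + (𝟙 c + (𝟙 d + 0))) + (𝟙 (not b) + 𝟙 (not c)) ≼ 3) refl
          (F z) (E G z s) (E G z x) (E G z y) (E G z t) (not⁺ (none z)) z∈F) })
  -- From five vertices on, 2M = 6 is at most the length plus 1.
  shape (_∷_ e (_∷_ e′ (_∷_ e″ (_∷_ {ℓ = ℓ} e‴ c)))) ≤3 = inj₂ (record
    { M = 3 ; M≤3 = ≤-refl ; 2M≤ = ≤-trans (n≤1+n 6) (s≤s (s≤s (s≤s (s≤s (m≤n+m 3 (length ℓ))))))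
    ; seen = ≤3 ; short = inj₁ (s≤s (s≤s (s≤s (s≤s (+-monoˡ-≤ 1 (nonempty c)))))) })
    where
    nonempty : ∀ {x ℓ} → Chain G x ℓ t → 1 ≤ length ℓ
    nonempty [ _ ]   = s≤s z≤n
    nonempty (_ ∷ _) = s≤s z≤n

-- Linking four pairs in the neighbourhood of a vertex

Pair : ℕ → Set
Pair N = Fin N × Fin N

Route : ℕ → Set
Route N = Pair N × List (Fin N)

flat : List (Pair N) → List (Fin N)
flat []             = []
flat ((s , t) ∷ rs) = s ∷ t ∷ flat rs

used : List (Route N) → List (Fin N)
used []             = []
used ((_ , ℓ) ∷ rs) = ℓ ++ used rs

-- The pair that is easiest to join is routed next, wherever it stands in the list.
data Pick {A : Set} (x : A) : List A → List A → Set where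
  here  : ∀ {xs} → Pick x (x ∷ xs) xs
  there : ∀ {y xs ys} → Pick x xs ys → Pick x (y ∷ xs) (y ∷ ys)

used-∈ : ∀ {p : Pair N} {ℓ done} → (p , ℓ) ∈ₗ done → mem ℓ ⊆ mem (used done)
used-∈ {ℓ = ℓ} {_ ∷ done} (here refl) h = mem-++ˡ ℓ (used done) h
used-∈ {done = (_ , ℓ) ∷ done} (there p) h = mem-++ʳ ℓ (used done) (used-∈ p h)

flat-∈ : ∀ {s t : Fin N} {rest} → (s , t) ∈ₗ rest → s ∈ mem (flat rest) × t ∈ mem (flat rest)
flat-∈ {s = s} {t} (here refl) = ∨-introˡ (==⁺ s) , ∨-introʳ {t == s} (∨-introˡ (==⁺ t))
flat-∈ {s = s} {t} {(a , b) ∷ _} (there p) with flat-∈ p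
... | q , r = ∨-introʳ {s == a} (∨-introʳ {s == b} q) , ∨-introʳ {t == a} (∨-introʳ {t == b} r)

pick-length : ∀ {A : Set} {x : A} {xs ys} → Pick x xs ys → length xs ≡ suc (length ys)
pick-length here      = refl
pick-length (there p) = cong suc (pick-length p)

pick-∈ : ∀ {A : Set} {x y : A} {xs ys} → Pick x xs ys → y ∈ₗ xs → y ≡ x ⊎ y ∈ₗ ys
pick-∈ here      (here e)  = inj₁ e
pick-∈ here      (there p) = inj₂ p
pick-∈ (there q) (here e)  = inj₂ (here e)
pick-∈ (there q) (there p) with pick-∈ q p
... | inj₁ e = inj₁ e
... | inj₂ r = inj₂ (there r)

pick-mult : ∀ {s t : Fin N} {rs rs′} → Pick (s , t) rs rs′ → ∀ z →
    𝟙 (z == s) + 𝟙 (z == t) + mult (flat rs′) z ≤ mult (flat rs) z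
pick-mult here z = ≤-reflexive (+-assoc (𝟙 (z == _)) _ _)
pick-mult {s = s} {t} (there {y = a , b} {xs} {ys} p) z = linear 6 (λ s t m m′ a b → 1 · (s ⊕ t) ⊕ m ≼ m′ ⇒
    ⊢ (s ⊕ t) ⊕ (a ⊕ (b ⊕ m)) ≼ a ⊕ (b ⊕ m′)) refl
  (𝟙 (z == s)) (𝟙 (z == t)) (mult (flat ys) z) (mult (flat xs) z) (𝟙 (z == a)) (𝟙 (z == b)) (pick-mult p z)

module _ (G : Graph N) where

  joins : Fin N → List (Pair N) → Bool
  joins z []             = false
  joins z ((s , t) ∷ rs) = (E G z s ∧ E G z t) ∨ joins z rs

  joins-pick : ∀ {z} rs → joins z rs ≡ true →
               ∃ λ s → ∃ λ t → ∃ λ rs′ → Pick (s , t) rs rs′ × E G z s ≡ true × E G z t ≡ true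
  joins-pick {z} ((s , t) ∷ rs) h with ∨⁻ {E G z s ∧ E G z t} h
  ... | inj₁ p = s , t , rs , here , ∧-left p , ∧-right {E G z s} p
  ... | inj₂ p with joins-pick rs p
  ...   | s′ , t′ , rs′ , q , e , e′ = s′ , t′ , (s , t) ∷ rs′ , there q , e , e′

  count-flat : ∀ {z} rs → joins z rs ≡ false → count (E G z) (flat rs) ≤ length rs
  count-flat []                 h = z≤n
  count-flat {z} ((s , t) ∷ rs) h = linear 4 (λ a b c n → 1 · a ⊕ b ≼ con 1 ⇒ 1 · c ≼ n ⇒
      ⊢ a ⊕ (b ⊕ c) ≼ con 1 ⊕ n) refl
    (𝟙 (E G z s)) (𝟙 (E G z t)) (count (E G z) (flat rs)) (length rs)
    (taut 3 (λ a b c → not ((a ∧ b) ∨ c) ⇒ 𝟙 a + 𝟙 b ≼ 1) refl (E G z s) (E G z t) (joins z rs) (not⁺ h))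
    (count-flat rs (not⁻ (taut 2 (λ a b → not (a ∨ b) ⇒ ! not b) refl (E G z s ∧ E G z t) (joins z rs) (not⁺ h))))

-- Terminals count as adjacent to each other, because contracting v into a terminal also loses its
-- edges to the other terminals.
vicinity : Graph N → (W T : VSet N) → Fin N → VSet N
vicinity G W T w x = W x ∧ not (x == w) ∧ (E G w x ∨ (T w ∧ T x))

module Dense {N : ℕ} (G : Graph N) (W : VSet N) (v : Fin N) (v∉W : W v ≡ false)
             (v~W : ∀ {w} → w ∈ W → E G v w ≡ true) (W≤29 : # W ≤ 29) (T : VSet N)
             (degree : ∀ {w} → w ∈ W → 15 ≤ # (vicinity G W T w))
             (pairs₀ : List (Pair N))
             (T⊆pairs : ∀ {z} → z ∈ T → ∃ λ s → ∃ λ t → (s , t) ∈ₗ pairs₀ × (z ≡ s ⊎ z ≡ t)) where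

  V : VSet N
  V = W ∪ ⁅ v ⁆

  Solution : Set
  Solution = Σ[ col ∈ (Fin N → Fin N) ]
    (∀ {s t} → (s , t) ∈ₗ pairs₀ → Walk G (λ z → z ∈ V × col z ≡ s) s t)

  Outcome : Set
  Outcome = BigClique G V ⊎ Solution

  -- Finished routes and remaining terminals share one distinctness condition, so a new route only
  -- has to keep to free vertices apart from its ends.
  record State (done : List (Route N)) (rest : List (Pair N)) : Set where
    field
      chains   : ∀ {s t ℓ} → ((s , t) , ℓ) ∈ₗ done → s ≢ t × Chain G s ℓ t
      distinct : Distinct (used done ++ flat rest)
      inside   : mem (used done ++ flat rest) ⊆ W
      complete : ∀ {p} → p ∈ₗ pairs₀ → (∃ λ ℓ → (p , ℓ) ∈ₗ done) ⊎ p ∈ₗ rest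

  module _ {done : List (Route N)} {rest : List (Pair N)} (σ : State done rest) where
    open State σ

    L : List (Fin N)
    L = used done ++ flat rest

    Free : VSet N
    Free = W ∖ mem L

    covers : T ⊆ mem L
    covers {z} h with T⊆pairs h
    ... | s , t , p , e with complete p
    ...   | inj₂ q = mem-++ʳ (used done) (flat rest) ([ (λ { refl → proj₁ (flat-∈ q) }) ,
        (λ { refl → proj₂ (flat-∈ q) }) ]′ e)
    ...   | inj₁ (ℓ , q) = mem-++ˡ (used done) (flat rest) (used-∈ q ([ (λ { refl → chain-start (proj₂ (chains q)) })
                                                                     , (λ { refl → chain-end (proj₂ (chains q)) }) ]′ e))

    free-size : # Free + length L ≤ 29
    free-size = ≤-trans (#-∖-distinct L distinct inside) W≤29

    Free-∉ : ∀ {z} → z ∈ Free → mult L z ≤ 0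
    Free-∉ {z} h = mult-∉ L (not⁻ (∧-right {W z} h))

    mult-L : ∀ z → mult (used done) z + mult (flat rest) z ≤ 1
    mult-L = distinct-++⁻ (used done) (flat rest) distinct

    Free-T : ∀ {z} → z ∈ Free → T z ≡ false
    Free-T {z} h = ¬true⇒false (λ p → true≢false (covers p) (not⁻ (∧-right {W z} h)))

    -- A free vertex is no terminal, so its 15 neighbours are genuine. Those that are not free lie
    -- on finished routes or among the remaining terminals, at most one in each pair.
    free-degree : ∀ {z} → z ∈ Free → joins G z rest ≡ false →
                  15 ≤ # (Free ∩ E G z) + (count (E G z) (used done) + length rest)
    free-degree {z} h j = ≤-trans (degree (∧-left h)) (≤-trans (#-mono {Q = W ∩ E G z} (λ {x} →
          taut 5 (λ w q e t u → not t ⇒ w ∧ not q ∧ (e ∨ (t ∧ u)) ⇒ ! (w ∧ e)) refl (W x) (x == z) (E G z x) (T z)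
              (T x) (not⁺ (Free-T h))))
      (≤-trans (#-count (W ∩ E G z) L) (+-mono-≤ (#-mono {P = (W ∩ E G z) ∖ mem L} {Q = Free ∩ E G z} (λ {x} →
          taut 3 (λ w e l → (w ∧ e) ∧ not l ⇒ ! ((w ∧ not l) ∧ e)) refl (W x) (E G z x) (mem L x)))
        (≤-trans (count-mono {P = W ∩ E G z} {Q = E G z} (λ {x} → ∧-right {W x}) L)
          (≤-respˡ (sym (count-++ (E G z) (used done) (flat rest))) (+-monoʳ-≤ _ (count-flat G rest j)))))))

    -- All terminals are in L, so the members of the vicinity outside L are true neighbours. As t is
    -- not in its own vicinity, L contains at most `length L` - 1 members.
    terminal-degree : ∀ {t} → t ∈ mem L → 16 ≤ # (Free ∩ E G t) + length L
    terminal-degree {t} h = linear 5 (λ d f c l k → 1 · con 15 ≼ d ⇒ 1 · d ≼ f ⊕ c ⇒ 1 · con 1 ⊕ c ≼ l ⇒ 1 · f ≼ k ⇒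
        ⊢ con 16 ≼ k ⊕ l) refl
        (# D) (# (D ∖ mem L)) (count D L) (length L) (# (Free ∩ E G t)) (degree (inside h))
            (#-count D L) missed outside
      where
      D : VSet N
      D = vicinity G W T t
      t∉D : D t ≡ false
      t∉D = not⁻ (taut 3 (λ w q e → q ⇒ ! not (w ∧ not q ∧ e)) refl (W t) (t == t) (E G t t ∨ (T t ∧ T t)) (==⁺ t))
      missed : suc (count D L) ≤ length L
      missed = count-miss D L h t∉D
      outside : # (D ∖ mem L) ≤ # (Free ∩ E G t)
      outside = #-mono {P = D ∖ mem L} {Q = Free ∩ E G t} (λ {x} →
          taut 6 (λ w q e a b l → (b ⇛ l) ⇒ (w ∧ not q ∧ (e ∨ (a ∧ b))) ∧ not l ⇒ ! ((w ∧ not l) ∧ e)) refl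
          (W x) (x == t) (E G t x) (T t) (T x) (mem L x) (⇛⁺ {T x} covers))

    terminal-neighbour : ∀ {t} → t ∈ mem L → length L ≤ 15 → ∃ λ a → a ∈ Free × E G t a ≡ true
    terminal-neighbour {t} h le = unpack (#-pos⁻ {P = Free ∩ E G t} positive)
      where
      positive : 1 ≤ # (Free ∩ E G t)
      positive = linear 2 (λ a l → 1 · con 16 ≼ a ⊕ l ⇒ 1 · l ≼ con 15 ⇒ ⊢ con 1 ≼ a) refl
        (# (Free ∩ E G t)) (length L) (terminal-degree h) le
      unpack : ∃ (_∈ Free ∩ E G t) → ∃ λ a → a ∈ Free × E G t a ≡ true
      unpack (a , p) = a , ∧-left p , ∧-right {Free a} p

    NewRoute : Fin N → Fin N → List (Fin N) → Set
    NewRoute s t ℓ = Chain G s ℓ t × (∀ {z} → z ∈ mem ℓ → z ∈ Free ⊎ z ≡ s ⊎ z ≡ t)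

    through : ∀ {s t a b ℓ} → E G s a ≡ true → Chain G a ℓ b → mem ℓ ⊆ Free → E G b t ≡ true →
        NewRoute s t (s ∷ (ℓ ++ t ∷ []))
    through {s} {t} {ℓ = ℓ} e c sub e′ = e ∷ chain-++ c e′ [ t ] , λ {z} h → classify z (∨⁻ {z == s} h)
      where
      classify : ∀ z → (z == s ≡ true) ⊎ z ∈ mem (ℓ ++ t ∷ []) → z ∈ Free ⊎ z ≡ s ⊎ z ≡ t
      classify z (inj₁ p) = inj₂ (inj₁ (==⁻ p))
      classify z (inj₂ p) with mem-++⁻ ℓ (t ∷ []) p
      ... | inj₁ q = inj₁ (sub q)
      ... | inj₂ q with ∨⁻ {z == t} q
      ...   | inj₁ r = inj₂ (inj₂ (==⁻ r))

    via : ∀ {s t z} → z ∈ Free → E G z s ≡ true → E G z t ≡ true → NewRoute s t (s ∷ (z ∷ t ∷ []))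
    via {s} {t} {z} h e e′ = through {ℓ = z ∷ []} (E-sym G e) [ z ] (λ {x} p → single x (∨⁻ {x == z} p)) e′
      where
      single : ∀ x → (x == z ≡ true) ⊎ (false ≡ true) → x ∈ Free
      single x (inj₁ q) = subst (_∈ Free) (==⁻ˢ q) h

    picked-distinct : ∀ {s t rest′} → Pick (s , t) rest rest′ → ∀ z →
                      𝟙 (z == s) + 𝟙 (z == t) + mult (flat rest′) z + mult (used done) z ≤ 1
    picked-distinct {s} {t} {rest′} p z = linear 5 (λ a b m m′ u → 1 · (a ⊕ b) ⊕ m ≼ m′ ⇒ 1 · u ⊕ m′ ≼ con 1 ⇒
        ⊢ (a ⊕ b ⊕ m) ⊕ u ≼ con 1) refl
      (𝟙 (z == s)) (𝟙 (z == t)) (mult (flat rest′) z) (mult (flat rest) z) (mult (used done) z) (pick-mult p z)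
          (mult-L z)

    picked-≢ : ∀ {s t rest′} → Pick (s , t) rest rest′ → s ≢ t
    picked-≢ {s} {rest′ = rest′} p refl = <-irrefl refl (linear 3 (λ a m u → 1 · ((a ⊕ a) ⊕ m) ⊕ u ≼ con 1 ⇒
        2 · con 1 ≼ a ⇒ ⊢ con 1 ≼ con 0) refl
      (𝟙 (s == s)) (mult (flat rest′) s) (mult (used done) s) (picked-distinct p s)
          (≤-reflexive (cong 𝟙 (sym (==⁺ s)))))

    new-apart : ∀ {s t ℓ rest′} → Pick (s , t) rest rest′ → NewRoute s t ℓ → ∀ {z} → z ∈ mem ℓ →
                mult (used done) z + mult (flat rest′) z ≤ 0
    new-apart {s} {t} {ℓ} {rest′} p (_ , where?) {z} h with where? h
    ... | inj₁ f = linear 5 (λ u m m′ l k → 1 · k ⊕ m ≼ m′ ⇒ 1 · u ⊕ m′ ≼ l ⇒ 1 · l ≼ con 0 ⇒ ⊢ u ⊕ m ≼ con 0) refl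
          (mult (used done) z) (mult (flat rest′) z) (mult (flat rest) z) (mult L z) (𝟙 (z == s) + 𝟙 (z == t))
          (pick-mult p z) (≤-reflexive (sym (count-++ _ (used done) (flat rest)))) (Free-∉ f)
    ... | inj₂ (inj₁ refl) = linear 4 (λ a b m u → 1 · ((a ⊕ b) ⊕ m) ⊕ u ≼ con 1 ⇒ 1 · con 1 ≼ a ⇒
        ⊢ u ⊕ m ≼ con 0) refl
          (𝟙 (z == z)) (𝟙 (z == t)) (mult (flat rest′) z) (mult (used done) z) (picked-distinct p z)
              (≤-reflexive (cong 𝟙 (sym (==⁺ z))))
    ... | inj₂ (inj₂ refl) = linear 4 (λ a b m u → 1 · ((a ⊕ b) ⊕ m) ⊕ u ≼ con 1 ⇒ 1 · con 1 ≼ b ⇒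
        ⊢ u ⊕ m ≼ con 0) refl
          (𝟙 (z == s)) (𝟙 (z == z)) (mult (flat rest′) z) (mult (used done) z) (picked-distinct p z)
              (≤-reflexive (cong 𝟙 (sym (==⁺ z))))

    rest⊆W : mem (flat rest) ⊆ W
    rest⊆W h = inside (mem-++ʳ (used done) (flat rest) h)

    pick-s : ∀ {s t rest′} → Pick (s , t) rest rest′ → s ∈ mem (flat rest)
    pick-s {s} {t} {rest′} p = mult⇒mem (flat rest) (≤-trans (≤-respˡ (sym (cong 𝟙 (sym (==⁺ s))))
      (≤-trans (m≤m+n _ (𝟙 (s == t))) (m≤m+n _ (mult (flat rest′) s)))) (pick-mult p s))

    pick-t : ∀ {s t rest′} → Pick (s , t) rest rest′ → t ∈ mem (flat rest)
    pick-t {s} {t} {rest′} p = mult⇒mem (flat rest) (≤-trans (≤-respˡ (sym (cong 𝟙 (sym (==⁺ t))))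
      (≤-trans (m≤n+m _ (𝟙 (t == s))) (m≤m+n _ (mult (flat rest′) t)))) (pick-mult p t))

    new-inside : ∀ {s t ℓ rest′} → Pick (s , t) rest rest′ → NewRoute s t ℓ → mem ℓ ⊆ W
    new-inside p (_ , where?) h with where? h
    ... | inj₁ f           = ∧-left f
    ... | inj₂ (inj₁ refl) = rest⊆W (pick-s p)
    ... | inj₂ (inj₂ refl) = rest⊆W (pick-t p)

    pick-⊆ : ∀ {s t rest′} → Pick (s , t) rest rest′ → mem (flat rest′) ⊆ mem (flat rest)
    pick-⊆ {s} {t} {rest′} p {z} h = mult⇒mem (flat rest) (≤-trans (mem⇒mult {ℓ = flat rest′} h)
      (≤-trans (m≤n+m _ (𝟙 (z == s) + 𝟙 (z == t))) (pick-mult p z)))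

    add-route : ∀ {s t ℓ rest′} → Pick (s , t) rest rest′ → NewRoute s t ℓ → Distinct ℓ →
        State (((s , t) , ℓ) ∷ done) rest′
    add-route {s} {t} {ℓ} {rest′} p new d = record
      { chains   = λ { (here refl) → picked-≢ p , proj₁ new ; (there h) → chains h }
      ; distinct = subst Distinct (sym assoc) (distinct-++ ℓ (used done ++ flat rest′) d
          (λ z → linear 5 (λ a m u l b → 1 · (a ⊕ m) ⊕ u ≼ con 1 ⇒ 1 · l ≼ u ⊕ m ⇒ ⊢ l ≼ con 1) refl
            (𝟙 (z == s) + 𝟙 (z == t)) (mult (flat rest′) z) (mult (used done) z) (mult (used done ++ flat rest′) z) 0
            (picked-distinct p z) (≤-reflexive (count-++ _ (used done) (flat rest′))))
          (λ {z} h → ∉-mult (used done ++ flat rest′) (≤-respˡ (sym (count-++ _ (used done) (flat rest′)))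
              (new-apart p new h))))
      ; inside   = λ {z} h → case-inside z (mem-++⁻ ℓ (used done ++ flat rest′) (subst (λ k → z ∈ mem k) assoc h))
      ; complete = λ h → case-complete (complete h)
      }
      where
      assoc : (ℓ ++ used done) ++ flat rest′ ≡ ℓ ++ (used done ++ flat rest′)
      assoc = List.++-assoc ℓ (used done) (flat rest′)
      case-inside : ∀ z → z ∈ mem ℓ ⊎ z ∈ mem (used done ++ flat rest′) → z ∈ W
      case-inside z (inj₁ h) = new-inside p new h
      case-inside z (inj₂ h) with mem-++⁻ (used done) (flat rest′) h
      ... | inj₁ k = inside (mem-++ˡ (used done) (flat rest) k)
      ... | inj₂ k = rest⊆W (pick-⊆ p k)
      case-complete : ∀ {q} → (∃ λ k → (q , k) ∈ₗ done) ⊎ q ∈ₗ rest → (∃ λ k → (q , k) ∈ₗ (((s , t) , ℓ) ∷ done)) ⊎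
          q ∈ₗ rest′
      case-complete (inj₁ (k , h)) = inj₁ (k , there h)
      case-complete (inj₂ h) with pick-∈ p h
      ... | inj₁ refl = inj₁ (ℓ , here refl)
      ... | inj₂ k    = inj₂ k

    erase-new : ∀ {s t ℓ} → NewRoute s t ℓ → ∃ λ ℓ′ → NewRoute s t ℓ′ × Distinct ℓ′ × length ℓ′ ≤ length ℓ
    erase-new (c , where?) with erase c
    ... | ℓ′ , c′ , d′ , le , sub = ℓ′ , (c′ , λ h → where? (sub h)) , d′ , le

  replace-route : ∀ {s t ℓ ℓ′ done rest} (σ : State (((s , t) , ℓ) ∷ done) rest) → Chain G s ℓ′ t → Distinct ℓ′ →
                  (∀ {z} → z ∈ mem ℓ′ → z ∈ Free σ ⊎ z ∈ mem ℓ) → State (((s , t) , ℓ′) ∷ done) rest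
  replace-route {s} {t} {ℓ} {ℓ′} {done} {rest} σ c d where? = record
    { chains   = λ { (here refl) → proj₁ (chains (here refl)) , c ; (there h) → chains (there h) }
    ; distinct = subst Distinct (sym (assoc ℓ′)) (distinct-++ ℓ′ R d (λ z → ≤-trans (m≤n+m _ (mult ℓ z)) (both z))
        (λ {z} h → apart z (where? h)))
    ; inside   = λ {z} h → case-inside z (mem-++⁻ ℓ′ R (subst (λ k → z ∈ mem k) (assoc ℓ′) h))
    ; complete = λ h → case-complete (complete h)
    }
    where
    open State σ
    R : List (Fin N)
    R = used done ++ flat rest
    assoc : ∀ ℓ → (ℓ ++ used done) ++ flat rest ≡ ℓ ++ R
    assoc ℓ = List.++-assoc ℓ (used done) (flat rest)
    both : ∀ z → mult ℓ z + mult R z ≤ 1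
    both = distinct-++⁻ ℓ R (subst Distinct (assoc ℓ) distinct)
    apart : ∀ z → z ∈ Free σ ⊎ z ∈ mem ℓ → mem R z ≡ false
    apart z (inj₁ f) = ∉-mult R (≤-trans (m≤n+m _ (mult ℓ z)) (≤-trans (≤-reflexive
      (trans (sym (count-++ _ ℓ R)) (cong (λ k → mult k z) (sym (assoc ℓ))))) (Free-∉ σ f)))
    apart z (inj₂ h) = distinct-apart ℓ R (subst Distinct (assoc ℓ) distinct) h
    case-inside : ∀ z → z ∈ mem ℓ′ ⊎ z ∈ mem R → z ∈ W
    case-inside z (inj₂ h) = inside (subst (λ k → z ∈ mem k) (sym (assoc ℓ)) (mem-++ʳ ℓ R h))
    case-inside z (inj₁ h) with where? h
    ... | inj₁ f = ∧-left f
    ... | inj₂ k = inside (subst (λ m → z ∈ mem m) (sym (assoc ℓ)) (mem-++ˡ ℓ R k))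
    case-complete : ∀ {q} → (∃ λ k → (q , k) ∈ₗ (((s , t) , ℓ) ∷ done)) ⊎ q ∈ₗ rest →
        (∃ λ k → (q , k) ∈ₗ (((s , t) , ℓ′) ∷ done)) ⊎ q ∈ₗ rest
    case-complete (inj₁ (_ , here refl)) = inj₁ (ℓ′ , here refl)
    case-complete (inj₁ (k , there h))   = inj₁ (k , there h)
    case-complete (inj₂ h)               = inj₂ h

  W⊆V : W ⊆ V
  W⊆V = ∨-introˡ

  mult-swap : ∀ ℓ₁ ℓ₂ (u f : List (Fin N)) z → mult ((ℓ₁ ++ (ℓ₂ ++ u)) ++ f) z ≡ mult ((ℓ₂ ++ (ℓ₁ ++ u)) ++ f) z
  mult-swap ℓ₁ ℓ₂ u f z = ≤-antisym (half ℓ₁ ℓ₂) (half ℓ₂ ℓ₁)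
    where
    expand : ∀ ℓ₁ ℓ₂ → mult ((ℓ₁ ++ (ℓ₂ ++ u)) ++ f) z ≡ mult ℓ₁ z + (mult ℓ₂ z + mult u z) + mult f z
    expand ℓ₁ ℓ₂ = trans (count-++ _ (ℓ₁ ++ (ℓ₂ ++ u)) f) (cong (_+ mult f z)
      (trans (count-++ _ ℓ₁ (ℓ₂ ++ u)) (cong (mult ℓ₁ z +_) (count-++ _ ℓ₂ u))))
    half : ∀ ℓ₁ ℓ₂ → mult ((ℓ₁ ++ (ℓ₂ ++ u)) ++ f) z ≤ mult ((ℓ₂ ++ (ℓ₁ ++ u)) ++ f) z
    half ℓ₁ ℓ₂ = ≤-respˡ (sym (expand ℓ₁ ℓ₂)) (≤-trans
      (linear 4 (λ a b u f → ⊢ (a ⊕ (b ⊕ u)) ⊕ f ≼ (b ⊕ (a ⊕ u)) ⊕ f) refl (mult ℓ₁ z) (mult ℓ₂ z) (mult u z)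
          (mult f z))
      (≤-reflexive (sym (expand ℓ₂ ℓ₁))))

  swap-mem : ∀ ℓ₁ ℓ₂ (u f : List (Fin N)) → mem ((ℓ₁ ++ (ℓ₂ ++ u)) ++ f) ⊆ mem ((ℓ₂ ++ (ℓ₁ ++ u)) ++ f)
  swap-mem ℓ₁ ℓ₂ u f {z} h = mult⇒mem ((ℓ₂ ++ (ℓ₁ ++ u)) ++ f) {z}
      (≤-respʳ (mult-swap ℓ₁ ℓ₂ u f z) (mem⇒mult {ℓ = (ℓ₁ ++ (ℓ₂ ++ u)) ++ f} h))

  -- Shortening acts on the first route of the list, so the second has to be brought there.
  swap-routes : ∀ {p q : Pair N} {ℓ₁ ℓ₂ done rest} → State ((p , ℓ₁) ∷ (q , ℓ₂) ∷ done) rest →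
      State ((q , ℓ₂) ∷ (p , ℓ₁) ∷ done) rest
  swap-routes {p} {q} {ℓ₁} {ℓ₂} {done} {rest} σ = record
    { chains   = λ { (here refl) → chains (there (here refl)) ; (there (here refl)) →
        chains (here refl) ; (there (there h)) → chains (there (there h)) }
    ; distinct = λ z → ≤-respˡ (sym (mult-swap ℓ₂ ℓ₁ (used done) (flat rest) z)) (distinct z)
    ; inside   = λ h → inside (swap-mem ℓ₂ ℓ₁ (used done) (flat rest) h)
    ; complete = λ h → rearrange (complete h)
    }
    where
    open State σ
    rearrange : ∀ {r} → (∃ λ k → (r , k) ∈ₗ ((p , ℓ₁) ∷ (q , ℓ₂) ∷ done)) ⊎ r ∈ₗ rest →
                (∃ λ k → (r , k) ∈ₗ ((q , ℓ₂) ∷ (p , ℓ₁) ∷ done)) ⊎ r ∈ₗ rest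
    rearrange (inj₁ (k , here refl))         = inj₁ (k , there (here refl))
    rearrange (inj₁ (k , there (here refl))) = inj₁ (k , here refl)
    rearrange (inj₁ (k , there (there h)))   = inj₁ (k , there (there h))
    rearrange (inj₂ h)                       = inj₂ h

  colour : List (Route N) → Fin N → Fin N → Fin N
  colour []                  d z = d
  colour (((s , _) , ℓ) ∷ rs) d z = if mem ℓ z then s else colour rs d z

  colour-∉ : ∀ rs {d z} → mem (used rs) z ≡ false → colour rs d z ≡ d
  colour-∉ [] h = refl
  colour-∉ (((s , _) , ℓ) ∷ rs) {d} {z} h = trans
    (if-false (¬true⇒false (λ p → true≢false (mem-++ˡ ℓ (used rs) p) h)))
    (colour-∉ rs (¬true⇒false (λ p → true≢false (mem-++ʳ ℓ (used rs) p) h)))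

  colour-∈ : ∀ rs {d s t ℓ z} → Distinct (used rs) → ((s , t) , ℓ) ∈ₗ rs → z ∈ mem ℓ → colour rs d z ≡ s
  colour-∈ (((s , _) , ℓ) ∷ rs) {d} {z = z} u (here refl) h = if-true h
  colour-∈ (((s , _) , ℓ) ∷ rs) {d} {z = z} u (there p) h = trans
    (if-false (¬true⇒false (λ q → true≢false (used-∈ p h) (distinct-apart ℓ (used rs) u q))))
    (colour-∈ rs (λ y → ≤-trans (m≤n+m _ (mult ℓ y)) (distinct-++⁻ ℓ (used rs) u y)) p h)

  -- v is adjacent to all of W and lies on no finished route, so it joins the last pair.
  solve : ∀ {done rest} → State done rest → length rest ≡ 1 → Solution
  solve {done} {(s , t) ∷ []} σ _ = col , walk
    where
    open State σ
    col : Fin N → Fin N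
    -- Everything off the finished routes, v included, gets the colour of the last pair by default.
    col = colour done s
    used-distinct : Distinct (used done)
    used-distinct z = ≤-trans (m≤m+n _ _) (mult-L σ z)
    v∉used : mem (used done) v ≡ false
    v∉used = ¬true⇒false (λ h → true≢false (inside (mem-++ˡ (used done) (flat ((s , t) ∷ [])) h)) v∉W)
    rest-col : ∀ {z} → z ∈ mem (flat ((s , t) ∷ [])) → z ∈ V × col z ≡ s
    rest-col {z} h = W⊆V (rest⊆W σ h) , colour-∉ done
      (¬true⇒false (λ k → true≢false h (distinct-apart (used done) (flat ((s , t) ∷ [])) distinct k)))
    s∈ t∈ : _
    s∈ = flat-∈ {rest = (s , t) ∷ []} (here refl) .proj₁
    t∈ = flat-∈ {rest = (s , t) ∷ []} (here refl) .proj₂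
    walk : ∀ {a b} → (a , b) ∈ₗ pairs₀ → Walk G (λ z → z ∈ V × col z ≡ a) a b
    walk {a} {b} h with complete h
    ... | inj₁ (ℓ , p) = chain-walk (proj₂ (chains p)) (λ {z} k →
            W⊆V (inside (mem-++ˡ (used done) (flat ((s , t) ∷ [])) (used-∈ p k))) , colour-∈ done used-distinct p k)
    ... | inj₂ (here refl) = step (rest-col s∈) (E-sym G (v~W (rest⊆W σ s∈)))
            (step (∨-introʳ {W v} (==⁺ v) , colour-∉ done v∉used) (v~W (rest⊆W σ t∈)) (stop (rest-col t∈)))

  finish : ∀ {done rest s t ℓ rest′} (σ : State done rest) → length rest ≡ 2 → Pick (s , t) rest rest′ →
      NewRoute σ s t ℓ → Outcome
  finish σ two p new with erase-new σ new
  ... | ℓ′ , new′ , d , _ = inj₂ (solve (add-route σ p new′ d) (suc-injective (trans (sym (pick-length p)) two)))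

  flat-length : ∀ (rest : List (Pair N)) → length (flat rest) ≡ 2 * length rest
  flat-length []         = refl
  flat-length (_ ∷ rest) = trans (cong (λ n → suc (suc n)) (flat-length rest)) (sym (*-suc 2 (length rest)))

  length-L : ∀ {done rest} (σ : State done rest) → length (L σ) ≡ length (used done) + 2 * length rest
  length-L {done} {rest} σ = trans (List.length-++ (used done)) (cong (length (used done) +_) (flat-length rest))

  half-1 : ∀ m → m + m ≤ 1 → m ≤ 0
  half-1 m h = ≮⇒≥ (λ k → <-irrefl refl (linear 1 (λ m → 1 · m ⊕ m ≼ con 1 ⇒ 2 · con 1 ≼ m ⇒
      ⊢ con 1 ≼ con 0) refl m h k))

  half-3 : ∀ m → m + m ≤ 3 → m ≤ 1
  half-3 m h = ≮⇒≥ (λ k → <-irrefl refl (linear 1 (λ m → 1 · m ⊕ m ≼ con 3 ⇒ 2 · con 2 ≼ m ⇒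
      ⊢ con 1 ≼ con 0) refl m h k))

  -- Each vertex of a small closed set sees at most 3 vertices of either path and one
  -- vertex of each remaining pair, so nearly all its neighbours lie in the set.
  module Closed {p q : Pair N} {ℓ₁ ℓ₂ : List (Fin N)} {rest : List (Pair N)}
                (σ : State ((p , ℓ₁) ∷ (q , ℓ₂) ∷ []) rest) (two : length rest ≡ 2)
                (π₁ : Profile G (Free σ) ℓ₁) (π₂ : Profile G (Free σ) ℓ₂)
                (unjoined : ∀ {z} → z ∈ Free σ → joins G z rest ≡ false)
                (F : VSet N) (F⊆Free : F ⊆ Free σ)
                (closed : ∀ {x y} → x ∈ F → y ∈ Free σ → E G x y ≡ true → y ∈ F)
                (small : # F + # F ≤ # (Free σ)) (nonempty : ∃ (_∈ F)) where

    module π₁ = Profile π₁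
    module π₂ = Profile π₂

    miss : Fin N → ℕ
    miss z = # (nonneighbours G F z)

    -- At least 15 - 2 neighbours of z are free or on the two routes, the free ones lie in F, and z
    -- itself belongs to F: hence 14.
    miss-bound : ∀ {z} → z ∈ F → 14 + miss z ≤ # F + (count (E G z) ℓ₁ + count (E G z) ℓ₂)
    miss-bound {z} h = linear 7 (λ n m f′ f c c₁ c₂ → 1 · con 15 ≼ n ⊕ (c ⊕ con 2) ⇒ 1 · c ≼ c₁ ⊕ (c₂ ⊕ con 0) ⇒
        1 · n ⊕ m ≼ f′ ⇒
        1 · con 1 ⊕ f′ ≼ f ⇒ ⊢ con 14 ⊕ m ≼ f ⊕ (c₁ ⊕ c₂)) refl
      (# (Free σ ∩ E G z)) (miss z) (# (F ∖ ⁅ z ⁆)) (# F) (count (E G z) (used ((p , ℓ₁) ∷ (q , ℓ₂) ∷ [])))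
          (count (E G z) ℓ₁) (count (E G z) ℓ₂)
      (subst (λ k → 15 ≤ # (Free σ ∩ E G z) + (count (E G z) (used ((p , ℓ₁) ∷ (q , ℓ₂) ∷ [])) + k)) two
          (free-degree σ (F⊆Free h) (unjoined (F⊆Free h))))
      (≤-reflexive (trans (count-++ (E G z) ℓ₁ (ℓ₂ ++ [])) (cong (count (E G z) ℓ₁ +_) (count-++ (E G z) ℓ₂ []))))
      split (≤-reflexive (sym (#-delete-∈ {P = F} h)))
      where
      split : # (Free σ ∩ E G z) + miss z ≤ # (F ∖ ⁅ z ⁆)
      split = #+≤ {P = Free σ ∩ E G z} {nonneighbours G F z} {F ∖ ⁅ z ⁆} (λ x →
        taut 4 (λ g e f q → (g ∧ e ⇛ f) ⇒ (q ⇛ not e) ⇒ 𝟙 (g ∧ e) + 𝟙 (f ∧ not q ∧ not e) ≼ 𝟙 (f ∧ not q)) refl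
          (Free σ x) (E G z x) (F x) (x == z)
          (⇛⁺ {Free σ x ∧ E G z x} (λ k → closed h (∧-left k) (∧-right {Free σ x} k)))
          (⇛⁺ (λ k → not⁺ (subst (λ y → E G z y ≡ false) (==⁻ˢ k) (E-irr G z)))))

    -- Of at most 29 vertices 4 are terminals still to be joined, and F has at most half of the free
    -- ones.
    size : # F + # F + (length ℓ₁ + length ℓ₂) ≤ 25
    size = linear 5 (λ f g l a b → 1 · f ⊕ f ≼ g ⇒ 1 · g ⊕ l ≼ con 29 ⇒ 1 · (a ⊕ b) ⊕ con 4 ≼ l ⇒
        ⊢ (f ⊕ f) ⊕ (a ⊕ b) ≼ con 25) refl
      (# F) (# (Free σ)) (length (L σ)) (length ℓ₁) (length ℓ₂) small (free-size σ)
      (≤-reflexive (sym (trans (length-L σ) (cong₂ _+_ lengths (cong (2 *_) two)))))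
      where
      lengths : length (ℓ₁ ++ (ℓ₂ ++ [])) ≡ length ℓ₁ + length ℓ₂
      lengths = trans (List.length-++ ℓ₁) (cong (length ℓ₁ +_) (cong length (List.++-identityʳ ℓ₂)))

    F⊆V : F ⊆ V
    F⊆V h = W⊆V (∧-left (F⊆Free h))

    -- Fifteen neighbours, less three on each route and one in each of two pairs, leave seven
    -- besides z.
    8≤F : 8 ≤ # F
    8≤F = let z , h = nonempty in
      linear 6 (λ f m a b M M′ → 1 · con 14 ⊕ m ≼ f ⊕ (a ⊕ b) ⇒ 1 · a ≼ M ⇒ 1 · b ≼ M′ ⇒ 1 · M ≼ con 3 ⇒
          1 · M′ ≼ con 3 ⇒ ⊢ con 8 ≼ f) refl
        (# F) (miss z) (count (E G z) ℓ₁) (count (E G z) ℓ₂) π₁.M π₂.M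
        (miss-bound h) (π₁.seen (F⊆Free h)) (π₂.seen (F⊆Free h)) π₁.M≤3 π₂.M≤3

    whole : (∀ {z} → z ∈ F → miss z ≤ 0) → BigClique G V
    whole none = F , F⊆V , 8≤F , clique
      where
      clique : Clique G F
      clique {x} {y} p q n with bool (E G x y)
      ... | inj₁ e = e
      ... | inj₂ e = ⊥-elim (<⇒≱ (#-pos {P = nonneighbours G F x} {y}
              (∧⁺ q (∧⁺ (not⁺ (≢⇒≠ (λ r → n (sym r)))) (not⁺ e)))) (none p))

    -- Doubling `miss-bound` and adding `size` yields 28 + 2 miss ≤ 25 + 4, so nothing is missed.
    long : π₁.M + π₂.M + (π₁.M + π₂.M) ≤ length ℓ₁ + length ℓ₂ + 4 → BigClique G V
    long h = whole (λ {z} k → half-1 (miss z) (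
      linear 8 (λ f m a b M M′ q q′ → 2 · con 14 ⊕ m ≼ f ⊕ (a ⊕ b) ⇒ 2 · a ≼ M ⇒ 2 · b ≼ M′ ⇒
          1 · (f ⊕ f) ⊕ (q ⊕ q′) ≼ con 25 ⇒
          1 · (M ⊕ M′) ⊕ (M ⊕ M′) ≼ (q ⊕ q′) ⊕ con 4 ⇒ ⊢ m ⊕ m ≼ con 1) refl
        (# F) (miss z) (count (E G z) ℓ₁) (count (E G z) ℓ₂) π₁.M π₂.M (length ℓ₁) (length ℓ₂)
        (miss-bound k) (π₁.seen (F⊆Free k)) (π₂.seen (F⊆Free k)) size h))

    used∉F : ∀ {j} → j ∈ mem ℓ₁ ⊎ j ∈ mem ℓ₂ → j ∈ V × F j ≡ false × E G v j ≡ true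
    used∉F {j} h = W⊆V j∈W , ¬true⇒false (λ k → true≢false j∈L (not⁻ (∧-right {W j} (F⊆Free k)))) , v~W j∈W
      where
      j∈used : j ∈ mem ℓ₁ ⊎ j ∈ mem ℓ₂ → j ∈ mem (ℓ₁ ++ (ℓ₂ ++ []))
      j∈used (inj₁ k) = mem-++ˡ ℓ₁ (ℓ₂ ++ []) k
      j∈used (inj₂ k) = mem-++ʳ ℓ₁ (ℓ₂ ++ []) (mem-++ˡ ℓ₂ [] k)
      j∈L : j ∈ mem (L σ)
      j∈L = mem-++ˡ (ℓ₁ ++ (ℓ₂ ++ [])) (flat rest) (j∈used h)
      j∈W : j ∈ W
      j∈W = State.inside σ j∈L

    big-clique : BigClique G V
    big-clique = cases π₁.short π₂.short
      where
      cases : _ → _ → BigClique G V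
      cases (inj₁ h) _ = long (linear 4 (λ M M′ q q′ → 1 · M ⊕ M ≼ q ⊕ con 1 ⇒ 1 · M′ ⊕ M′ ≼ q′ ⊕ con 3 ⇒
          ⊢ (M ⊕ M′) ⊕ (M ⊕ M′) ≼ (q ⊕ q′) ⊕ con 4) refl
        π₁.M π₂.M (length ℓ₁) (length ℓ₂) h π₂.2M≤)
      cases (inj₂ _) (inj₁ h) = long (linear 4 (λ M M′ q q′ → 1 · M ⊕ M ≼ q ⊕ con 3 ⇒ 1 · M′ ⊕ M′ ≼ q′ ⊕ con 1 ⇒
          ⊢ (M ⊕ M′) ⊕ (M ⊕ M′) ≼ (q ⊕ q′) ⊕ con 4) refl
        π₁.M π₂.M (length ℓ₁) (length ℓ₂) π₁.2M≤ h)
      cases (inj₂ (j₁ , j₂ , m₁ , m₂ , e₁₂ , bound₁)) (inj₂ (j₃ , j₄ , m₃ , m₄ , e₃₄ , bound₂)) =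
          sizes (<-≤-connex 8 (# F))
        where
        js : ∀ {j} → j ∈ mem (j₁ ∷ j₂ ∷ j₃ ∷ j₄ ∷ []) → j ∈ mem ℓ₁ ⊎ j ∈ mem ℓ₂
        js {j} h with ∨⁻ {j == j₁} h
        ... | inj₁ k = inj₁ (subst (_∈ mem ℓ₁) (==⁻ˢ k) m₁)
        ... | inj₂ h₂ with ∨⁻ {j == j₂} h₂
        ...   | inj₁ k = inj₁ (subst (_∈ mem ℓ₁) (==⁻ˢ k) m₂)
        ...   | inj₂ h₃ with ∨⁻ {j == j₃} h₃
        ...     | inj₁ k = inj₂ (subst (_∈ mem ℓ₂) (==⁻ˢ k) m₃)
        ...     | inj₂ h₄ with ∨⁻ {j == j₄} h₄
        ...       | inj₁ k = inj₂ (subst (_∈ mem ℓ₂) (==⁻ˢ k) m₄)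
        m₁₂ m₃₄ : Fin N → ℕ
        m₁₂ z = 𝟙 (not (E G z j₁)) + 𝟙 (not (E G z j₂))
        m₃₄ z = 𝟙 (not (E G z j₃)) + 𝟙 (not (E G z j₄))
        sizes : 8 < # F ⊎ # F ≤ 8 → BigClique G V
        sizes (inj₁ 9≤F) = near-clique {G = G} {F} {V} {v} {j₁} {j₂} {j₃} {j₄} F⊆V (∨-introʳ {W v} (==⁺ v))
            (¬true⇒false (λ h → true≢false (∧-left (F⊆Free h)) v∉W))
          (λ h → v~W (∧-left (F⊆Free h))) (λ h → used∉F (js h)) e₁₂ e₃₄
          -- The same count with 3 + 3 in place of 4 gives 28 + 2d ≤ 31, where d counts the
          -- nonneighbours in F and the missed ends of both edges.
          (λ {z} k → half-3 (miss z + (m₁₂ z + m₃₄ z)) (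
            linear 10 (λ f m a b c d M M′ q q′ → 2 · con 14 ⊕ m ≼ f ⊕ (a ⊕ b) ⇒ 2 · a ⊕ c ≼ M ⇒ 2 · b ⊕ d ≼ M′ ⇒
                1 · (f ⊕ f) ⊕ (q ⊕ q′) ≼ con 25 ⇒ 1 · M ⊕ M ≼ q ⊕ con 3 ⇒ 1 · M′ ⊕ M′ ≼ q′ ⊕ con 3 ⇒
                ⊢ (m ⊕ (c ⊕ d)) ⊕ (m ⊕ (c ⊕ d)) ≼ con 3) refl
              (# F) (miss z) (count (E G z) ℓ₁) (count (E G z) ℓ₂) (m₁₂ z) (m₃₄ z) π₁.M π₂.M (length ℓ₁) (length ℓ₂)
              (miss-bound k) (bound₁ (F⊆Free k)) (bound₂ (F⊆Free k)) size π₁.2M≤ π₂.2M≤))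
          9≤F
        -- Here 14 + miss ≤ 8 + 3 + 3.
        sizes (inj₂ F≤8) = whole (λ {z} k →
          linear 6 (λ f m a b M M′ → 1 · con 14 ⊕ m ≼ f ⊕ (a ⊕ b) ⇒ 1 · a ≼ M ⇒ 1 · b ≼ M′ ⇒ 1 · M ≼ con 3 ⇒
              1 · M′ ≼ con 3 ⇒ 1 · f ≼ con 8 ⇒ ⊢ m ≼ con 0) refl
            (# F) (miss z) (count (E G z) ℓ₁) (count (E G z) ℓ₂) π₁.M π₂.M
            (miss-bound k) (π₁.seen (F⊆Free k)) (π₂.seen (F⊆Free k)) π₁.M≤3 π₂.M≤3 F≤8)

module Linking {N : ℕ} (G : Graph N) (W : VSet N) (v : Fin N) (v∉W : W v ≡ false)
               (v~W : ∀ {w} → w ∈ W → E G v w ≡ true) (W≤29 : # W ≤ 29) (T : VSet N)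
               (degree : ∀ {w} → w ∈ W → 15 ≤ # (vicinity G W T w))
               (pairs₀ : List (Pair N))
               (T⊆pairs : ∀ {z} → z ∈ T → ∃ λ s → ∃ λ t → (s , t) ∈ₗ pairs₀ × (z ≡ s ⊎ z ≡ t)) where

  open Dense G W v v∉W v~W W≤29 T degree pairs₀ T⊆pairs

  search-join : ∀ {done rest} (σ : State done rest) →
                (∃ λ z → z ∈ Free σ × ∃ λ s → ∃ λ t → ∃ λ rest′ → Pick (s , t) rest rest′ × E G z s ≡ true ×
                    E G z t ≡ true) ⊎
                (∀ {z} → z ∈ Free σ → joins G z rest ≡ false)
  search-join {rest = rest} σ with find (λ z → Free σ z ∧ joins G z rest)
  ... | inj₁ (z , h) = inj₁ (z , ∧-left h , joins-pick G rest (∧-right {Free σ z} h))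
  ... | inj₂ none = inj₂ (λ {z} h → not⁻ (taut 2 (λ a b → not (a ∧ b) ⇒ a ⇒ ! not b) refl (Free σ z)
      (joins G z rest) (not⁺ (none z)) h))

  NextRoute : ∀ {done rest} → State done rest → ℕ → Set
  NextRoute {rest = rest} σ m = ∃ λ s → ∃ λ t → ∃ λ ℓ → ∃ λ rest′ →
    Pick (s , t) rest rest′ × NewRoute σ s t ℓ × (length ℓ ≤ 5 ⊎ (length ℓ ≤ 6 × m + m ≤ # (Free σ)))

  Free⊆V : ∀ {done rest} (σ : State done rest) → Free σ ⊆ V
  Free⊆V σ h = W⊆V (∧-left h)

  -- A free vertex adjacent to both ends of a pair is used at once. Otherwise each free vertex sees
  -- at most one end of every pair, which secures the degrees for `dense-join` between free
  -- neighbours of s and t. Adding s and t turns 3 and 4 into 5 and 6.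
  next-route : ∀ {done s t rest} (σ : State done ((s , t) ∷ rest)) m → 8 ≤ m →
               (∀ {z} → z ∈ Free σ → joins G z ((s , t) ∷ rest) ≡ false → m ≤ suc (# (Free σ ∩ E G z))) →
               # (Free σ) ≤ m + m → length (L σ) ≤ 15 → BigClique G V ⊎ NextRoute σ m
  next-route {done} {s} {t} {rest} σ m 8≤m large small room = decide (search-join σ)
    where
    end : ∀ {x} → x ∈ mem (flat ((s , t) ∷ rest)) → ∃ λ a → a ∈ Free σ × E G x a ≡ true
    end h = terminal-neighbour σ (mem-++ʳ (used done) (flat ((s , t) ∷ rest)) h) room
    near-s : ∃ λ a → a ∈ Free σ × E G s a ≡ true
    near-s = end (∨-introˡ (==⁺ s))
    near-t : ∃ λ b → b ∈ Free σ × E G t b ≡ true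
    near-t = end (∨-introʳ {t == s} (∨-introˡ (==⁺ t)))
    long : ∀ ℓ → length (s ∷ (ℓ ++ t ∷ [])) ≡ 2 + length ℓ
    long ℓ = cong suc (trans (List.length-++ ℓ) (+-comm (length ℓ) 1))
    connect : BigClique G (Free σ) ⊎ Joined G (Free σ) m (proj₁ near-s) (proj₁ near-t) → BigClique G V ⊎ NextRoute σ m
    connect (inj₁ (K , sub , big , clique)) = inj₁ (K , (λ h → Free⊆V σ (sub h)) , big , clique)
    connect (inj₂ (ℓ , c , sub , bound)) = inj₂ (s , t , s ∷ (ℓ ++ t ∷ []) , rest , here ,
      through σ {ℓ = ℓ} (proj₂ (proj₂ near-s)) c sub (E-sym G (proj₂ (proj₂ near-t))) , lengths bound)
      where
      lengths : length ℓ ≤ 3 ⊎ (length ℓ ≤ 4 × m + m ≤ # (Free σ)) → _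
      lengths (inj₁ h)       = inj₁ (≤-respˡ (sym (long ℓ)) (s≤s (s≤s h)))
      lengths (inj₂ (h , k)) = inj₂ (≤-respˡ (sym (long ℓ)) (s≤s (s≤s h)) , k)
    decide : _ ⊎ (∀ {z} → z ∈ Free σ → joins G z ((s , t) ∷ rest) ≡ false) → BigClique G V ⊎ NextRoute σ m
    decide (inj₁ (z , z∈ , a , b , rest′ , p , e , e′)) =
      inj₂ (a , b , a ∷ z ∷ b ∷ [] , rest′ , p , via σ z∈ e e′ , inj₁ (s≤s (s≤s (s≤s z≤n))))
    decide (inj₂ none) = connect (dense-join m (proj₁ (proj₂ near-s)) (proj₁ (proj₂ near-t)) 8≤m (λ h →
        large h (none h)) small)

  shorten : ∀ {s t ℓ done rest} (σ : State (((s , t) , ℓ) ∷ done) rest) → Shorter G (Free σ) s ℓ t →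
            ∃ λ ℓ′ → length ℓ′ < length ℓ × State (((s , t) , ℓ′) ∷ done) rest
  shorten {ℓ = ℓ} σ (z , z∈ , ℓ′ , c , less , sub) with erase c
  ... | ℓ″ , c″ , d , le , sub″ = ℓ″ , ≤-<-trans le less , replace-route σ c″ d (λ h → classify (∨⁻ (sub (sub″ h))))
    where
    classify : ∀ {x} → (x == z ≡ true) ⊎ x ∈ mem ℓ → x ∈ Free σ ⊎ x ∈ mem ℓ
    classify (inj₁ q) = inj₁ (subst (_∈ Free σ) (==⁻ˢ q) z∈)
    classify (inj₂ q) = inj₂ q

  route-profile : ∀ {s t ℓ done rest} (σ : State (((s , t) , ℓ) ∷ done) rest) → Shorter G (Free σ) s ℓ t ⊎
      Profile G (Free σ) ℓ
  route-profile σ = let s≢t , c = State.chains σ (here refl) in profile s≢t c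

  Free-swap : ∀ {p q : Pair N} {ℓ₁ ℓ₂ done rest} (σ : State ((p , ℓ₁) ∷ (q , ℓ₂) ∷ done) rest) →
      Free (swap-routes σ) ⊆ Free σ
  Free-swap {p} {q} {ℓ₁} {ℓ₂} {done} {rest} σ {z} h = ∧⁺ (∧-left h) (not⁺ (¬true⇒false (λ k →
    true≢false (swap-mem ℓ₁ ℓ₂ (used done) (flat rest) k) (not⁻ (∧-right {W z} h)))))

  profile-⊆ : ∀ {F F′ : VSet N} {ℓ} → F′ ⊆ F → Profile G F ℓ → Profile G F′ ℓ
  profile-⊆ s π = record
    { M = M ; M≤3 = M≤3 ; 2M≤ = 2M≤ ; seen = λ h → seen (s h)
    ; short = [ inj₁ , (λ (x , y , p , q , e , b) → inj₂ (x , y , p , q , e , λ {z} h → b {z} (s h))) ]′ short }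
    where open Profile π

  -- Routes are shortened until both have profiles; n bounds their total length. The bound 11 stems
  -- from routes of 5 and 6 vertices and, with 4 remaining terminals, reaches exactly the 15 up to
  -- which every terminal has a free neighbour.
  two-routes : ∀ n {p q : Pair N} {ℓ₁ ℓ₂ r₃ r₄} → State ((p , ℓ₁) ∷ (q , ℓ₂) ∷ []) (r₃ ∷ r₄ ∷ []) →
               length ℓ₁ + length ℓ₂ ≤ n → length ℓ₁ + length ℓ₂ ≤ 11 → Outcome
  two-routes n {p} {q} {ℓ₁} {ℓ₂} {s , t} {r₄} σ size bound =
      profiles (route-profile σ) (route-profile (swap-routes σ))
    where
    rest : List (Pair N)
    rest = (s , t) ∷ r₄ ∷ []
    room : length (L σ) ≤ 15
    room = ≤-respˡ (sym (trans (length-L σ) (cong (_+ 4) (trans (List.length-++ ℓ₁)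
        (cong (length ℓ₁ +_) (cong length (List.++-identityʳ ℓ₂)))))))
      (+-monoˡ-≤ 4 bound)
    again : ∀ n {p q : Pair N} {k₁ k₂} → State ((p , k₁) ∷ (q , k₂) ∷ []) rest →
        length k₁ + length k₂ < length ℓ₁ + length ℓ₂ →
            length ℓ₁ + length ℓ₂ ≤ n → Outcome
    again zero    τ less size = ⊥-elim (n≮0 (<-≤-trans less size))
    again (suc n) τ less size = two-routes n τ (≤-pred (<-≤-trans less size)) (≤-trans (<⇒≤ less) bound)
    near-s : ∃ λ a → a ∈ Free σ × E G s a ≡ true
    near-s = terminal-neighbour σ (mem-++ʳ (used ((p , ℓ₁) ∷ (q , ℓ₂) ∷ [])) (flat rest) (∨-introˡ (==⁺ s))) room
    near-t : ∃ λ b → b ∈ Free σ × E G t b ≡ true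
    near-t = terminal-neighbour σ (mem-++ʳ (used ((p , ℓ₁) ∷ (q , ℓ₂) ∷ [])) (flat rest)
        (∨-introʳ {t == s} (∨-introˡ (==⁺ t)))) room
    a b : Fin N
    a = proj₁ near-s
    b = proj₁ near-t
    Component : Set
    Component = ∃ λ A → A ⊆ Free σ × a ∈ A × (∀ {x y} → x ∈ A → y ∈ Free σ → E G x y ≡ true → y ∈ A) ×
                (∀ {x} → x ∈ A → Walk G (_∈ Free σ) a x)
    separated : Profile G (Free σ) ℓ₁ → Profile G (Free σ) ℓ₂ → (∀ {z} → z ∈ Free σ → joins G z rest ≡ false) →
        Component → Outcome
    separated π₁ π₂ none (A , A⊆ , a∈A , closed , reach) = inside? (bool (A b))
      where
      B : VSet N
      B = Free σ ∖ A
      halves : # A + # B ≤ # (Free σ)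
      halves = #+≤ {P = A} {B} {Free σ} (λ x →
        taut 2 (λ f a → (a ⇛ f) ⇒ 𝟙 a + 𝟙 (f ∧ not a) ≼ 𝟙 f) refl (Free σ x) (A x) (⇛⁺ (A⊆ {x})))
      inside? : (A b ≡ true) ⊎ (A b ≡ false) → Outcome
      inside? (inj₁ b∈A) = let ℓ , c , sub = walk-chain (reach b∈A) in
        finish σ refl here (through σ {ℓ = ℓ} (proj₂ (proj₂ near-s)) c sub (E-sym G (proj₂ (proj₂ near-t))))
      -- The component of a and its complement among the free vertices are both closed, so the
      -- smaller of them meets the requirements of `Closed`.
      inside? (inj₂ b∉A) = smaller (≤-total (# A) (# B))
        where
        smaller : # A ≤ # B ⊎ # B ≤ # A → Outcome
        smaller (inj₁ h) = inj₁ (Closed.big-clique σ refl π₁ π₂ none A A⊆ closed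
          (≤-trans (+-monoʳ-≤ (# A) h) halves) (a , a∈A))
        smaller (inj₂ h) = inj₁ (Closed.big-clique σ refl π₁ π₂ none B ∧-left
          (λ {x} {y} x∈ y∈ e → ∧⁺ y∈ (not⁺ (¬true⇒false (λ k →
              true≢false (closed k (∧-left x∈) (E-sym G e)) (not⁻ (∧-right {Free σ x} x∈))))))
          (≤-trans (+-monoˡ-≤ (# B) h) halves) (b , ∧⁺ (proj₁ (proj₂ near-t)) (not⁺ b∉A)))
    joined? : Profile G (Free σ) ℓ₁ → Profile G (Free σ) ℓ₂ → _ ⊎ (∀ {z} → z ∈ Free σ → joins G z rest ≡ false) →
        Outcome
    joined? π₁ π₂ (inj₁ (z , z∈ , _ , _ , _ , pick , e , e′)) = finish σ refl pick (via σ z∈ e e′)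
    joined? π₁ π₂ (inj₂ none) = separated π₁ π₂ none (component (proj₁ (proj₂ near-s)))
    profiles : _ → _ → Outcome
    profiles (inj₁ h) _ = let k , less , τ = shorten σ h in again n τ (+-monoˡ-< (length ℓ₂) less) size
    profiles (inj₂ _) (inj₁ h) = let k , less , τ = shorten (swap-routes σ) h in
      again n τ (<-≤-trans (+-monoˡ-< (length ℓ₁) less) (≤-reflexive (+-comm (length ℓ₂) (length ℓ₁)))) size
    profiles (inj₂ π₁) (inj₂ π₂) = joined? π₁ (profile-⊆ (Free-swap (swap-routes σ)) π₂) (search-join σ)

  one-route : ∀ n {p : Pair N} {ℓ r₂ r₃ r₄} → State ((p , ℓ) ∷ []) (r₂ ∷ r₃ ∷ r₄ ∷ []) → length ℓ ≤ n →
      length ℓ ≤ 5 → Outcome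
  one-route n {p} {ℓ} {r₂} {r₃} {r₄} σ size ≤5 = decide (route-profile σ)
    where
    rest : List (Pair N)
    rest = r₂ ∷ r₃ ∷ r₄ ∷ []
    length-used : length (L σ) ≡ length ℓ + 6
    length-used = trans (length-L σ) (cong (λ k → length k + 6) (List.++-identityʳ ℓ))
    again : ∀ n {k} → State ((p , k) ∷ []) rest → length k < length ℓ → length ℓ ≤ n → Outcome
    again zero    τ less size = ⊥-elim (n≮0 (<-≤-trans less size))
    again (suc n) τ less size = one-route n τ (≤-pred (<-≤-trans less size)) (≤-trans (<⇒≤ less) ≤5)
    continue : ∀ m → BigClique G V ⊎ NextRoute σ m → Outcome
    continue m (inj₁ K) = inj₁ K
    continue m (inj₂ (s , t , k , rest′ , pick , new , bound)) with erase-new σ new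
    ... | k′ , new′ , d , le = step₂ rest′ (pick-length pick) (add-route σ pick new′ d)
      where
      k′≤6 : length k′ ≤ 6
      k′≤6 = ≤-trans le ([ m≤n⇒m≤1+n , proj₁ ]′ bound)
      step₂ : ∀ rest′ → 3 ≡ suc (length rest′) → State (((s , t) , k′) ∷ (p , ℓ) ∷ []) rest′ → Outcome
      step₂ (_ ∷ _ ∷ []) _ τ = two-routes _ τ ≤-refl (+-mono-≤ k′≤6 ≤5)
    decide : _ → Outcome
    decide (inj₁ h) = let k , less , τ = shorten σ h in again n τ less size
    decide (inj₂ π) = continue m (next-route σ m 8≤m large small room)
      where
      open Profile π
      m : ℕ
      -- A free vertex keeps 15 - 3 - M free neighbours, so its ball has 13 - M vertices. As the
      -- route has at least 2M - 3 vertices, at most 29 - 6 - (2M - 3) = 2m are free.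
      m = 13 ∸ M
      m+M : m + M ≡ 13
      m+M = m∸n+n≡m (≤-trans M≤3 (s≤s (s≤s (s≤s z≤n))))
      8≤m : 8 ≤ m
      8≤m = linear 2 (λ m M → 1 · con 13 ≼ m ⊕ M ⇒ 1 · M ≼ con 3 ⇒ ⊢ con 8 ≼ m) refl m M (≤-reflexive (sym m+M)) M≤3
      large : ∀ {z} → z ∈ Free σ → joins G z rest ≡ false → m ≤ suc (# (Free σ ∩ E G z))
      large {z} h j = linear 5 (λ m M n c c′ → 1 · con 15 ≼ n ⊕ (c′ ⊕ con 3) ⇒ 1 · c′ ≼ c ⇒ 1 · c ≼ M ⇒
          1 · m ⊕ M ≼ con 13 ⇒ ⊢ m ≼ con 1 ⊕ n) refl
        m M (# (Free σ ∩ E G z)) (count (E G z) ℓ) (count (E G z) (ℓ ++ []))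
        (free-degree σ h j) (≤-reflexive (cong (count (E G z)) (List.++-identityʳ ℓ))) (seen h) (≤-reflexive m+M)
      small : # (Free σ) ≤ m + m
      small = linear 5 (λ m M f l q → 1 · f ⊕ l ≼ con 29 ⇒ 1 · q ⊕ con 6 ≼ l ⇒ 1 · M ⊕ M ≼ q ⊕ con 3 ⇒
          2 · con 13 ≼ m ⊕ M ⇒ ⊢ f ≼ m ⊕ m) refl
        m M (# (Free σ)) (length (L σ)) (length ℓ) (free-size σ) (≤-reflexive (sym length-used)) 2M≤
            (≤-reflexive (sym m+M))
      room : length (L σ) ≤ 15
      room = ≤-respˡ (sym length-used) (≤-trans (+-monoˡ-≤ 6 ≤5) (m≤m+n 11 4))

  link-pairs : Distinct (flat pairs₀) → mem (flat pairs₀) ⊆ W → length pairs₀ ≡ 4 → Outcome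
  link-pairs distinct₀ inside₀ four = begin pairs₀ four
      (record { chains = λ () ; distinct = distinct₀ ; inside = inside₀ ; complete = inj₂ })
    where
    begin : ∀ rest → length rest ≡ 4 → State [] rest → Outcome
    -- A free vertex sees at most one end of each of four pairs, so its ball has 15 - 4 + 1 = 12
    -- vertices. Two disjoint balls would exceed the 21 free vertices, which limits the first route
    -- to 5.
    begin (r₁ ∷ r₂ ∷ r₃ ∷ r₄ ∷ []) _ σ = continue (next-route σ 12 (m≤m+n 8 4)
        (λ {z} h j → linear 1 (λ n → 1 · con 15 ≼ n ⊕ con 4 ⇒ ⊢ con 12 ≼ con 1 ⊕ n) refl (# (Free σ ∩ E G z))
            (free-degree σ h j))
        (≤-trans free≤21 (m≤m+n 21 3)) (m≤m+n 8 7))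
      where
      free≤21 : # (Free σ) ≤ 21
      free≤21 = linear 1 (λ f → 1 · f ⊕ con 8 ≼ con 29 ⇒ ⊢ f ≼ con 21) refl (# (Free σ)) (free-size σ)
      continue : BigClique G V ⊎ NextRoute σ 12 → Outcome
      continue (inj₁ K) = inj₁ K
      continue (inj₂ (_ , _ , _ , _ , _ , _ , inj₂ (_ , large))) = ⊥-elim (<⇒≱ (≤-trans (m≤m+n 22 2) large) free≤21)
      continue (inj₂ (s , t , k , rest′ , pick , new , inj₁ k≤5)) with erase-new σ new
      ... | k′ , new′ , d , le = step₁ rest′ (pick-length pick) (add-route σ pick new′ d)
        where
        step₁ : ∀ rest′ → 4 ≡ suc (length rest′) → State (((s , t) , k′) ∷ []) rest′ → Outcome
        step₁ (_ ∷ _ ∷ _ ∷ []) _ τ = one-route _ τ ≤-refl (≤-trans le k≤5)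

-- From labels to pairs

big-clique? : ∀ (G : Graph N) V → BigClique G V ⊎ ¬ BigClique G V
big-clique? G V with search (λ x a _ → a ⇛ V x) (λ x y a _ a′ _ → a ⇛ a′ ⇛ not (x == y) ⇛ E G x y) (λ A _ →
    8 ℕ.≤? # A)
                            (λ a _ → subst (8 ≤_) (#-cong a))
... | inj₁ (K , _ , inside , adjacent , big) = inj₁ (K , (λ {x} → ⇛⁻ (inside x)) , big ,
        λ {x} {y} p q n → ⇛⁻ (⇛⁻ (⇛⁻ (adjacent x y) p) q) (not⁺ (≢⇒≠ n)))
... | inj₂ none = inj₂ λ (K , sub , big , clique) → none K ∅ ((λ x → ⇛⁺ sub) ,
        (λ x y → ⇛⁺ (λ p → ⇛⁺ (λ q → ⇛⁺ (λ n → clique p q (λ { refl → true≢false (==⁺ x) (not⁻ n) }))))) , big)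

routable-clique : ∀ {G : Graph N} {K T} → Clique G K → T ⊆ K → Routable G K T
routable-clique {G = G} {K} {T} clique T⊆K l _ = l , walk
  where
  walk : ∀ {x y} → x ∈ T → y ∈ T → l x ≡ l y → Walk G (λ z → z ∈ K × l z ≡ l x) x y
  walk {x} {y} p q e with x Fin.≟ y
  ... | yes refl = stop (T⊆K p , refl)
  ... | no n     = step (T⊆K p , refl) (clique (T⊆K p) (T⊆K q) n) (stop (T⊆K q , sym e))

enlarge : ∀ {W : VSet N} k P → P ⊆ W → # P + k ≤ # W → ∃ λ Q → P ⊆ Q × Q ⊆ W × # Q ≡ # P + k
enlarge zero P s h = P , (λ p → p) , s , sym (+-identityʳ _)
enlarge {W = W} (suc k) P s h = extend (#-size<⇒∃ {P = P} {Q = W}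
    (≤-trans (s≤s (m≤m+n (# P) k)) (≤-respˡ (+-suc (# P) k) h)))
  where
  extend : ∃ (_∈ W ∖ P) → ∃ λ Q → P ⊆ Q × Q ⊆ W × # Q ≡ # P + suc k
  extend (x , x∈) = let Q , a , b , c = enlarge k (P ∪ ⁅ x ⁆) (insert-⊆ {P = P} {V = W} s (∧-left x∈)) (≤-respˡ (sym shift) h)
    in Q , (λ p → a (∨-introˡ p)) , b , trans c shift
    where
    one-more : # (P ∪ ⁅ x ⁆) ≡ suc (# P)
    one-more = ≤-antisym (≤-trans (#-∪ P ⁅ x ⁆) (≤-respʳ (+-comm (# P) 1) (+-monoʳ-≤ (# P) (#-⁅⁆ x))))
                           (#-insert (not⁻ (∧-right {W x} x∈)))
    shift : # (P ∪ ⁅ x ⁆) + k ≡ # P + suc k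
    shift = trans (cong (_+ k) one-more) (sym (+-suc (# P) k))

flat-++ : ∀ (ps qs : List (Pair N)) → flat (ps ++ qs) ≡ flat ps ++ flat qs
flat-++ []             qs = refl
flat-++ ((s , t) ∷ ps) qs = cong (λ k → s ∷ t ∷ k) (flat-++ ps qs)

pair-up : List (Fin N) → List (Pair N)
pair-up (x ∷ y ∷ ℓ) = (x , y) ∷ pair-up ℓ
pair-up _           = []

odd≢even : ∀ p q → p + p + 1 ≡ q + q → ⊥
odd≢even zero    (suc q) e = 0≢1+n (trans (suc-injective e) (+-suc q q))
odd≢even (suc p) (suc q) e = odd≢even p q (suc-injective (suc-injective
  (trans (cong (λ k → suc (k + 1)) (sym (+-suc p p))) (trans e (cong suc (+-suc q q))))))

halve : ∀ p q → p + p ≡ q + q → p ≡ q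
halve zero    zero    e = refl
halve (suc p) (suc q) e = cong suc (halve p q (suc-injective (suc-injective
  (trans (cong suc (sym (+-suc p p))) (trans e (cong suc (+-suc q q)))))))

-- The number p stands for couples formed before. Since the total is even, the list never ends in a
-- single vertex.
pair-up-even : ∀ (ℓ : List (Fin N)) p q → p + p + length ℓ ≡ q + q → flat (pair-up ℓ) ≡ ℓ × p + length (pair-up ℓ) ≡ q
pair-up-even []          p q e = refl , trans (+-identityʳ p) (halve p q (trans (sym (+-identityʳ (p + p))) e))
pair-up-even (x ∷ [])    p q e = ⊥-elim (odd≢even p q e)
pair-up-even (x ∷ y ∷ ℓ) p q e with pair-up-even ℓ (suc p) q (trans shift e)
  where
  shift : suc p + suc p + length ℓ ≡ p + p + suc (suc (length ℓ))
  shift = trans (cong (λ k → suc (k + length ℓ)) (+-suc p p))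
      (sym (trans (+-suc (p + p) (suc (length ℓ))) (cong suc (+-suc (p + p) (length ℓ)))))
... | a , b = cong (λ k → x ∷ y ∷ k) a , trans (+-suc p _) b

record Matching (P : VSet N) (l : Fin N → ℕ) : Set where
  field
    couples  : List (Pair N)
    singles  : List (Fin N)
    size     : length couples + length couples + length singles ≡ # P
    distinct : Distinct (flat couples ++ singles)
    members⁺ : P ⊆ mem (flat couples ++ singles)
    members⁻ : mem (flat couples ++ singles) ⊆ P
    matched  : ∀ {x y} → x ∈ P → y ∈ P → x ≢ y → l x ≡ l y → (x , y) ∈ₗ couples ⊎ (y , x) ∈ₗ couples

-- Greedy: a vertex has at most one partner, so once a couple is removed, its label does not occur
-- any more.
matching : ∀ n (P : VSet N) l → AtMostTwice P l → # P ≤ n → Matching P l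
matching {N} n P l twice size≤n with find P
... | inj₂ none = record
  { couples = [] ; singles = [] ; size = sym (#-empty {P = P} none) ; distinct = λ _ → z≤n
  ; members⁺ = λ {x} p → absurd p (none x) ; members⁻ = λ ()
  ; matched = λ {x} p → absurd p (none x) }
matching zero P l twice size≤n | inj₁ (x , x∈P) = ⊥-elim (<⇒≱ (#-pos {P = P} x∈P) size≤n)
matching {N} (suc n) P l twice size≤n | inj₁ (x , x∈P) = choose (find (λ y → P′ y ∧ does (l x ℕ.≟ l y)))
  where
  P′ : VSet N
  P′ = P ∖ ⁅ x ⁆
  #P : # P ≡ suc (# P′)
  #P = #-delete-∈ {P = P} x∈P
  P′≤n : # P′ ≤ n
  P′≤n = ≤-pred (≤-respˡ #P size≤n)
  choose : ∃ (_∈ λ y → P′ y ∧ does (l x ℕ.≟ l y)) ⊎ (∀ y → P′ y ∧ does (l x ℕ.≟ l y) ≡ false) → Matching P l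
  choose (inj₂ none) = record
    { couples = M.couples ; singles = x ∷ M.singles
    ; size = trans (+-suc _ _) (trans (cong suc M.size) (sym #P))
    ; distinct = λ z → ≤-respˡ (sym (move z)) (distinct-∷ {ℓ = flat M.couples ++ M.singles}
        (¬true⇒false (λ h → proj₂ (∖⁅⁆⁻ {P = P} (M.members⁻ h)) refl)) M.distinct z)
    ; members⁺ = λ {z} h → mult⇒mem (flat M.couples ++ (x ∷ M.singles)) {z}
        (≤-respʳ (sym (move z)) (into z h (z Fin.≟ x)))
    ; members⁻ = λ {z} h → out z (∨⁻ {z == x} (mult⇒mem (x ∷ (flat M.couples ++ M.singles)) {z}
        (≤-respʳ (move z) (mem⇒mult {ℓ = flat M.couples ++ (x ∷ M.singles)} h))))
    ; matched = coupled }
    where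
    module M = Matching (matching n P′ l (λ p q r → twice (∧-left p) (∧-left q) (∧-left r)) P′≤n)
    alone : ∀ {y} → y ∈ P → y ≢ x → l x ≡ l y → ⊥
    alone {y} p n e = true≢false (∧⁺ (∈-∖⁅⁆ {P = P} p n) (does⁺ (l x ℕ.≟ l y) e)) (none y)
    move : ∀ z → mult (flat M.couples ++ (x ∷ M.singles)) z ≡ mult (x ∷ (flat M.couples ++ M.singles)) z
    move z = trans (count-++ _ (flat M.couples) (x ∷ M.singles)) (trans (+-comm _ (𝟙 (z == x) + mult M.singles z))
      (trans (+-assoc (𝟙 (z == x)) _ _) (cong (𝟙 (z == x) +_)
          (trans (+-comm _ (mult (flat M.couples) z)) (sym (count-++ _ (flat M.couples) M.singles))))))
    into : ∀ z → z ∈ P → Dec (z ≡ x) → 1 ≤ mult (x ∷ (flat M.couples ++ M.singles)) z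
    into z h (yes refl) = mem⇒mult {ℓ = x ∷ (flat M.couples ++ M.singles)} (∨-introˡ (==⁺ x))
    into z h (no n)     = mem⇒mult {ℓ = x ∷ (flat M.couples ++ M.singles)}
        (∨-introʳ {z == x} (M.members⁺ (∈-∖⁅⁆ {P = P} h n)))
    out : ∀ z → (z == x ≡ true) ⊎ z ∈ mem (flat M.couples ++ M.singles) → z ∈ P
    out z (inj₁ q) = subst (_∈ P) (==⁻ˢ q) x∈P
    out z (inj₂ q) = ∧-left (M.members⁻ q)
    coupled : ∀ {a b} → a ∈ P → b ∈ P → a ≢ b → l a ≡ l b → (a , b) ∈ₗ M.couples ⊎ (b , a) ∈ₗ M.couples
    coupled {a} {b} p q n e with a Fin.≟ x | b Fin.≟ x
    ... | yes refl | _        = ⊥-elim (alone q (λ r → n (sym r)) e)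
    ... | no m     | yes refl = ⊥-elim (alone p m (sym e))
    ... | no m     | no m′    = M.matched (∈-∖⁅⁆ {P = P} p m) (∈-∖⁅⁆ {P = P} q m′) n e
  choose (inj₁ (y , h)) = record
    { couples = (x , y) ∷ M.couples ; singles = M.singles
    ; size = trans (cong (λ k → suc (k + length M.singles)) (+-suc _ _)) (trans (cong (λ k → suc (suc k)) M.size)
               (sym (trans #P (cong suc (#-delete-∈ {P = P′} {y} y∈P′)))))
    ; distinct = distinct-∷ {ℓ = y ∷ (flat M.couples ++ M.singles)}
        (¬true⇒false (λ k → bad-x (∨⁻ {x == y} k)))
        (distinct-∷ {ℓ = flat M.couples ++ M.singles} (¬true⇒false (λ k →
            proj₂ (∖⁅⁆⁻ {P = P′} (M.members⁻ k)) refl)) M.distinct)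
    ; members⁺ = λ {z} k → into z k (z Fin.≟ x) (z Fin.≟ y)
    ; members⁻ = λ {z} k → out z (∨⁻ {z == x} k)
    ; matched = coupled }
    where
    y∈P′ : y ∈ P′
    y∈P′ = ∧-left h
    y∈P : y ∈ P
    y∈P = ∧-left y∈P′
    y≢x : y ≢ x
    y≢x = proj₂ (∖⁅⁆⁻ {P = P} y∈P′)
    lx≡ly : l x ≡ l y
    lx≡ly = does⁻ (l x ℕ.≟ l y) (∧-right {P′ y} h)
    P″ : VSet N
    P″ = P′ ∖ ⁅ y ⁆
    module M = Matching (matching n P″ l (λ p q r → twice (∧-left (∧-left p)) (∧-left (∧-left q)) (∧-left (∧-left r)))
      (≤-trans (#-mono {P = P″} {Q = P′} ∧-left) P′≤n))
    bad-x : (x == y ≡ true) ⊎ x ∈ mem (flat M.couples ++ M.singles) → ⊥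
    bad-x (inj₁ q) = y≢x (==⁻ˢ q)
    bad-x (inj₂ q) = proj₂ (∖⁅⁆⁻ {P = P} (∧-left (M.members⁻ q))) refl
    into : ∀ z → z ∈ P → Dec (z ≡ x) → Dec (z ≡ y) → z ∈ mem (x ∷ y ∷ (flat M.couples ++ M.singles))
    into z k (yes refl) _          = ∨-introˡ (==⁺ x)
    into z k (no _)     (yes refl) = ∨-introʳ {y == x} (∨-introˡ (==⁺ y))
    into z k (no a)     (no b)     = ∨-introʳ {z == x} (∨-introʳ {z == y}
        (M.members⁺ (∈-∖⁅⁆ {P = P′} (∈-∖⁅⁆ {P = P} k a) b)))
    out : ∀ z → (z == x ≡ true) ⊎ z ∈ mem (y ∷ (flat M.couples ++ M.singles)) → z ∈ P
    out z (inj₁ q) = subst (_∈ P) (==⁻ˢ q) x∈P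
    out z (inj₂ q) with ∨⁻ {z == y} q
    ... | inj₁ r = subst (_∈ P) (==⁻ˢ r) y∈P
    ... | inj₂ r = ∧-left (∧-left (M.members⁻ r))
    third : ∀ {b} → b ∈ P → b ≢ x → l x ≡ l b → b ≡ y
    third p n e with twice x∈P y∈P p lx≡ly (trans (sym lx≡ly) e)
    ... | inj₁ r        = ⊥-elim (y≢x (sym r))
    ... | inj₂ (inj₁ r) = sym r
    ... | inj₂ (inj₂ r) = ⊥-elim (n (sym r))
    coupled : ∀ {a b} → a ∈ P → b ∈ P → a ≢ b → l a ≡ l b → (a , b) ∈ₗ ((x , y) ∷ M.couples) ⊎
        (b , a) ∈ₗ ((x , y) ∷ M.couples)
    coupled {a} {b} p q n e with a Fin.≟ x | b Fin.≟ x
    ... | yes refl | _        = inj₁ (here (cong (x ,_) (third q (λ r → n (sym r)) e)))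
    ... | no m     | yes refl = inj₂ (here (cong (x ,_) (third p m (sym e))))
    ... | no m     | no m′ with a Fin.≟ y | b Fin.≟ y
    ...   | yes refl | _ = ⊥-elim (n (sym (third q m′ (trans lx≡ly e))))
    ...   | no _ | yes refl = ⊥-elim (n (third p m (trans lx≡ly (sym e))))
    ...   | no k | no k′ with M.matched (∈-∖⁅⁆ {P = P′} (∈-∖⁅⁆ {P = P} p m) k)
        (∈-∖⁅⁆ {P = P′} (∈-∖⁅⁆ {P = P} q m′) k′) n e
    ...     | inj₁ r = inj₁ (there r)
    ...     | inj₂ r = inj₂ (there r)

partner-unique : ∀ {ps : List (Pair N)} {s t t′} → Distinct (flat ps) → (s , t) ∈ₗ ps → (s , t′) ∈ₗ ps → t ≡ t′
partner-unique d (here refl) (here refl) = refl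
partner-unique {ps = (s , t) ∷ ps} d (here refl) (there p) =
  absurd (∨-introʳ {s == t} (proj₁ (flat-∈ p))) (distinct-head {ℓ = t ∷ flat ps} d)
partner-unique {ps = (s , t) ∷ ps} d (there p) (here refl) =
  absurd (∨-introʳ {s == t} (proj₁ (flat-∈ p))) (distinct-head {ℓ = t ∷ flat ps} d)
partner-unique {ps = (s , t) ∷ ps} d (there p) (there q) =
  partner-unique (distinct-tail {x = t} {ℓ = flat ps} (distinct-tail {x = s} {ℓ = t ∷ flat ps} d)) p q

flat-∈⁻ : ∀ (ps : List (Pair N)) {z} → z ∈ mem (flat ps) → ∃ λ s → ∃ λ t → (s , t) ∈ₗ ps × (z ≡ s ⊎ z ≡ t)
flat-∈⁻ ((s , t) ∷ ps) {z} h with ∨⁻ {z == s} h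
... | inj₁ p = s , t , here refl , inj₁ (==⁻ p)
... | inj₂ q with ∨⁻ {z == t} q
...   | inj₁ p = s , t , here refl , inj₂ (==⁻ p)
...   | inj₂ p with flat-∈⁻ ps p
...     | a , b , r , e = a , b , there r , e

∈ₗ-++ˡ : ∀ {p : Pair N} {ps} qs → p ∈ₗ ps → p ∈ₗ (ps ++ qs)
∈ₗ-++ˡ qs (here e)  = here e
∈ₗ-++ˡ qs (there p) = there (∈ₗ-++ˡ qs p)

-- Eight terminals are split into four pairs; unmatched terminals are paired arbitrarily.
route-eight : ∀ {G : Graph N} {W v T} → W v ≡ false → (∀ {w} → w ∈ W → E G v w ≡ true) → # W ≤ 29 →
              (∀ {w} → w ∈ W → 15 ≤ # (vicinity G W T w)) →
              ¬ BigClique G (W ∪ ⁅ v ⁆) → T ⊆ W → # T ≡ 8 → Routable G (W ∪ ⁅ v ⁆) T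
route-eight {N} {G} {W} {v} {T} v∉W v~W W≤29 degree none T⊆W eight l twice = outcome
    (Linking.link-pairs G W v v∉W v~W W≤29 T degree pairs₀ (λ h →
        flat-∈⁻ pairs₀ (subst (λ k → _ ∈ mem k) (sym flat-pairs₀) (members⁺ h)))
      pairs-distinct (λ {z} h → T⊆W (members⁻ (subst (λ k → z ∈ mem k) flat-pairs₀ h))) four)
  where
  open Matching (matching (# T) T l twice ≤-refl)
  evened : flat (pair-up singles) ≡ singles × length couples + length (pair-up singles) ≡ 4
  evened = pair-up-even singles (length couples) 4 (trans size eight)
  pairs₀ : List (Pair N)
  pairs₀ = couples ++ pair-up singles
  flat-pairs₀ : flat pairs₀ ≡ flat couples ++ singles
  flat-pairs₀ = trans (flat-++ couples (pair-up singles)) (cong (flat couples ++_) (proj₁ evened))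
  four : length pairs₀ ≡ 4
  four = trans (List.length-++ couples) (proj₂ evened)
  pairs-distinct : Distinct (flat pairs₀)
  pairs-distinct = subst Distinct (sym flat-pairs₀) distinct
  V : VSet N
  V = W ∪ ⁅ v ⁆
  outcome : BigClique G V ⊎ (Σ[ col ∈ (Fin N → Fin N) ] (∀ {s t} → (s , t) ∈ₗ pairs₀ →
      Walk G (λ z → z ∈ V × col z ≡ s) s t)) →
            Σ[ col ∈ (Fin N → ℕ) ] (∀ {x y} → x ∈ T → y ∈ T → l x ≡ l y → Walk G (λ z → z ∈ V × col z ≡ l x) x y)
  outcome (inj₁ K) = ⊥-elim (none K)
  outcome (inj₂ (col , link)) = final , walk
    where
    final : Fin N → ℕ
    -- When two unmatched terminals form a couple, the second keeps its own label although it has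
    -- the colour of the first.
    final z = if T z then l z else l (col z)
    final-T : ∀ {z} → z ∈ T → final z ≡ l z
    final-T {z} h = if-true h
    route : ∀ {x y} → (x , y) ∈ₗ pairs₀ → l x ≡ l y → Walk G (λ z → z ∈ V × final z ≡ l x) x y
    route {x} {y} p e = walk-weaken (λ {z} (a , b) → a , inside z b (bool (T z))) (link p)
      where
      inside : ∀ z → col z ≡ x → (T z ≡ true) ⊎ (T z ≡ false) → final z ≡ l x
      inside z b (inj₂ h) = trans (if-false h) (cong l b)
      inside z b (inj₁ h) with flat-∈⁻ pairs₀ (subst (λ k → z ∈ mem k) (sym flat-pairs₀) (members⁺ h))
      ... | s , t , q , inj₁ refl = trans (final-T h) (cong l (trans (sym (proj₂ (walk-head (link q)))) b))
      ... | s , t , q , inj₂ refl with trans (sym (proj₂ (walk-last (link q)))) b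
      ...   | refl = trans (final-T h) (trans (cong l (partner-unique pairs-distinct q p)) (sym e))
    relabel : ∀ {a b x y} → a ≡ b → Walk G (λ z → z ∈ V × final z ≡ a) x y → Walk G (λ z → z ∈ V × final z ≡ b) x y
    relabel refl w = w
    walk : ∀ {x y} → x ∈ T → y ∈ T → l x ≡ l y → Walk G (λ z → z ∈ V × final z ≡ l x) x y
    walk {x} {y} p q e with x Fin.≟ y
    ... | yes refl = stop (∨-introˡ (T⊆W p) , final-T p)
    ... | no n with matched p q n e
    ...   | inj₁ r = route (∈ₗ-++ˡ (pair-up singles) r) e
    ...   | inj₂ r = relabel (sym e) (walk-reverse (route (∈ₗ-++ˡ (pair-up singles) r) (sym e)))

-- T is padded to eight vertices of W, which has at least 15. The padded set contains the terminals
-- of X in W, so vicinities can only grow.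
route-neighbourhood : ∀ {G : Graph N} {W v X T} → W v ≡ false → (∀ {w} → w ∈ W → E G v w ≡ true) → # W ≤ 29 →
    ∃ (_∈ W) →
                      (∀ {w} → w ∈ W → 15 ≤ # (vicinity G W X w)) →
                      ¬ BigClique G (W ∪ ⁅ v ⁆) → T ⊆ W → # T ≤ 8 → X ∩ W ⊆ T → Routable G (W ∪ ⁅ v ⁆) T
route-neighbourhood {N} {G} {W} {v} {X} {T} v∉W v~W W≤29 (w₀ , w₀∈) degree none T⊆W T≤8 X⊆T =
    padded (enlarge {W = W} (8 ∸ # T) T T⊆W room)
  where
  full : # T + (8 ∸ # T) ≡ 8
  full = m+[n∸m]≡n T≤8
  room : # T + (8 ∸ # T) ≤ # W
  room = ≤-respˡ (sym full) (≤-trans (m≤m+n 8 7) (≤-trans (degree w₀∈) (#-mono {Q = W} ∧-left)))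
  padded : (∃ λ Q → T ⊆ Q × Q ⊆ W × # Q ≡ # T + (8 ∸ # T)) → Routable G (W ∪ ⁅ v ⁆) T
  padded (Q , T⊆Q , Q⊆W , e) = routable-⊆ T⊆Q (route-eight v∉W v~W W≤29
    (λ {w} h → ≤-trans (degree h) (#-mono {P = vicinity G W X w} {vicinity G W Q w} λ {x} →
      taut 7 (λ a q e p p′ r r′ → (a ∧ p ⇛ r) ⇒ (p′ ⇛ r′) ⇒ a ∧ not q ∧ (e ∨ (p′ ∧ p)) ⇒
          ! (a ∧ not q ∧ (e ∨ (r′ ∧ r)))) refl
        (W x) (x == w) (E G w x) (X x) (X w) (Q x) (Q w)
        (⇛⁺ {W x ∧ X x} (λ k → T⊆Q (X⊆T (∧⁺ (∧-right {W x} k) (∧-left k)))))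
        (⇛⁺ (λ k → T⊆Q (X⊆T {w} (∧⁺ k h))))))
    none Q⊆W (trans e full))

-- Massed sets of at most eight vertices are routable

incidence-empty : ∀ {G : Graph N} {V C} → (∀ x → C x ≡ false) → incidence G V C ≡ 0
incidence-empty {G = G} {V} {C} h = trans (sum-cong (λ x → #-empty (λ y →
    not⁻ (taut 5 (λ a b e c d → not c ⇒ not d ⇒ ! not (pair a b e c d)) refl
  (V x) (V y) (E G x y) (C x) (C y) (not⁺ (h x)) (not⁺ (h y)))))) (sum-0 (λ _ → refl))

-- The first summand is a lower bound for the pairs that begin outside X, the second counts those
-- that begin in X and end outside.
degree-sum : ∀ {G : Graph N} {V X} → X ⊆ V → (∀ {u} → u ∈ V ∖ X → 30 ≤ # (V ∩ E G u)) →
             30 * # (V ∖ X) + pairs (λ x y → X x ∧ (V y ∧ not (X y)) ∧ E G x y) ≤ incidence G V (V ∖ X)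
degree-sum {N} {G} {V} {X} X⊆V degree = linear 5 (λ n a b I z → 1 · n ≼ a ⇒ 1 · a ⊕ b ⊕ z ≼ I ⊕ z ⊕ z ⇒
    1 · z ≼ con 0 ⇒ ⊢ n ⊕ b ≼ I) refl
    (30 * # (V ∖ X)) (pairs inner) (pairs cross) (incidence G V (V ∖ X)) (pairs none) rows
    (pairs-mono₃ (λ x y → taut 5 (λ a b e c d → (d ⇛ b) ⇒ (c ⇛ a) ⇒
      𝟙 ((a ∧ not c) ∧ b ∧ e) + 𝟙 (c ∧ (b ∧ not d) ∧ e) + 𝟙 false ≼ 𝟙 (pair a b e (a ∧ not c)
          (b ∧ not d)) + 𝟙 false + 𝟙 false) refl
      (V x) (V y) (E G x y) (X x) (X y) (⊆ᵇ X V X⊆V y) (⊆ᵇ X V X⊆V x)))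
    (≤-reflexive (trans (sum-cong (λ x → #-empty (λ _ → refl))) (sum-0 (λ _ → refl))))
  where
  inner cross none : Fin N → Fin N → Bool
  inner x y = (V x ∧ not (X x)) ∧ V y ∧ E G x y
  cross x y = X x ∧ (V y ∧ not (X y)) ∧ E G x y
  none _ _ = false
  rows : 30 * # (V ∖ X) ≤ pairs inner
  rows = sum-≥ 30 {V ∖ X} (λ {x} h → ≤-trans (degree h) (#-mono {P = V ∩ E G x} {Q = inner x} (λ p → ∧⁺ h p)))

module Reduction {N : ℕ} {G : Graph N} {V X : VSet N} (IH : Inductive N (# V)) (X≤8 : # X ≤ 8) (m : Massed G V X)
            (x₀ : Fin N) (x₀∈X : x₀ ∈ X) where

  lost : Fin N → Fin N → VSet N
  lost u v w = V w ∧ E G v w ∧ (w == u ∨ E G u w ∨ (X u ∧ X w))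

  route-clique : BigClique G V → Routable G V X
  route-clique (K , K⊆V , 8≤K , clique) = route-to {Z = K} {D = K} IH X≤8 m K⊆V (λ p → p)
    (λ {x} p → absurd (∧-left {K x} p) (not⁻ (∧-right {K x} p))) (λ _ p → p)
    (inj₂ (≤-trans X≤8 8≤K)) (λ T T⊆K _ _ → routable-clique clique T⊆K)

  module Low {v : Fin N} (v∈ : v ∈ V ∖ X) (low : # (V ∩ E G v) ≤ 29) (none : ¬ BigClique G V) where

    W : VSet N
    W = V ∩ E G v

    v∈V : v ∈ V
    v∈V = ∧-left v∈

    v∉X : X v ≡ false
    v∉X = not⁻ (∧-right {V v} v∈)

    v∉W : W v ≡ false
    v∉W = trans (cong (V v ∧_) (E-irr G v)) (Bool.∧-zeroʳ (V v))

    W∪v⊆V : W ∪ ⁅ v ⁆ ⊆ V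
    W∪v⊆V = insert-⊆ {P = W} {V = V} ∧-left v∈V

    -- The empty set cuts off v, and it is smaller than X because X has an element.
    isolated : (∀ w → W w ≡ false) → Routable G V X
    isolated empty = shrink IH X≤8 m (# (V ∖ ⁅ v ⁆)) ⁅ v ⁆ ∅ ≤-refl
      (sep (λ x → taut 3 (λ a b p → (p ⇛ a ∧ not b) ⇒ ! sep-vertex a b p false) refl (V x) (X x) (x == v)
             (⇛⁺ (λ e → subst (_∈ V ∖ X) (==⁻ˢ e) v∈)))
           (λ x y → taut 5 (λ e f a p q → (p ⇛ e ⇛ f) ⇒ not (a ∧ f) ⇒ ! sep-edge e a p false q false) refl
             (E G x y) (E G v y) (V y) (x == v) (y == v) (==-subst (λ t → E G t y) x v) (not⁺ (empty y))))
      (≤-trans (s≤s (≤-reflexive (#-empty {P = ∅} (λ _ → refl)))) (#-pos {P = X} x₀∈X))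
      (v , ==⁺ v) (λ l _ → l , λ ())

    -- If the edge from v to w fails the test for contraction, `lost w v` has at least 16 elements.
    -- One is w itself, the others lie in the vicinity of w.
    connected : ∃ (_∈ W) → Routable G V X
    connected w₀ = choose (find (λ w → W w ∧ does (# (lost w v) ℕ.≤? 15)))
      where
      choose : ∃ (_∈ λ w → W w ∧ does (# (lost w v) ℕ.≤? 15)) ⊎ (∀ w → W w ∧ does (# (lost w v) ℕ.≤? 15) ≡ false) →
          Routable G V X
      choose (inj₁ (w , h)) = contractible IH X≤8 m (∧-left (∧-left h)) v∈V v∉X (E-sym G (∧-right {V w} (∧-left h)))
        (does⁻ (# (lost w v) ℕ.≤? 15) (∧-right {W w} h))
      choose (inj₂ dense) = route-to {Z = W ∪ ⁅ v ⁆} {D = W} IH X≤8 m W∪v⊆V (λ p → ∨-introˡ p)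
          (λ {x} {y} p q e → ∨-introˡ (∧⁺ q (subst (λ t → E G t y ≡ true) (only-v p) e)))
          (λ {x} p q → in-W p (∨⁻ {W x} q))
          (inj₁ (v , ∧⁺ (∨-introʳ {W v} (==⁺ v)) (not⁺ v∉W)))
          (λ T T⊆W T≤8 X⊆T → route-neighbourhood {X = X} v∉W (λ {w} h → ∧-right {V w} h) low w₀ degree
            (λ (K , s , rest) → none (K , (λ h → W∪v⊆V (s h)) , rest)) T⊆W T≤8 X⊆T)
        where
        only-v : ∀ {x} → x ∈ (W ∪ ⁅ v ⁆) ∖ W → x ≡ v
        only-v {x} p = ==⁻ (taut 2 (λ a b → (a ∨ b) ∧ not a ⇒ ! b) refl (W x) (x == v) p)
        in-W : ∀ {x} → x ∈ X → x ∈ W ⊎ x ∈ ⁅ v ⁆ → x ∈ W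
        in-W p (inj₁ h) = h
        in-W p (inj₂ h) = absurd (subst (_∈ X) (==⁻ h) p) v∉X
        degree : ∀ {w} → w ∈ W → 15 ≤ # (vicinity G W X w)
        degree {w} h = ≤-pred (≤-trans many (≤-respˡ (sym (#-delete-∈ {P = lost w v} {w}
              (∧⁺ (∧-left {V w} h) (∧⁺ (∧-right {V w} h) (∨-introˡ (==⁺ w))))))
            (s≤s (#-mono {P = lost w v ∖ ⁅ w ⁆} λ {x} → taut 5 (λ a e q f g → (a ∧ e ∧ (q ∨ f ∨ g)) ∧ not q ⇒
                ! ((a ∧ e) ∧ not q ∧ (f ∨ g))) refl
              (V x) (E G v x) (x == w) (E G w x) (X w ∧ X x)))))
          where
          many : 16 ≤ # (lost w v)
          many = ≰⇒> (λ k → true≢false (∧⁺ h (does⁺ (# (lost w v) ℕ.≤? 15) k)) (dense w))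

  module High (high : ∀ {u} → u ∈ V ∖ X → 30 ≤ # (V ∩ E G u)) where

    free-edge : ∃ λ u → ∃ λ w → u ∈ V ∖ X × w ∈ V ∖ X × E G u w ≡ true
    free-edge = pick (find (V ∖ X))
      where
      pick : ∃ (_∈ V ∖ X) ⊎ (∀ u → (V ∖ X) u ≡ false) → ∃ λ u → ∃ λ w → u ∈ V ∖ X × w ∈ V ∖ X × E G u w ≡ true
      pick (inj₂ none) = ⊥-elim (<⇒≱ (heavy m) (≤-respˡ (sym (incidence-empty {G = G} {V} none)) z≤n))
      pick (inj₁ (u , h)) with #-size<⇒∃ {P = X} {Q = V ∩ E G u} (≤-trans (s≤s X≤8) (≤-trans (m≤m+n 9 21) (high h)))
      ... | w , k = u , w , h , ∧⁺ (∧-left (∧-left k)) (∧-right {V w ∧ E G u w} k) , ∧-right {V w} (∧-left k)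

    cross : Fin N → Fin N → Bool
    cross x y = X x ∧ (V y ∧ not (X y)) ∧ E G x y

    -- By `degree-sum` at most two edges leave X. But if such an edge from x to w fails the test for
    -- contraction, 16 vertices are lost, at most 8 of them in X, and the others are neighbours of x
    -- outside X. If no edge leaves X, the empty set cuts off everything else, against `light`.
    tight : incidence G V (V ∖ X) ≤ 2 + 30 * # (V ∖ X) → Routable G V X
    tight few = touching (find (λ x → anyᵇ (cross x)))
      where
      touching : ∃ (_∈ λ x → anyᵇ (cross x)) ⊎ (∀ x → anyᵇ (cross x) ≡ false) → Routable G V X
      touching (inj₂ none) = ⊥-elim (<⇒≱ (heavy m) (light m (V ∖ X) ∅
        (sep (λ x → taut 2 (λ a b → ! sep-vertex a b (a ∧ not b) false) refl (V x) (X x))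
             (λ x y → taut 6 (λ e e′ a b c d → (e ⇛ e′) ⇒ not (d ∧ (a ∧ not c) ∧ e′) ⇒
                 ! sep-edge e b (a ∧ not c) false (b ∧ not d) false) refl
               (E G x y) (E G y x) (V x) (V y) (X x) (X y) (⇛⁺ (E-sym G))
               (not⁺ (¬true⇒false (λ h → true≢false (anyᵇ⁺ {P = cross y} {x} h) (none y))))))
        (≤-trans (s≤s (≤-reflexive (#-empty {P = ∅} (λ _ → refl)))) (#-pos {P = X} x₀∈X))))
      touching (inj₁ (x , h)) = compare (anyᵇ⁻ h)
        where
        compare : ∃ (_∈ cross x) → Routable G V X
        compare (w , k) = decide (# (lost x w) ℕ.≤? 15)
          where
          x∈X : x ∈ X
          x∈X = ∧-left k
          w∈ : w ∈ V ∖ X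
          w∈ = ∧-left (∧-right {X x} k)
          many : ¬ (# (lost x w) ≤ 15) → 8 ≤ # (cross x)
          many big = linear 4 (λ l c x c′ → 1 · con 16 ≼ l ⇒ 1 · l ≼ x ⊕ c′ ⇒ 1 · c′ ≼ c ⇒ 1 · x ≼ con 8 ⇒
              ⊢ con 8 ≼ c) refl
            (# (lost x w)) (# (cross x)) (# X) (# (lost x w ∖ X)) (≰⇒> big) (#-∖ (lost x w) X)
            (#-mono {P = lost x w ∖ X} {Q = cross x} λ {y} →
                taut 6 (λ a e q f c d → (q ⇛ d) ⇒ c ⇒ (a ∧ e ∧ (q ∨ f ∨ (c ∧ d))) ∧ not d ⇒
                    ! (c ∧ (a ∧ not d) ∧ f)) refl
              (V y) (E G w y) (y == x) (E G x y) (X x) (X y) (⇛⁺ (λ r → subst (_∈ X) (==⁻ˢ r) x∈X)) x∈X) X≤8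
          total : 8 ≤ # (cross x) → 8 ≤ pairs cross
          total big = ≤-trans (≤-trans (*-monoʳ-≤ 8 (#-pos {P = ⁅ x ⁆} (==⁺ x))) (sum-≥ 8 {⁅ x ⁆} (λ {y} r →
            subst (λ t → 8 ≤ # (cross t)) (==⁻ˢ r) big))) ≤-refl
          decide : Dec (# (lost x w) ≤ 15) → Routable G V X
          decide (yes small) = contractible IH X≤8 m (X⊆V m x∈X) (∧-left w∈) (not⁻ (∧-right {V w} w∈))
            (∧-right {V w ∧ not (X w)} (∧-right {X x} k)) small
          decide (no big) = ⊥-elim (<-irrefl refl (linear 3 (λ n c I → 1 · n ⊕ c ≼ I ⇒ 1 · I ≼ con 2 ⊕ n ⇒
              1 · con 8 ≼ c ⇒ ⊢ con 1 ≼ con 0) refl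
            (30 * # (V ∖ X)) (pairs cross) (incidence G V (V ∖ X)) (degree-sum {G = G} {V} {X} (X⊆V m) high) few
                (total (many big))))

    spread : (∀ u v → Massed (delete G u v) V X → u ∈ V ∖ X → v ∈ V ∖ X → E G u v ≡ true →
        Routable (delete G u v) V X) → Routable G V X
    spread IH′ = decide (<-≤-connex (2 + 30 * # (V ∖ X)) (incidence G V (V ∖ X)))
      where
      decide : 2 + 30 * # (V ∖ X) < incidence G V (V ∖ X) ⊎ incidence G V (V ∖ X) ≤ 2 + 30 * # (V ∖ X) →
          Routable G V X
      decide (inj₁ spare) = let u , v , p , q , e = free-edge in deletable IH X≤8 m p q spare (λ m′ → IH′ u v m′ p q e)
      decide (inj₂ few)   = tight few

  reduce : (∀ u v → Massed (delete G u v) V X → u ∈ V ∖ X → v ∈ V ∖ X → E G u v ≡ true →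
      Routable (delete G u v) V X) → Routable G V X
  reduce IH′ = by-clique (big-clique? G V)
    where
    by-degree : ¬ BigClique G V → ∃ (_∈ λ v → (V ∖ X) v ∧ does (# (V ∩ E G v) ℕ.≤? 29)) ⊎
                (∀ v → (V ∖ X) v ∧ does (# (V ∩ E G v) ℕ.≤? 29) ≡ false) → Routable G V X
    by-degree none (inj₁ (v , h)) = by-neighbour (find (V ∩ E G v))
      where
      open Low (∧-left h) (does⁻ (# (V ∩ E G v) ℕ.≤? 29) (∧-right {(V ∖ X) v} h)) none
      by-neighbour : ∃ (_∈ V ∩ E G v) ⊎ (∀ w → (V ∩ E G v) w ≡ false) → Routable G V X
      by-neighbour (inj₁ w₀)    = connected w₀
      by-neighbour (inj₂ empty) = isolated empty
    by-degree none (inj₂ all) = High.spread (λ {u} h → ≰⇒> (λ k →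
      true≢false (∧⁺ h (does⁺ (# (V ∩ E G u) ℕ.≤? 29) k)) (all u))) IH′
    by-clique : BigClique G V ⊎ ¬ BigClique G V → Routable G V X
    by-clique (inj₁ K)    = route-clique K
    by-clique (inj₂ none) = by-degree none (find (λ v → (V ∖ X) v ∧ does (# (V ∩ E G v) ℕ.≤? 29)))

delete-fewer : ∀ {G : Graph N} {V X u v} → u ∈ V ∖ X → v ∈ V ∖ X → E G u v ≡ true →
               incidence (delete G u v) V (V ∖ X) < incidence G V (V ∖ X)
delete-fewer {N} {G} {V} {X} {u} {v} p q e = linear 4 (λ I I′ d z → 1 · I′ ⊕ d ⊕ z ≼ I ⊕ z ⊕ z ⇒ 1 · con 1 ≼ d ⇒
    1 · z ≼ con 0 ⇒ ⊢ con 1 ⊕ I′ ≼ I) refl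
    (incidence G V (V ∖ X)) (incidence (delete G u v) V (V ∖ X)) (pairs (λ x y → x == u ∧ ⁅ v ⁆ y)) (pairs none)
    (pairs-mono₃ (λ x y → taut 9 (λ a b f c d xu yv xv yu → (xu ∧ yv ⇛ pair a b f c d) ⇒
      𝟙 (pair a b (f ∧ not ((xu ∧ yv) ∨ (xv ∧ yu))) c d) + 𝟙 (xu ∧ yv) + 𝟙 false ≼ 𝟙 (pair a b f c d) + 𝟙 false + 𝟙 false) refl
      (V x) (V y) (E G x y) ((V ∖ X) x) ((V ∖ X) y) (x == u) (y == v) (x == v) (y == u)
          (⇛⁺ {x == u ∧ y == v} (present x y))))
    (≤-respʳ (sym (pairs-δˡ u ⁅ v ⁆)) (#-pos {P = ⁅ v ⁆} (==⁺ v)))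
    (≤-reflexive (trans (sum-cong (λ x → #-empty (λ _ → refl))) (sum-0 (λ _ → refl))))
  where
  none : Fin N → Fin N → Bool
  none _ _ = false
  present : ∀ x y → x == u ∧ y == v ≡ true → pair (V x) (V y) (E G x y) ((V ∖ X) x) ((V ∖ X) y) ≡ true
  present x y h with ==⁻ (∧-left h) | ==⁻ (∧-right {x == u} h)
  ... | refl | refl = ∧⁺ (∧-left {V u} p) (∧⁺ (∧-left {V v} q) (∧⁺ e (∨-introˡ p)))

-- Nested inductions: parts, cliques on separators and contractions lower the number of vertices,
-- while deleting an edge only lowers the number of edges.
massed⇒routable : ∀ n k {G : Graph N} {V X} → # V ≤ n → incidence G V (V ∖ X) ≤ k → # X ≤ 8 → Massed G V X →
    Routable G V X
massed⇒routable {N} n k {G} {V} {X} V≤n inc≤k X≤8 m = by-terminals (find X)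
  where
  IH : ∀ n → # V ≤ n → Inductive N (# V)
  IH zero    V≤n less = ⊥-elim (n≮0 (<-≤-trans less V≤n))
  IH (suc n) V≤n {G′} {V′} {X′} less = massed⇒routable n (incidence G′ V′ (V′ ∖ X′))
      (≤-pred (<-≤-trans less V≤n)) ≤-refl
  IH′ : ∀ k → incidence G V (V ∖ X) ≤ k → ∀ u v → Massed (delete G u v) V X → u ∈ V ∖ X → v ∈ V ∖ X →
      E G u v ≡ true → Routable (delete G u v) V X
  IH′ zero    inc≤k u v m′ p q e = ⊥-elim (n≮0 (<-≤-trans (delete-fewer {G = G} {V} {X} p q e) inc≤k))
  IH′ (suc k) inc≤k u v m′ p q e = massed⇒routable n k V≤n (≤-pred
      (<-≤-trans (delete-fewer {G = G} {V} {X} p q e) inc≤k)) X≤8 m′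
  by-terminals : ∃ (_∈ X) ⊎ (∀ x → X x ≡ false) → Routable G V X
  by-terminals (inj₂ none) l _ = l , λ {x} h → absurd h (none x)
  by-terminals (inj₁ (x , h)) = Reduction.reduce (IH n V≤n) X≤8 m x h (IH′ k inc≤k)

-- Highly connected graphs are massed

graph : FiniteGraph N → Graph N
graph G = record
  { E     = λ u v → does (adj? u v)
  ; E-sym = λ {u} {v} e → does⁺ (adj? v u) (G.sym (does⁻ (adj? u v) e))
  ; E-irr = λ u → doesnt⁺ (adj? u u) (G.irrefl refl)
  }
  where
  module G = SimpleGraph G
  open G using (adj?)

opaque
  unfolding #

  ∣tabulate∣ : (P : VSet N) → ∣ tabulate P ∣ ≡ # P
  ∣tabulate∣ {zero}  P = refl
  ∣tabulate∣ {suc N} P with P zero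
  ... | true  = cong suc (∣tabulate∣ (λ i → P (suc i)))
  ... | false = ∣tabulate∣ (λ i → P (suc i))

  #-full : # {N} (λ _ → true) ≡ N
  #-full {zero}  = refl
  #-full {suc N} = cong suc (#-full {N})

module _ (G : FiniteGraph N) where

  open Graph (graph G) using () renaming (E to e)

  closed-path : ∀ {S C : VSet N} → (∀ {x y} → x ∈ C → e x y ≡ true → y ∈ C ∪ S) →
                ∀ {a b : Refinement (Fin N) (λ v → ¬ (v Data.Fin.Subset.∈ tabulate S))} vs →
                Linked (λ x y → SimpleGraph.Adj G (value x) (value y)) vs → head vs ≡ just a → last vs ≡ just b →
                value a ∈ C → value b ∈ C
  closed-path closed (x ∷ [])     _       refl refl h = h
  closed-path {S} {C} closed {b = b} (x ∷ y ∷ vs) (p ∷ l) refl q h = closed-path closed (y ∷ vs) l refl q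
      (stay (∨⁻ {C (value y)} (closed h (does⁺ (SimpleGraph.adj? G (value x) (value y)) p))))
    where
    stay : value y ∈ C ⊎ value y ∈ S → value y ∈ C
    stay (inj₁ k) = k
    stay (inj₂ k) = avoid (proof y)
      where
      avoid : Irrelevant (¬ (value y Data.Fin.Subset.∈ tabulate S)) → value y ∈ C
      avoid [ ∉S ] = ⊥-elim-irr (∉S (Vec.lookup⇒[]= (value y) (tabulate S)
          (trans (Vec.lookup∘tabulate S (value y)) k)))

  no-separation : ∀ {m} → m -connected G → ∀ {C S : VSet N} → # S < m → (∀ {x y} → x ∈ C → e x y ≡ true → y ∈ C ∪ S) →
                  ∀ {a b} → a ∈ C → S a ≡ false → C b ≡ false → S b ≡ false → ⊥
  no-separation (_ , connected) {C} {S} small closed {a} {b} a∈C a∉S b∉C b∉S =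
    true≢false (closed-path closed (Path.vertices path) (Path.linked path) (Path.starts path)
        (Path.ends path) a∈C) b∉C
    where
    outside : ∀ {x} → S x ≡ false → ¬ (x Data.Fin.Subset.∈ tabulate S)
    outside {x} h p = true≢false (trans (sym (Vec.lookup∘tabulate S x)) (Vec.[]=⇒lookup p)) h
    path : Path (G ─ tabulate S) (a , [ outside a∉S ]) (b , [ outside b∉S ])
    path = connected (tabulate S) (≤-trans (s≤s (≤-reflexive (∣tabulate∣ S))) small) (a , [ outside a∉S ]) (b ,
        [ outside b∉S ])

  -- Otherwise the neighbours of u separate it from a further vertex, which exists as there are more
  -- than m vertices.
  min-degree : ∀ {m} → m -connected G → ∀ u → m ≤ # (e u)
  min-degree {m} conn@(m<N , _) u = ≮⇒≥ λ small → split small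
      (#-size<⇒∃ {P = e u ∪ ⁅ u ⁆} {Q = λ _ → true} (few small))
    where
    few : # (e u) < m → # (e u ∪ ⁅ u ⁆) < # {N} (λ _ → true)
    few small = ≤-trans (s≤s (≤-trans (#-∪ (e u) ⁅ u ⁆) (≤-trans (+-monoʳ-≤ (# (e u)) (#-⁅⁆ u))
      (≤-respˡ (sym (+-comm (# (e u)) 1)) small)))) (≤-respʳ (sym #-full) m<N)
    split : # (e u) < m → ∃ (_∈ (λ _ → true) ∖ (e u ∪ ⁅ u ⁆)) → ⊥
    split small (w , h) = no-separation conn {C = ⁅ u ⁆} {S = e u} small
      (λ {x} {y} p q → ∨-introʳ {y == u} (subst (λ z → e z y ≡ true) (==⁻ p) q))
      {u} {w} (==⁺ u) (E-irr (graph G) u)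
      (not⁻ (taut 2 (λ a b → not (a ∨ b) ⇒ ! not b) refl (e u w) (w == u) h))
      (not⁻ (taut 2 (λ a b → not (a ∨ b) ⇒ ! not a) refl (e u w) (w == u) h))

  -- All degrees are at least 30, and an edge leaving X, which exists as 30 exceeds 8, makes the
  -- inequality strict. Parts as in `light` are empty, since a terminal outside S lies beyond the
  -- separation.
  connected⇒massed : 30 -connected G → ∀ {X} → # X ≤ 8 → ∃ (_∈ X) → Massed (graph G) (λ _ → true) X
  connected⇒massed conn {X} X≤8 (x , x∈X) = record { X⊆V = λ _ → refl ; heavy = heavy′ ; light = light′ }
    where
    V : VSet N
    V _ = true
    degree : ∀ u → 30 ≤ # (V ∩ e u)
    degree u = ≤-trans (min-degree conn u) (#-mono {P = e u} {Q = V ∩ e u} (λ p → p))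
    cross : Fin N → Fin N → Bool
    cross x y = X x ∧ (V y ∧ not (X y)) ∧ e x y
    crossing : 1 ≤ pairs cross
    crossing = outside (#-size<⇒∃ {P = X} {Q = e x} (≤-trans (s≤s X≤8) (≤-trans (m≤m+n 9 21) (min-degree conn x))))
      where
      outside : ∃ (_∈ e x ∖ X) → 1 ≤ pairs cross
      outside (y , h) = ≤-trans (*-monoʳ-≤ 1 (#-pos {P = ⁅ x ⁆} (==⁺ x))) (sum-≥ 1 {⁅ x ⁆} (λ {z} p →
        #-pos {P = cross z} {y} (subst (λ t → y ∈ cross t) (==⁻ˢ p) (∧⁺ x∈X (∧⁺ (∧-right {e x y} h) (∧-left h))))))
    heavy′ : 30 * # (V ∖ X) < incidence (graph G) V (V ∖ X)
    heavy′ = ≤-trans (≤-respˡ (sym (+-comm 1 (30 * # (V ∖ X)))) (+-monoʳ-≤ _ crossing))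
      (degree-sum {G = graph G} {V} {X} (λ _ → refl) (λ {u} _ → degree u))
    light′ : ∀ C S → Sep (graph G) V X C S → # S < # X → incidence (graph G) V C ≤ 30 * # C
    light′ C S σ S<X = nonempty (find C)
      where
      nonempty : ∃ (_∈ C) ⊎ (∀ c → C c ≡ false) → incidence (graph G) V C ≤ 30 * # C
      nonempty (inj₂ none) = ≤-respˡ (sym (incidence-empty {G = graph G} {V} none)) z≤n
      nonempty (inj₁ (c , c∈C)) = terminal (#-size<⇒∃ {P = S} {Q = X} S<X)
        where
        terminal : ∃ (_∈ X ∖ S) → incidence (graph G) V C ≤ 30 * # C
        terminal (w , h) = ⊥-elim (no-separation conn {C = C} {S = S} (<-≤-trans S<X (≤-trans X≤8 (m≤m+n 8 22)))
          (λ {x} {y} p q → taut 5 (λ e c s c′ s′ → sep-edge e true c s c′ s′ ⇒ c ⇒ e ⇒ ! (c′ ∨ s′)) refl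
            (e x y) (C x) (S x) (C y) (S y) (sep-across σ x y) p q)
          {c} {w} c∈C (not⁻ (taut 3 (λ x c s → sep-vertex true x c s ⇒ c ⇒ ! not s) refl (X c) (C c) (S c)
              (sep-at σ c) c∈C))
          (not⁻ (taut 3 (λ x c s → sep-vertex true x c s ⇒ x ∧ not s ⇒ ! not c) refl (X w) (C w) (S w)
              (sep-at σ w) h))
          (not⁻ (∧-right {X w} h)))

-- Linked graphs

∈ₗ⇒mem : ∀ {ℓ} {z : Fin N} → z ∈ₗ ℓ → z ∈ mem ℓ
∈ₗ⇒mem {z = z} (here refl)          = ∨-introˡ (==⁺ z)
∈ₗ⇒mem {ℓ = x ∷ ℓ} {z} (there p) = ∨-introʳ {z == x} (∈ₗ⇒mem p)

∉⇒All≢ : ∀ {x : Fin N} ℓ → mem ℓ x ≡ false → All (x ≢_) ℓ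
∉⇒All≢ []      h = []
∉⇒All≢ {x = x} (y ∷ ℓ) h = (λ { refl → true≢false (∨-introˡ (==⁺ x)) h }) ∷
  ∉⇒All≢ ℓ (¬true⇒false (λ p → true≢false (∨-introʳ {x == y} p) h))

distinct⇒unique : ∀ (ℓ : List (Fin N)) → Distinct ℓ → Unique ℓ
distinct⇒unique []      d = []
distinct⇒unique (x ∷ ℓ) d = ∉⇒All≢ ℓ (distinct-head {ℓ = ℓ} d) ∷ distinct⇒unique ℓ (distinct-tail {x = x} {ℓ = ℓ} d)

chain⇒path : ∀ (G : FiniteGraph N) {s ℓ t} → Chain (graph G) s ℓ t → Distinct ℓ → Path G s t
chain⇒path G {s} {ℓ} {t} c d = record
  { vertices = ℓ ; linked = proj₁ (walk c) ; distinct = distinct⇒unique ℓ d ; starts =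
      proj₁ (proj₂ (walk c)) ; ends = proj₂ (proj₂ (walk c)) }
  where
  walk : ∀ {s ℓ} → Chain (graph G) s ℓ t → Linked (SimpleGraph.Adj G) ℓ × head ℓ ≡ just s × last ℓ ≡ just t
  walk [ s ] = [-] , refl , refl
  walk (_∷_ {s} {x} e c@([ _ ])) = let l , h , k = walk c in does⁻ (SimpleGraph.adj? G s x) e ∷ l , refl , k
  walk (_∷_ {s} {x} e c@(_ ∷ _)) = let l , h , k = walk c in does⁻ (SimpleGraph.adj? G s x) e ∷ l , refl , k

routable⇒linked : ∀ (G : FiniteGraph N) → 8 ≤ N →
                  (∀ {X} → # X ≤ 8 → ∃ (_∈ X) → Routable (graph G) (λ _ → true) X) → 4 -linked G
routable⇒linked {N} G 8≤N routable = 8≤N , link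
  where
  link : ∀ (u v : Fin 4 → Fin N) → Injective _≡_ _≡_ [ u , v ]′ → Σ[ P ∈ (∀ i → Path G (u i) (v i)) ]
         (∀ i j → i ≢ j → ∀ {z} → ¬ (z ∈ₗ Path.vertices (P i) × z ∈ₗ Path.vertices (P j)))
  link u v inj = deliver (routable X≤8 (u zero , u∈X zero) label twice)
    where
    owns : Fin N → VSet 4
    owns z i = z == u i ∨ z == v i
    X : VSet N
    X z = anyᵇ (owns z)
    u∈X : ∀ i → u i ∈ X
    u∈X i = anyᵇ⁺ {P = owns (u i)} {i} (∨-introˡ (==⁺ (u i)))
    v∈X : ∀ i → v i ∈ X
    v∈X i = anyᵇ⁺ {P = owns (v i)} {i} (∨-introʳ {v i == u i} (==⁺ (v i)))
    owner-unique : ∀ {z i j} → i ∈ owns z → j ∈ owns z → i ≡ j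
    owner-unique {z} {i} {j} p q with ∨⁻ {z == u i} p | ∨⁻ {z == u j} q
    ... | inj₁ a | inj₁ b with inj {inj₁ i} {inj₁ j} (trans (==⁻ˢ a) (==⁻ b))
    ...   | refl = refl
    owner-unique {z} {i} {j} p q | inj₂ a | inj₂ b with inj {inj₂ i} {inj₂ j} (trans (==⁻ˢ a) (==⁻ b))
    ...   | refl = refl
    owner-unique {z} {i} {j} p q | inj₁ a | inj₂ b with inj {inj₁ i} {inj₂ j} (trans (==⁻ˢ a) (==⁻ b))
    ...   | ()
    owner-unique {z} {i} {j} p q | inj₂ a | inj₁ b with inj {inj₂ i} {inj₁ j} (trans (==⁻ˢ a) (==⁻ b))
    ...   | ()
    label : Fin N → ℕ
    label z = index (find (owns z))
      where
      index : ∃ (_∈ owns z) ⊎ (∀ i → owns z i ≡ false) → ℕ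
      index (inj₁ (i , _)) = toℕ i
      index (inj₂ _)       = 0
    label-owner : ∀ {z i} → i ∈ owns z → label z ≡ toℕ i
    label-owner {z} {i} p with find (owns z)
    ... | inj₁ (j , q) = cong toℕ (owner-unique {z} q p)
    ... | inj₂ none    = absurd p (none i)
    label-u : ∀ i → label (u i) ≡ toℕ i
    label-u i = label-owner {u i} (∨-introˡ (==⁺ (u i)))
    label-v : ∀ i → label (v i) ≡ toℕ i
    label-v i = label-owner {v i} (∨-introʳ {v i == u i} (==⁺ (v i)))
    same-owner : ∀ {x y} → x ∈ X → y ∈ X → label x ≡ label y → ∃ λ i → i ∈ owns x × i ∈ owns y
    same-owner {x} {y} p q e = let i , a = anyᵇ⁻ {P = owns x} p ; j , b = anyᵇ⁻ {P = owns y} q in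
      i , a , subst (_∈ owns y) (Fin.toℕ-injective (trans (sym (label-owner {y} b))
          (trans (sym e) (label-owner {x} a)))) b
    twice : AtMostTwice X label
    twice {x} {y} {z} p q r e f with same-owner {x} {y} p q e | same-owner {y} {z} q r f
    ... | i , a , b | j , b′ , c with owner-unique {y} b b′
    -- All three vertices belong to pair i, so two of them are the same end of it.
    ...   | refl with ∨⁻ {x == u i} a | ∨⁻ {y == u i} b | ∨⁻ {z == u i} c
    ...     | inj₁ h | inj₁ k | _      = inj₁ (trans (==⁻ h) (==⁻ˢ k))
    ...     | inj₂ h | inj₂ k | _      = inj₁ (trans (==⁻ h) (==⁻ˢ k))
    ...     | inj₁ h | inj₂ _ | inj₁ k = inj₂ (inj₂ (trans (==⁻ h) (==⁻ˢ k)))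
    ...     | inj₂ h | inj₁ _ | inj₂ k = inj₂ (inj₂ (trans (==⁻ h) (==⁻ˢ k)))
    ...     | inj₁ _ | inj₂ h | inj₂ k = inj₂ (inj₁ (trans (==⁻ h) (==⁻ˢ k)))
    ...     | inj₂ _ | inj₁ h | inj₁ k = inj₂ (inj₁ (trans (==⁻ h) (==⁻ˢ k)))
    listed : List (Fin 4) → List (Fin N)
    listed []       = []
    listed (i ∷ is) = u i ∷ v i ∷ listed is
    four : List (Fin 4)
    four = zero ∷ suc zero ∷ suc (suc zero) ∷ suc (suc (suc zero)) ∷ []
    all-four : ∀ i → i ∈ₗ four
    all-four zero                   = here refl
    all-four (suc zero)             = there (here refl)
    all-four (suc (suc zero))       = there (there (here refl))
    all-four (suc (suc (suc zero))) = there (there (there (here refl)))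
    listed-∈ : ∀ {z i is} → i ∈ owns z → i ∈ₗ is → z ∈ mem (listed is)
    listed-∈ {z} {i} p (here refl) with ∨⁻ {z == u i} p
    ... | inj₁ a = ∨-introˡ a
    ... | inj₂ a = ∨-introʳ {z == u i} (∨-introˡ a)
    listed-∈ {z} {i} {j ∷ is} p (there q) = ∨-introʳ {z == u j} (∨-introʳ {z == v j} (listed-∈ {z} p q))
    X⊆listed : X ⊆ mem (listed four)
    X⊆listed {z} p = let i , a = anyᵇ⁻ {P = owns z} p in listed-∈ {z} a (all-four i)
    X≤8 : # X ≤ 8
    X≤8 = ≤-trans (#-count X (listed four)) (+-mono-≤ (≤-reflexive (#-empty {P = X ∖ mem (listed four)} (λ z →
      not⁻ (taut 2 (λ a b → (a ⇛ b) ⇒ ! not (a ∧ not b)) refl (X z) (mem (listed four) z) (⇛⁺ {X z} X⊆listed)))))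
      (count≤length X (listed four)))
    deliver : Σ[ col ∈ (Fin N → ℕ) ] (∀ {x y} → x ∈ X → y ∈ X → label x ≡ label y →
        Walk (graph G) (λ z → true ≡ true × col z ≡ label x) x y) →
              Σ[ P ∈ (∀ i → Path G (u i) (v i)) ] (∀ i j → i ≢ j → ∀ {z} →
                  ¬ (z ∈ₗ Path.vertices (P i) × z ∈ₗ Path.vertices (P j)))
    deliver (col , walks) = path , disjoint
      where
      Track : Fin 4 → Set
      Track i = ∃ λ ℓ → Chain (graph G) (u i) ℓ (v i) × Distinct ℓ × (∀ {z} → z ∈ mem ℓ → col z ≡ toℕ i)
      simple : ∀ i → (∃ λ ℓ → Chain (graph G) (u i) ℓ (v i) ×
          (∀ {z} → z ∈ mem ℓ → true ≡ true × col z ≡ label (u i))) → Track i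
      simple i (ℓ , c , coloured) = let ℓ′ , c′ , d , _ , sub = erase c in
        ℓ′ , c′ , d , λ {z} h → trans (proj₂ (coloured {z} (sub {z} h))) (label-u i)
      track : ∀ i → Track i
      track i = simple i (walk-chain (walks (u∈X i) (v∈X i) (trans (label-u i) (sym (label-v i)))))
      path : ∀ i → Path G (u i) (v i)
      path i = chain⇒path G (proj₁ (proj₂ (track i))) (proj₁ (proj₂ (proj₂ (track i))))
      coloured : ∀ i {z} → z ∈ₗ Path.vertices (path i) → col z ≡ toℕ i
      coloured i p = proj₂ (proj₂ (proj₂ (track i))) (∈ₗ⇒mem p)
      disjoint : ∀ i j → i ≢ j → ∀ {z} → ¬ (z ∈ₗ Path.vertices (path i) × z ∈ₗ Path.vertices (path j))
      disjoint i j i≢j (p , q) = i≢j (Fin.toℕ-injective (trans (sym (coloured i p)) (coloured j q)))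

connected⇒linked : ∀ (G : FiniteGraph N) → 30 -connected G → 4 -linked G
connected⇒linked G conn = routable⇒linked G (≤-trans (m≤m+n 8 23) (proj₁ conn)) (λ X≤8 x →
  massed⇒routable _ _ ≤-refl ≤-refl X≤8 (connected⇒massed G conn X≤8 x))

-- Without a least element, no number below any given bound has the property, by induction on the
-- bound.
¬¬-least : ∀ {ℓ} {P : ℕ → Set ℓ} {n} → P n → ¬ ¬ (∃[ m ] (P m × (∀ m′ → P m′ → m ≤ m′)))
¬¬-least {P = P} {n} p none = below (suc n) n ≤-refl p
  where
  below : ∀ k m → m < k → ¬ P m
  below (suc k) m m<k q = none (m , q , λ m′ q′ → ≮⇒≥ (λ m′<m → below k m′ (<-≤-trans m′<m (≤-pred m<k)) q′))

theorem1p4 : (∀ {n} (G : FiniteGraph n) → 30 -connected G → 4 -linked G) ×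
    (¬ ¬ (∃[ m ] IsG 4 m)) ×
    (∀ m → IsG 4 m → m ≤ 30)
theorem1p4 = connected⇒linked , ¬¬-least {P = λ m → ConnectivityForcesLinked m 4} {n = 30} connected⇒linked ,
  λ m (_ , least) → least 30 connected⇒linked
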